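{- The map \[ \theta^{(10)}:\mathfrak{stab}_{\mathfrak{Lie}(X)}(\Delta_Y)\to\mathfrak{stab}_{\mathfrak{Lie}(B)}(\tau),\qquad \psi+\lambda_1x_1+\lambda_0x_0\mapsto\theta(\psi)+\lambda_1b_1+\lambda_0b_0\quad(\psi\in\mathfrak{ls},\ \lambda_0,\lambda_1\in\mathbb{Q}), \] is an injective Lie algebra morphism from $(\mathfrak{stab}_{\mathfrak{Lie}(X)}(\Delta_Y),\{ -,-\})$ to $(\mathfrak{stab}_{\mathfrak{Lie}(B)}(\tau),\{ -,-\}_A)$.
   Context: Setting X/Y: $\mathbb{Q}\langle X\rangle$ is the free associative $\mathbb{Q}$-algebra on $X=\{x_0,x_1\}$ with coproduct $\Delta_X(x_i)=x_i\otimes1+1\otimes x_i$ (algebra morphism); $\mathfrak{Lie}(X)$ is the free Lie algebra on $X$ (= $\Delta_X$-primitives). $\mathbb{Q}\langle Y\rangle$ is the free associative algebra on $Y=\{y_1,y_2,\dots\}$ with $\Delta_Y(y_n)=y_n\otimes1+1\otimes y_n$. Identify $\mathbb{Q}\langle Y\rangle\subset\mathbb{Q}\langle X\rangle$ via $y_n\mapsto x_0^{n-1}x_1$; $\pi_Y:\mathbb{Q}\langle X\rangle\to\mathbb{Q}\langle Y\rangle$ sends $x_0^{k_1-1}x_1\cdots x_0^{k_d-1}x_1x_0^r$ to $y_{k_1}\cdots y_{k_d}$ if $r=0$, to $0$ otherwise. $(\psi\mid w)$ is the coefficient of a word $w$ in $\psi$. For $\psi\in\mathbb{Q}\langle X\rangle$,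 $d_\psi$ is the derivation with $d_\psi(x_0)=0$, $d_\psi(x_1)=[x_1,\psi]$; the Ihara bracket $\{\psi_1,\psi_2\}=d_{\psi_1}(\psi_2)-d_{\psi_2}(\psi_1)+[\psi_1,\psi_2]$ is a Lie bracket on $\mathfrak{Lie}(X)$. For $\psi\in\mathfrak{Lie}(X)$, $s_\psi=\ell_\psi+d_\psi$ ($\ell_\psi$ = left multiplication) preserves $\mathbb{Q}\langle X\rangle x_0$, and $s^Y_\psi$ is the unique linear endomorphism of $\mathbb{Q}\langle Y\rangle$ with $\pi_Y\circ s_\psi=s^Y_\psi\circ\pi_Y$. $\mathfrak{stab}_{\mathfrak{Lie}(X)}(\Delta_Y)=\{\psi\in\mathfrak{Lie}(X)\mid(s^Y_\psi\otimes\mathrm{id}+\mathrm{id}\otimes s^Y_\psi)\circ\Delta_Y=\Delta_Y\circ s^Y_\psi\}$. $\mathfrak{ls}$ is the set of $\psi\in\mathbb{Q}\langle X\rangle$ with $(\psi\mid x_0)=(\psi\mid x_1)=0$, $\psi$ $\Delta_X$-primitive, $\pi_Y(\psi)$ $\Delta_Y$-primitive, and $(\psi\mid x_0^{n-1}x_1)=0$ for even $n\ge2$. Setting B: $\mathbb{Q}\langle B\rangle$ is the free algebra on $B=\{b_0,b_1,\dots\}$ with $\Delta_B(b_i)=b_i\otimes1+1\otimes b_i$; $\mathfrak{Lie}(B)$ its primitives. $\mathbb{Q}\langle B\rangle^0$ is the span (and subalgebra) of words not ending in $b_0$, $\pi_0$ the projection killing words ending in $b_0$. For a word $w=b_0^{m_1}b_{k_1}\cdots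 b_0^{m_d}b_{k_d}b_0^{m_{d+1}}$ ($d\ge1$), $\mathbf{k}=(k_1,\dots,k_d)$, $\mathbf{l}\in\mathbb{Z}_{>0}^d$, $w(\mathbf{l})$ replaces each $b_{k_i}$ by $b_{l_i}$; $\partial_w$ is the derivation with $\partial_w(b_0)=0$, $\partial_w(b_i)=\sum_{\mathbf{l}\le\mathbf{k}}(-1)^{|\mathbf{k}|+|\mathbf{l}|}\prod_j\binom{k_j-1}{l_j-1}[b_{i+|\mathbf{k}|-|\mathbf{l}|},w(\mathbf{l})]$ ($i\ge1$, $|\mathbf{k}|=\sum k_j$, $\mathbf{l}\le\mathbf{k}$ componentwise); for $w=b_0^m$, $\partial_w(b_0)=0$, $\partial_w(b_i)=[b_i,w]$; extend linearly in $w$. $\{\psi_1,\psi_2\}_A=\partial_{\psi_1}(\psi_2)-\partial_{\psi_2}(\psi_1)+[\psi_1,\psi_2]$ is a Lie bracket on $\mathfrak{Lie}(B)$. For $\psi\in\mathfrak{Lie}(B)$, $\sigma_\psi=\ell_\psi+\partial_\psi$ preserves $\mathbb{Q}\langle B\rangle b_0$ and induces $\sigma^0_\psi$ on $\mathbb{Q}\langle B\rangle^0$ with $\pi_0\circ\sigma_\psi=\sigma^0_\psi\circ\pi_0$. $\tau$ is the algebra antiautomorphism of $\mathbb{Q}\langle B\rangle^0$ with $\tau(b_0^mb_k)=b_0^{k-1}b_{m+1}$. $\mathfrak{stab}_{\mathfrak{Lie}(B)}(\tau)=\{\psi\in\mathfrak{Lie}(B)\mid\sigma^0_\psi\circ\tau=\tau\circ\sigma^0_\psi\}$.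 $\mathfrak{lq}$ is the set of $\psi\in\mathbb{Q}\langle B\rangle$ with $(\psi\mid b_0)=0$, $\psi$ $\Delta_B$-primitive, $\tau(\pi_0(\psi))=\pi_0(\psi)$, and $(\psi\mid b_0^mb_k)=0$ whenever $k+m$ is even. Known facts used: $\mathfrak{stab}_{\mathfrak{Lie}(X)}(\Delta_Y)=\mathfrak{ls}\oplus\mathbb{Q}x_1\oplus\mathbb{Q}x_0$ and $\mathfrak{stab}_{\mathfrak{Lie}(B)}(\tau)=\mathfrak{lq}\oplus\mathbb{Q}b_0$ (direct sums); $\mathfrak{ls}$ and $\mathfrak{lq}$ are Lie subalgebras. Let $\theta_X:\mathbb{Q}\langle X\rangle\to\mathbb{Q}\langle B\rangle$ be the algebra morphism $x_i\mapsto b_i$ ($i=0,1$), $\theta_Y:\mathbb{Q}\langle Y\rangle\to\mathbb{Q}\langle B\rangle^0$ the algebra antimorphism $y_n\mapsto b_n$, and $\theta(\psi)=\theta_X(\psi)+\theta_Y(\pi_Y(\psi))$; it is known that $\theta$ is an injective Lie algebra morphism $(\mathfrak{ls},\{ -,-\})\to(\mathfrak{lq},\{ -,-\}_A)$. -}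

module Defs where

open import Data.Nat as ℕ using (ℕ; zero; suc)
open import Data.Nat.Combinatorics using (_C_)
open import Data.Integer as ℤ using (+_)
open import Data.Rational as ℚ using (ℚ; 0ℚ; 1ℚ; _/_)
open import Data.List using (List; []; _∷_; _++_; map; concatMap; foldr; replicate; upTo)
open import Data.Maybe using (Maybe; just; nothing)
open import Data.Product using (_×_; _,_)
open import Data.Bool using (Bool; true; false)
open import Relation.Binary.PropositionalEquality using (_≡_; refl)
open import Relation.Binary.Definitions using (DecidableEquality)
open import Relation.Nullary using (yes; no)
import Data.List.Properties as LP

-- Generic free associative ℚ-algebras ℚ⟨A⟩, represented by finite formal
-- linear combinations of words; equality is equality of all coefficients.

Word : Set → Set
Word A = List A

Poly : Set → Set
Poly A = List (ℚ × Word A)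

-- elements of ℚ⟨A⟩ ⊗ ℚ⟨A⟩ (basis: pairs of words)
Poly₂ : Set → Set
Poly₂ A = List (ℚ × Word A × Word A)

fromℕ : ℕ → ℚ
fromℕ n = (+ n) / 1

sumℚ : List ℚ → ℚ
sumℚ = foldr ℚ._+_ 0ℚ

module Coeff {A : Set} (_≟_ : DecidableEquality A) where
  coeff : Poly A → Word A → ℚ
  coeff p w = sumℚ (map f p)
    where f : ℚ × Word A → ℚ
          f (c , u) with LP.≡-dec _≟_ u w
          ... | yes _ = c
          ... | no _ = 0ℚ

  coeff₂ : Poly₂ A → Word A → Word A → ℚ
  coeff₂ t v w = sumℚ (map f t)
    where f : ℚ × Word A × Word A → ℚ
          f (c , u , u') with LP.≡-dec _≟_ u v | LP.≡-dec _≟_ u' w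
          ... | yes _ | yes _ = c
          ... | _ | _ = 0ℚ

  infix 4 _≈_ _≈₂_
  _≈_ : Poly A → Poly A → Set
  p ≈ q = ∀ w → coeff p w ≡ coeff q w

  _≈₂_ : Poly₂ A → Poly₂ A → Set
  s ≈₂ t = ∀ v w → coeff₂ s v w ≡ coeff₂ t v w

private variable
  A D : Set

zeroP : Poly A
zeroP = []

mon : Word A → Poly A
mon w = (1ℚ , w) ∷ []

letter : A → Poly A
letter a = mon (a ∷ [])

oneP : Poly A
oneP = mon []

infixl 6 _⊕_ _⊖_
_⊕_ : Poly A → Poly A → Poly A
p ⊕ q = p ++ q

_·_ : ℚ → Poly A → Poly A
c · p = map (λ { (a , w) → (c ℚ.* a , w) }) p

_⊖_ : Poly A → Poly A → Poly A
p ⊖ q = p ⊕ (ℚ.- 1ℚ) · q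

mul : Poly A → Poly A → Poly A
mul p q = concatMap (λ { (a , u) → map (λ { (b , v) → (a ℚ.* b , u ++ v) }) q }) p

br : Poly A → Poly A → Poly A
br p q = mul p q ⊖ mul q p

linExt : (Word A → Poly D) → Poly A → Poly D
linExt f p = concatMap (λ { (c , w) → c · f w }) p

algMor : (A → Poly D) → Poly A → Poly D
algMor f = linExt (foldr (λ a acc → mul (f a) acc) oneP)

antiMor : (A → Poly D) → Poly A → Poly D
antiMor f = linExt (foldr (λ a acc → mul acc (f a)) oneP)

derW : (A → Poly A) → Word A → Poly A
derW f [] = zeroP
derW f (a ∷ w) = mul (f a) (mon w) ⊕ mul (letter a) (derW f w)

der : (A → Poly A) → Poly A → Poly A
der f = linExt (derW f)

-- the coproduct with all letters primitive (an algebra morphism)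
ΔW : Word A → Poly₂ A
ΔW [] = (1ℚ , [] , []) ∷ []
ΔW (a ∷ w) = concatMap (λ { (c , u , v) → (c , a ∷ u , v) ∷ (c , u , a ∷ v) ∷ [] }) (ΔW w)

Δ : Poly A → Poly₂ A
Δ p = concatMap (λ { (c , w) → map (λ { (d , u , v) → (c ℚ.* d , u , v) }) (ΔW w) }) p

prim₂ : Poly A → Poly₂ A
prim₂ p = map (λ { (c , w) → (c , w , []) }) p ++ map (λ { (c , w) → (c , [] , w) }) p

_⊗id : (Poly A → Poly A) → Poly₂ A → Poly₂ A
(f ⊗id) t = concatMap (λ { (c , u , v) → map (λ { (a , w) → (c ℚ.* a , w , v) }) (f (mon u)) }) t

id⊗_ : (Poly A → Poly A) → Poly₂ A → Poly₂ A
(id⊗ f) t = concatMap (λ { (c , u , v) → map (λ { (a , w) → (c ℚ.* a , u , w) }) (f (mon v)) }) t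

data X : Set where
  x₀ x₁ : X

_≟X_ : DecidableEquality X
x₀ ≟X x₀ = yes refl
x₀ ≟X x₁ = no λ ()
x₁ ≟X x₀ = no λ ()
x₁ ≟X x₁ = yes refl

-- Letters of Y: the natural number k stands for y_{k+1}.
Y : Set
Y = ℕ

open Coeff _≟X_ public renaming (coeff to coeffX; coeff₂ to coeff₂X; _≈_ to _≈X_; _≈₂_ to _≈₂X_)
open Coeff ℕ._≟_ public renaming (coeff to coeffN; coeff₂ to coeff₂N; _≈_ to _≈N_; _≈₂_ to _≈₂N_)

-- 𝔏𝔦𝔢(X) = Δ_X-primitive elements
LieX : Poly X → Set
LieX ψ = Δ ψ ≈₂X prim₂ ψ

dX : Poly X → Poly X → Poly X
dX ψ = der (λ { x₀ → zeroP ; x₁ → br (letter x₁) ψ })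

ihara : Poly X → Poly X → Poly X
ihara ψ₁ ψ₂ = dX ψ₁ ψ₂ ⊖ dX ψ₂ ψ₁ ⊕ br ψ₁ ψ₂

sX : Poly X → Poly X → Poly X
sX ψ p = mul ψ p ⊕ dX ψ p

ιY : Poly Y → Poly X
ιY = algMor (λ k → mon (replicate k x₀ ++ (x₁ ∷ [])))

-- π_Y on words; the accumulator counts the pending x₀'s
πYW : ℕ → Word X → Maybe (Word Y)
πYW zero [] = just []
πYW (suc _) [] = nothing
πYW n (x₀ ∷ w) = πYW (suc n) w
πYW n (x₁ ∷ w) with πYW zero w
... | just v = just (n ∷ v)
... | nothing = nothing

πY : Poly X → Poly Y
πY = linExt (λ w → f (πYW zero w))
  where f : Maybe (Word Y) → Poly Y
        f (just v) = mon v
        f nothing = zeroP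

-- s^Y_ψ : the unique endomorphism with π_Y ∘ s_ψ = s^Y_ψ ∘ π_Y,
-- written out as π_Y ∘ s_ψ ∘ ι_Y
sY : Poly X → Poly Y → Poly Y
sY ψ v = πY (sX ψ (ιY v))

StabX : Poly X → Set
StabX ψ = LieX ψ ×
  (∀ (v : Poly Y) → ((sY ψ ⊗id) (Δ v) ++ (id⊗ sY ψ) (Δ v)) ≈₂N Δ (sY ψ v))

-- Setting B   (letter b_i is the natural number i)

B : Set
B = ℕ

LieB : Poly B → Set
LieB ψ = Δ ψ ≈₂N prim₂ ψ

-- for a word w, the list of (sign·∏ binom, |k|-|l|, w(l)) over all l ≤ k
substs : Word B → List (ℚ × ℕ × Word B)
substs [] = (1ℚ , 0 , []) ∷ []
substs (zero ∷ w) = map (λ { (c , δ , u) → (c , δ , zero ∷ u) }) (substs w)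
substs (suc k′ ∷ w) =
  concatMap (λ l′ → map (λ { (c , δ , u) →
     (sgn (k′ ℕ.∸ l′) ℚ.* fromℕ (k′ C l′) ℚ.* c , (k′ ℕ.∸ l′) ℕ.+ δ , suc l′ ∷ u) })
     (substs w))
    (upTo (suc k′))
  where sgn : ℕ → ℚ
        sgn zero = 1ℚ
        sgn (suc n) = ℚ.- sgn n

hasNonzero : Word B → Bool
hasNonzero [] = false
hasNonzero (zero ∷ w) = hasNonzero w
hasNonzero (suc _ ∷ w) = true

∂W : Word B → B → Poly B
∂W w zero = zeroP
∂W w (suc i′) with hasNonzero w
... | false = br (letter (suc i′)) (mon w)
... | true = concatMap (λ { (c , δ , u) → c · br (letter (suc i′ ℕ.+ δ)) (mon u) }) (substs w)

∂ : Poly B → Poly B → Poly B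
∂ ψ = der (λ b → linExt (λ w → ∂W w b) ψ)

bracketA : Poly B → Poly B → Poly B
bracketA ψ₁ ψ₂ = ∂ ψ₁ ψ₂ ⊖ ∂ ψ₂ ψ₁ ⊕ br ψ₁ ψ₂

σ : Poly B → Poly B → Poly B
σ ψ p = mul ψ p ⊕ ∂ ψ p

endsInB0 : Word B → Bool
endsInB0 [] = false
endsInB0 (zero ∷ []) = true
endsInB0 (suc _ ∷ []) = false
endsInB0 (_ ∷ w@(_ ∷ _)) = endsInB0 w

π₀ : Poly B → Poly B
π₀ = linExt (λ w → f (endsInB0 w) w)
  where f : Bool → Word B → Poly B
        f true _ = zeroP
        f false w = mon w

InB0 : Poly B → Set
InB0 p = ∀ w → endsInB0 w ≡ true → coeffN p w ≡ 0ℚ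

-- σ⁰_ψ : induced map on ℚ⟨B⟩⁰, i.e. π₀ ∘ σ_ψ restricted to ℚ⟨B⟩⁰
σ⁰ : Poly B → Poly B → Poly B
σ⁰ ψ p = π₀ (σ ψ p)

-- τ on words of ℚ⟨B⟩⁰ (block b₀^m b_k ↦ b₀^{k-1} b_{m+1}, order reversed);
-- words ending in b₀ (outside ℚ⟨B⟩⁰) are sent to nothing
τW : ℕ → Word B → Maybe (Word B)
τW zero [] = just []
τW (suc _) [] = nothing
τW m (zero ∷ w) = τW (suc m) w
τW m (suc k′ ∷ w) with τW zero w
... | just v = just (v ++ (replicate k′ zero ++ (suc m ∷ [])))
... | nothing = nothing

τ : Poly B → Poly B
τ = linExt (λ w → f (τW zero w))
  where f : Maybe (Word B) → Poly B
        f (just v) = mon v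
        f nothing = zeroP

StabB : Poly B → Set
StabB ψ = LieB ψ × (∀ p → InB0 p → σ⁰ ψ (τ p) ≈N τ (σ⁰ ψ p))

θX : Poly X → Poly B
θX = algMor (λ { x₀ → letter 0 ; x₁ → letter 1 })

θY : Poly Y → Poly B
θY = antiMor (λ k → letter (suc k))

θ : Poly X → Poly B
θ ψ = θX ψ ⊕ θY (πY ψ)

-- φ = ψ + λ₁x₁ + λ₀x₀ with ψ ∈ 𝔩𝔰 ; since (ψ∣x₀) = (ψ∣x₁) = 0 we have λᵢ = (φ∣xᵢ)
θ10 : Poly X → Poly B
θ10 φ = θ (φ ⊖ λ₁ · letter x₁ ⊖ λ₀ · letter x₀) ⊕ λ₁ · letter 1 ⊕ λ₀ · letter 0
  where λ₀ = coeffX φ (x₀ ∷ [])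
        λ₁ = coeffX φ (x₁ ∷ [])

{-# OPTIONS --safe #-}
module Submission where

-- Write a word of ℚ⟨X⟩ as ι(u) x₀^r with u a word in Y.  Put a = θ_X(φ) and
-- c = θ_Y(π_Y φ) = τ(a), so that θ^(10)(φ) = a + c - λ₁ b₁, and b₁ = θ_X(x₁) = θ_Y(π_Y x₁).
--
-- Conjugating σ_a with τ gives left multiplication by c plus the derivation killing b₀ and
-- sending b_{m+1} to θ_Y(π_Y([φ, x₀^m] x₁)).  The crux is that for φ ∈ 𝔰𝔱𝔞𝔟(Δ_Y) this
-- derivation is ∂_c.  A Lie element is recovered from its part φ₀ ending in x₁ by
-- φ = Σ_r φ_r x₀^r, φ_r = (-1)^r/r! ∂₀^r φ₀ (up to a multiple of x₀), which accounts for the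
-- binomial coefficients in ∂_c; what remains is the identity
-- E := φ x₁ - Σ_r x₀^r x₁ φ_r = 0.  The stabilizer condition on y_{m+1} says that
-- π_Y([φ, x₀^m] x₁) is Δ_Y-primitive, and Σ_r [φ_r, y_{r+m+1}] is too, hence so is their
-- difference x₀^m E, for every m.  Pairing it with the shuffle of a letter y_{k+m} with a
-- nonempty word whose first letter has index ≤ m isolates a single coefficient of E: so E = 0.
--
-- Thus τ exchanges σ_a and σ_c, which gives θ^(10)(φ) ∈ 𝔰𝔱𝔞𝔟(τ).  Both brackets are
-- antisymmetrizations of s and σ, and σ_{a₁}(c₂) = c₂ a₁ = σ_{c₂}(a₁), so the mixed terms
-- cancel and {a₁ , a₂} + {c₁ , c₂} = θ_X{φ₁ , φ₂} + τ θ_X{φ₁ , φ₂}.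
--
-- Polynomials are compared through their pairings with all functions on words, so that
-- every linear map is replaced by its transpose.

open import Defs
open import Data.Bool using (true; false; if_then_else_)
open import Data.Empty using (⊥)
import Data.Integer as ℤ
import Data.Integer.Properties as ℤₚ
open import Data.List using (List; []; _∷_; _++_; map; concatMap; foldr; replicate; applyUpTo; upTo; length)
open import Data.List.Membership.Propositional using (_∈_)
open import Data.List.Properties using (++-assoc; ++-identityʳ; length-++; map-++; map-injective; map-replicate; ∷-injectiveˡ; ∷-injectiveʳ; ≡-dec)
open import Data.List.Relation.Unary.Any using (here; there)
open import Data.Maybe using (Maybe; just; nothing)
open import Data.Maybe.Properties using (just-injective)
open import Data.Nat as ℕ using (ℕ; zero; suc; z≤n; s≤s)
open import Data.Nat.Combinatorics using (_C_; nCk+nC[k+1]≡[n+1]C[k+1]; k>n⇒nCk≡0)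
import Data.Nat.Properties as ℕₚ
open import Data.Product using (∃; _×_; _,_; proj₁; proj₂)
open import Data.Rational as ℚ using (ℚ; 0ℚ; 1ℚ; ½; _+_; _*_; _-_; -_; toℚᵘ)
open import Data.Rational.Properties using (+-identityˡ; +-identityʳ; *-identityˡ; *-identityʳ; *-zeroˡ; *-zeroʳ; +-assoc; +-comm; *-comm; +-inverseʳ; +-inverseˡ; neg-distribˡ-*; neg-distrib-+; toℚᵘ-injective; toℚᵘ-fromℚᵘ; toℚᵘ-homo-+)
open import Data.Rational.Solver using (module +-*-Solver)
open import Data.Rational.Unnormalised as ℚᵘ using (mkℚᵘ; *≡*)
import Data.Rational.Unnormalised.Properties as ℚᵘₚ
open import Data.Sum using (_⊎_; inj₁; inj₂; [_,_]′)
open import Function using (_∘_)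
open import Relation.Binary.Definitions using (DecidableEquality)
open import Relation.Binary.PropositionalEquality
open import Relation.Nullary using (Dec; yes; no)
open +-*-Solver using (solve; _:=_; _:+_; _:*_; _:-_; :-_; con)
open ≡-Reasoning

-- The obstacle is that `∂W` is given word by word, whereas the equality of ∂_c with the conjugate
-- of ∂_a holds in general only after summation over the words of φ. That global input is confined
-- to `∂-formula`; the conjugation with τ and the cross terms are then identities for each single
-- word of φ, which is why `∂C`, `KA` and `KC` are indexed by such words. In E = 0 the two
-- coproducts meet: primitivity for Δ_X supplies the φ_r, primitivity for Δ_Y the vanishing. The
-- condition of the stabilizer enters at 1, where it makes π_Y(φ) primitive, and at the letters
-- y_{m+1}. Multiplication by x₀^m serves to raise the first letter of E beyond the first letter of
-- the word that is to remain, so that only one deletion is possible. Pairing with arbitrary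
-- functions, and not only with coefficients, keeps the test functions closed under composition with
-- maps of words; an identity of linear maps is then checked on basis words.

private variable
  A A′ : Set

-- Pairings of formal sums with functions

-- `Poly`, `Poly₂` and the values of `substs` are all of this form, so one set of pairing lemmas
-- serves them.
Lin : Set → Set
Lin I = List (ℚ × I)

⟪_∣_⟫ : ∀ {I : Set} → Lin I → (I → ℚ) → ℚ
⟪ [] ∣ f ⟫ = 0ℚ
⟪ (c , i) ∷ p ∣ f ⟫ = c * f i + ⟪ p ∣ f ⟫

module _ {I : Set} where

  ⟪⟫-cong : ∀ (p : Lin I) {f g : I → ℚ} → (∀ i → f i ≡ g i) → ⟪ p ∣ f ⟫ ≡ ⟪ p ∣ g ⟫
  ⟪⟫-cong [] e = refl
  ⟪⟫-cong ((c , i) ∷ p) e = cong₂ _+_ (cong (c *_) (e i)) (⟪⟫-cong p e)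

  ⟪⟫-zero : ∀ (p : Lin I) {f : I → ℚ} → (∀ i → f i ≡ 0ℚ) → ⟪ p ∣ f ⟫ ≡ 0ℚ
  ⟪⟫-zero [] e = refl
  ⟪⟫-zero ((c , i) ∷ p) e = cong₂ _+_ (trans (cong (c *_) (e i)) (*-zeroʳ c)) (⟪⟫-zero p e)

  ⟪⟫-+ : ∀ (p : Lin I) (f g : I → ℚ) → ⟪ p ∣ (λ i → f i + g i) ⟫ ≡ ⟪ p ∣ f ⟫ + ⟪ p ∣ g ⟫
  ⟪⟫-+ [] f g = refl
  ⟪⟫-+ ((c , i) ∷ p) f g rewrite ⟪⟫-+ p f g =
    solve 5 (λ c a b x y → c :* (a :+ b) :+ (x :+ y) := c :* a :+ x :+ (c :* b :+ y)) refl c (f i) (g i) ⟪ p ∣ f ⟫ ⟪ p ∣ g ⟫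

  ⟪⟫-* : ∀ (p : Lin I) k (f : I → ℚ) → ⟪ p ∣ (λ i → k * f i) ⟫ ≡ k * ⟪ p ∣ f ⟫
  ⟪⟫-* [] k f = sym (*-zeroʳ k)
  ⟪⟫-* ((c , i) ∷ p) k f rewrite ⟪⟫-* p k f =
    solve 4 (λ c k a x → c :* (k :* a) :+ k :* x := k :* (c :* a :+ x)) refl c k (f i) ⟪ p ∣ f ⟫

  ⟪⟫-neg : ∀ (p : Lin I) (f : I → ℚ) → ⟪ p ∣ (λ i → - f i) ⟫ ≡ - ⟪ p ∣ f ⟫
  ⟪⟫-neg [] f = refl
  ⟪⟫-neg ((c , i) ∷ p) f rewrite ⟪⟫-neg p f =
    solve 3 (λ c a x → c :* (:- a) :+ (:- x) := :- (c :* a :+ x)) refl c (f i) ⟪ p ∣ f ⟫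

  ⟪⟫-- : ∀ (p : Lin I) (f g : I → ℚ) → ⟪ p ∣ (λ i → f i - g i) ⟫ ≡ ⟪ p ∣ f ⟫ - ⟪ p ∣ g ⟫
  ⟪⟫-- p f g = trans (⟪⟫-+ p f (λ i → - g i)) (cong (⟪ p ∣ f ⟫ +_) (⟪⟫-neg p g))

  ⟪⟫-++ : ∀ (p q : Lin I) (f : I → ℚ) → ⟪ p ++ q ∣ f ⟫ ≡ ⟪ p ∣ f ⟫ + ⟪ q ∣ f ⟫
  ⟪⟫-++ [] q f = sym (+-identityˡ _)
  ⟪⟫-++ ((c , i) ∷ p) q f = trans (cong (c * f i +_) (⟪⟫-++ p q f)) (sym (+-assoc (c * f i) _ _))

⟪⟫-swap : ∀ {I J : Set} (p : Lin I) (q : Lin J) (f : I → J → ℚ) →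
  ⟪ p ∣ (λ i → ⟪ q ∣ f i ⟫) ⟫ ≡ ⟪ q ∣ (λ j → ⟪ p ∣ (λ i → f i j) ⟫) ⟫
⟪⟫-swap [] q f = sym (⟪⟫-zero q (λ _ → refl))
⟪⟫-swap ((c , i) ∷ p) q f = trans (cong₂ _+_ (sym (⟪⟫-* q c (f i))) (⟪⟫-swap p q f)) (sym (⟪⟫-+ q _ _))

-- `h` is implicit so that unification picks up the anonymous summand functions of the definitions;
-- their action is supplied pointwise.
⟪⟫-map : ∀ {I J : Set} {h : ℚ × I → ℚ × J} c (g : I → J) → (∀ b i → h (b , i) ≡ (c * b , g i)) →
  ∀ (q : Lin I) (f : J → ℚ) → ⟪ map h q ∣ f ⟫ ≡ c * ⟪ q ∣ f ∘ g ⟫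
⟪⟫-map c g e [] f = sym (*-zeroʳ c)
⟪⟫-map c g e ((b , i) ∷ q) f rewrite e b i | ⟪⟫-map c g e q f =
  solve 4 (λ c k a x → c :* k :* a :+ c :* x := c :* (k :* a :+ x)) refl c b (f (g i)) ⟪ q ∣ f ∘ g ⟫

⟪⟫-concatMap : ∀ {I J : Set} {h : ℚ × I → Lin J} (f : J → ℚ) (g : I → ℚ) →
  (∀ c i → ⟪ h (c , i) ∣ f ⟫ ≡ c * g i) → ∀ (q : Lin I) → ⟪ concatMap h q ∣ f ⟫ ≡ ⟪ q ∣ g ⟫
⟪⟫-concatMap f g e [] = refl
⟪⟫-concatMap {h = h} f g e ((c , i) ∷ q) =
  trans (⟪⟫-++ (h (c , i)) _ f) (cong₂ _+_ (e c i) (⟪⟫-concatMap f g e q))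

mapI : ∀ {I J : Set} → (I → J) → Lin I → Lin J
mapI g = map (λ (c , i) → c , g i)

⟪⟫-mapI : ∀ {I J : Set} (g : I → J) (q : Lin I) (f : J → ℚ) → ⟪ mapI g q ∣ f ⟫ ≡ ⟪ q ∣ f ∘ g ⟫
⟪⟫-mapI g [] f = refl
⟪⟫-mapI g ((c , i) ∷ q) f = cong (c * f (g i) +_) (⟪⟫-mapI g q f)

scale : ∀ {I : Set} → ℚ → Lin I → Lin I
scale k = map (λ (c , i) → k * c , i)

⟪⟫-scale : ∀ {I : Set} k (q : Lin I) (f : I → ℚ) → ⟪ scale k q ∣ f ⟫ ≡ k * ⟪ q ∣ f ⟫
⟪⟫-scale k = ⟪⟫-map k (λ i → i) (λ _ _ → refl)

bind : ∀ {I J : Set} → Lin I → (I → Lin J) → Lin J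
bind p g = concatMap (λ (c , i) → scale c (g i)) p

⟪⟫-bind : ∀ {I J : Set} (p : Lin I) (g : I → Lin J) (f : J → ℚ) → ⟪ bind p g ∣ f ⟫ ≡ ⟪ p ∣ (λ i → ⟪ g i ∣ f ⟫) ⟫
⟪⟫-bind p g f = ⟪⟫-concatMap f _ (λ c i → ⟪⟫-scale c (g i) f) p

⟪⟫-single : ∀ {I : Set} (i : I) (f : I → ℚ) → ⟪ (1ℚ , i) ∷ [] ∣ f ⟫ ≡ f i
⟪⟫-single i f = trans (+-identityʳ _) (*-identityˡ _)

-- The properties of a Kronecker delta from which coefficients are shown to determine all pairings;
-- words and pairs of words are the two instances.
record Delta {I : Set} (δ : I → I → ℚ) : Set where
  field
    δ-refl : ∀ i → δ i i ≡ 1ℚ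
    δ-dec : ∀ i j → i ≡ j ⊎ δ i j ≡ 0ℚ
open Delta

module _ {I : Set} {δ : I → I → ℚ} (D : Delta δ) where

  remove : I → Lin I → Lin I
  remove i [] = []
  remove i ((c , j) ∷ p) with δ-dec D i j
  ... | inj₁ _ = remove i p
  ... | inj₂ _ = (c , j) ∷ remove i p

  length-remove : ∀ i p → length (remove i p) ℕ.≤ length p
  length-remove i [] = z≤n
  length-remove i ((c , j) ∷ p) with δ-dec D i j
  ... | inj₁ _ = ℕₚ.m≤n⇒m≤1+n (length-remove i p)
  ... | inj₂ _ = s≤s (length-remove i p)

  ⟪⟫-remove : ∀ i p f → ⟪ p ∣ f ⟫ ≡ ⟪ p ∣ δ i ⟫ * f i + ⟪ remove i p ∣ f ⟫
  ⟪⟫-remove i [] f = sym (trans (+-identityʳ _) (*-zeroˡ (f i)))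
  ⟪⟫-remove i ((c , j) ∷ p) f with δ-dec D i j
  ... | inj₁ refl rewrite δ-refl D i | ⟪⟫-remove i p f =
    solve 4 (λ c a x y → c :* a :+ (x :* a :+ y) := (c :* con 1ℚ :+ x) :* a :+ y) refl c (f i) _ _
  ... | inj₂ e rewrite e | ⟪⟫-remove i p f =
    solve 5 (λ c a b x y → c :* b :+ (x :* a :+ y) := (c :* con 0ℚ :+ x) :* a :+ (c :* b :+ y)) refl c (f i) (f j) _ _

  -- Induction on an upper bound for the length: removing all occurrences of one
  -- basis element keeps every coefficient zero.
  separate₀ : ∀ n p → length p ℕ.≤ n → (∀ i → ⟪ p ∣ δ i ⟫ ≡ 0ℚ) → ∀ f → ⟪ p ∣ f ⟫ ≡ 0ℚ
  separate₀ n [] _ _ f = refl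
  separate₀ (suc n) ((c , i) ∷ p) (s≤s l) z f = begin
      ⟪ (c , i) ∷ p ∣ f ⟫                         ≡⟨ expand f ⟩
      ⟪ (c , i) ∷ p ∣ δ i ⟫ * f i + ⟪ remove i p ∣ f ⟫ ≡⟨ cong₂ (λ x y → x * f i + y) (z i) rest ⟩
      0ℚ * f i + 0ℚ                               ≡⟨ trans (+-identityʳ _) (*-zeroˡ (f i)) ⟩
      0ℚ ∎
    where
    expand : ∀ g → ⟪ (c , i) ∷ p ∣ g ⟫ ≡ ⟪ (c , i) ∷ p ∣ δ i ⟫ * g i + ⟪ remove i p ∣ g ⟫
    expand g rewrite δ-refl D i | ⟪⟫-remove i p g =
      solve 4 (λ c a x y → c :* a :+ (x :* a :+ y) := (c :* con 1ℚ :+ x) :* a :+ y) refl c (g i) _ _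
    coeff₀ : ∀ j → ⟪ remove i p ∣ δ j ⟫ ≡ 0ℚ
    coeff₀ j = begin
      ⟪ remove i p ∣ δ j ⟫                      ≡⟨ +-identityˡ _ ⟨
      0ℚ + ⟪ remove i p ∣ δ j ⟫                 ≡⟨ cong (_+ ⟪ remove i p ∣ δ j ⟫) (*-zeroˡ (δ j i)) ⟨
      0ℚ * δ j i + ⟪ remove i p ∣ δ j ⟫         ≡⟨ cong (λ x → x * δ j i + ⟪ remove i p ∣ δ j ⟫) (z i) ⟨
      ⟪ (c , i) ∷ p ∣ δ i ⟫ * δ j i + ⟪ remove i p ∣ δ j ⟫ ≡⟨ expand (δ j) ⟨
      ⟪ (c , i) ∷ p ∣ δ j ⟫                     ≡⟨ z j ⟩
      0ℚ ∎
    rest : ⟪ remove i p ∣ f ⟫ ≡ 0ℚ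
    rest = separate₀ n (remove i p) (ℕₚ.≤-trans (length-remove i p) l) coeff₀ f

  separate-zero : ∀ p → (∀ i → ⟪ p ∣ δ i ⟫ ≡ 0ℚ) → ∀ f → ⟪ p ∣ f ⟫ ≡ 0ℚ
  separate-zero p = separate₀ (length p) p ℕₚ.≤-refl

  -- Reduces to `separate-zero` for the formal difference `d`. This is the passage from `≈`, which
  -- speaks of delta functions only, to all test functions.
  separate : ∀ p q → (∀ i → ⟪ p ∣ δ i ⟫ ≡ ⟪ q ∣ δ i ⟫) → ∀ f → ⟪ p ∣ f ⟫ ≡ ⟪ q ∣ f ⟫
  separate p q e f = begin
      ⟪ p ∣ f ⟫                             ≡⟨ +-identityʳ _ ⟨
      ⟪ p ∣ f ⟫ + 0ℚ                        ≡⟨ cong (⟪ p ∣ f ⟫ +_) (+-inverseˡ ⟪ q ∣ f ⟫) ⟨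
      ⟪ p ∣ f ⟫ + (- ⟪ q ∣ f ⟫ + ⟪ q ∣ f ⟫) ≡⟨ +-assoc ⟪ p ∣ f ⟫ (- ⟪ q ∣ f ⟫) ⟪ q ∣ f ⟫ ⟨
      ⟪ p ∣ f ⟫ - ⟪ q ∣ f ⟫ + ⟪ q ∣ f ⟫     ≡⟨ cong (_+ ⟪ q ∣ f ⟫) (trans (sym (split f)) (separate-zero d d≈0 f)) ⟩
      0ℚ + ⟪ q ∣ f ⟫                        ≡⟨ +-identityˡ _ ⟩
      ⟪ q ∣ f ⟫                             ∎
    where
    d = p ++ scale (- 1ℚ) q
    split : ∀ g → ⟪ d ∣ g ⟫ ≡ ⟪ p ∣ g ⟫ - ⟪ q ∣ g ⟫
    split g = trans (⟪⟫-++ p _ g) (cong (⟪ p ∣ g ⟫ +_) (trans (⟪⟫-scale (- 1ℚ) q g)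
                (solve 1 (λ x → :- con 1ℚ :* x := :- x) refl _)))
    d≈0 : ∀ i → ⟪ d ∣ δ i ⟫ ≡ 0ℚ
    d≈0 i = trans (split (δ i)) (trans (cong (_- _) (e i)) (+-inverseʳ ⟪ q ∣ δ i ⟫))

module Words {A : Set} (_≟_ : DecidableEquality A) where
  open Coeff _≟_

  δW : Word A → Word A → ℚ
  δW w u with ≡-dec _≟_ u w
  ... | yes _ = 1ℚ
  ... | no _ = 0ℚ

  δW-refl : ∀ w → δW w w ≡ 1ℚ
  δW-refl w with ≡-dec _≟_ w w
  ... | yes _ = refl
  ... | no ¬e with () ← ¬e refl

  δW-≢ : ∀ w u → u ≢ w → δW w u ≡ 0ℚ
  δW-≢ w u ne with ≡-dec _≟_ u w
  ... | yes e with () ← ne e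
  ... | no _ = refl

  δW-delta : Delta δW
  δW-delta .δ-refl = δW-refl
  δW-delta .δ-dec w u with ≡-dec _≟_ u w
  ... | yes e = inj₁ (sym e)
  ... | no _ = inj₂ refl

  δW₂ : Word A × Word A → Word A × Word A → ℚ
  δW₂ (v , w) (u , u′) = δW v u * δW w u′

  δW₂-delta : Delta δW₂
  δW₂-delta .δ-refl (v , w) = cong₂ _*_ (δW-refl v) (δW-refl w)
  δW₂-delta .δ-dec (v , w) (u , u′) with δ-dec δW-delta v u | δ-dec δW-delta w u′
  ... | inj₁ refl | inj₁ refl = inj₁ refl
  ... | inj₂ z | _ rewrite z = inj₂ (*-zeroˡ (δW w u′))
  ... | inj₁ _ | inj₂ z rewrite z = inj₂ (*-zeroʳ (δW v u))

  coeff-⟪⟫ : ∀ p w → coeff p w ≡ ⟪ p ∣ δW w ⟫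
  coeff-⟪⟫ [] w = refl
  coeff-⟪⟫ ((c , u) ∷ p) w with ≡-dec _≟_ u w
  ... | yes _ = cong₂ _+_ (sym (trans (*-comm c 1ℚ) (*-identityˡ c))) (coeff-⟪⟫ p w)
  ... | no _ = cong₂ _+_ (sym (*-zeroʳ c)) (coeff-⟪⟫ p w)

  coeff₂-⟪⟫ : ∀ t v w → coeff₂ t v w ≡ ⟪ t ∣ δW₂ (v , w) ⟫
  coeff₂-⟪⟫ [] v w = refl
  coeff₂-⟪⟫ ((c , u , u′) ∷ p) v w with ≡-dec _≟_ u v | ≡-dec _≟_ u′ w
  ... | yes _ | yes _ = cong₂ _+_ (sym (trans (*-comm c 1ℚ) (*-identityˡ c))) (coeff₂-⟪⟫ p v w)
  ... | yes _ | no _ = cong₂ _+_ (sym (*-zeroʳ c)) (coeff₂-⟪⟫ p v w)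
  ... | no _ | yes _ = cong₂ _+_ (sym (*-zeroʳ c)) (coeff₂-⟪⟫ p v w)
  ... | no _ | no _ = cong₂ _+_ (sym (*-zeroʳ c)) (coeff₂-⟪⟫ p v w)

  ≈⇒⟪⟫ : ∀ p q → p ≈ q → ∀ f → ⟪ p ∣ f ⟫ ≡ ⟪ q ∣ f ⟫
  ≈⇒⟪⟫ p q e = separate δW-delta p q (λ w → trans (sym (coeff-⟪⟫ p w)) (trans (e w) (coeff-⟪⟫ q w)))

  ⟪⟫⇒≈ : ∀ p q → (∀ f → ⟪ p ∣ f ⟫ ≡ ⟪ q ∣ f ⟫) → p ≈ q
  ⟪⟫⇒≈ p q e w = trans (coeff-⟪⟫ p w) (trans (e _) (sym (coeff-⟪⟫ q w)))

  ≈₂⇒⟪⟫ : ∀ s t → s ≈₂ t → ∀ F → ⟪ s ∣ F ⟫ ≡ ⟪ t ∣ F ⟫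
  ≈₂⇒⟪⟫ s t e = separate δW₂-delta s t
    (λ (v , w) → trans (sym (coeff₂-⟪⟫ s v w)) (trans (e v w) (coeff₂-⟪⟫ t v w)))

  ⟪⟫⇒≈₂ : ∀ s t → (∀ F → ⟪ s ∣ F ⟫ ≡ ⟪ t ∣ F ⟫) → s ≈₂ t
  ⟪⟫⇒≈₂ s t e v w = trans (coeff₂-⟪⟫ s v w) (trans (e _) (sym (coeff₂-⟪⟫ t v w)))

module WX = Words _≟X_
module WN = Words ℕ._≟_

-- Transposes of the operations on free algebras

⟪⟫-mon : ∀ (w : Word A) f → ⟪ mon w ∣ f ⟫ ≡ f w
⟪⟫-mon w f = ⟪⟫-single w f

⟪⟫-· : ∀ c (p : Poly A) f → ⟪ c · p ∣ f ⟫ ≡ c * ⟪ p ∣ f ⟫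
⟪⟫-· c p f = ⟪⟫-map c (λ w → w) (λ _ _ → refl) p f

⟪⟫-⊖ : ∀ (p q : Poly A) f → ⟪ p ⊖ q ∣ f ⟫ ≡ ⟪ p ∣ f ⟫ - ⟪ q ∣ f ⟫
⟪⟫-⊖ p q f = trans (⟪⟫-++ p _ f) (cong (⟪ p ∣ f ⟫ +_) (trans (⟪⟫-· (- 1ℚ) q f)
               (solve 1 (λ x → :- con 1ℚ :* x := :- x) refl _)))

⟪⟫-mul : ∀ (p q : Poly A) f → ⟪ mul p q ∣ f ⟫ ≡ ⟪ p ∣ (λ u → ⟪ q ∣ (λ v → f (u ++ v)) ⟫) ⟫
⟪⟫-mul p q f = ⟪⟫-concatMap f _ (λ c u → ⟪⟫-map c (u ++_) (λ _ _ → refl) q f) p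

⟪⟫-br : ∀ (p q : Poly A) f → ⟪ br p q ∣ f ⟫ ≡ ⟪ p ∣ (λ u → ⟪ q ∣ (λ v → f (u ++ v) - f (v ++ u)) ⟫) ⟫
⟪⟫-br p q f = begin
  ⟪ br p q ∣ f ⟫ ≡⟨ ⟪⟫-⊖ (mul p q) (mul q p) f ⟩
  ⟪ mul p q ∣ f ⟫ - ⟪ mul q p ∣ f ⟫ ≡⟨ cong₂ _-_ (⟪⟫-mul p q f) (trans (⟪⟫-mul q p f) (⟪⟫-swap q p _)) ⟩
  ⟪ p ∣ (λ u → ⟪ q ∣ (λ v → f (u ++ v)) ⟫) ⟫ - ⟪ p ∣ (λ u → ⟪ q ∣ (λ v → f (v ++ u)) ⟫) ⟫ ≡⟨ ⟪⟫-- p _ _ ⟨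
  ⟪ p ∣ (λ u → ⟪ q ∣ (λ v → f (u ++ v)) ⟫ - ⟪ q ∣ (λ v → f (v ++ u)) ⟫) ⟫ ≡⟨ ⟪⟫-cong p (λ u → ⟪⟫-- q _ _) ⟨
  ⟪ p ∣ (λ u → ⟪ q ∣ (λ v → f (u ++ v) - f (v ++ u)) ⟫) ⟫ ∎

⟪⟫-linExt : ∀ (g : Word A → Poly A′) p f → ⟪ linExt g p ∣ f ⟫ ≡ ⟪ p ∣ (λ w → ⟪ g w ∣ f ⟫) ⟫
⟪⟫-linExt g p f = ⟪⟫-concatMap f _ (λ c w → ⟪⟫-· c (g w) f) p

⟪⟫-derW-∷ : ∀ (F : A → Poly A) a w f →
  ⟪ derW F (a ∷ w) ∣ f ⟫ ≡ ⟪ F a ∣ (λ z → f (z ++ w)) ⟫ + ⟪ derW F w ∣ (λ z → f (a ∷ z)) ⟫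
⟪⟫-derW-∷ F a w f = trans (⟪⟫-++ (mul (F a) (mon w)) _ f) (cong₂ _+_
  (trans (⟪⟫-mul (F a) (mon w) f) (⟪⟫-cong (F a) (λ z → ⟪⟫-mon w (λ v → f (z ++ v)))))
  (trans (⟪⟫-mul (letter a) (derW F w) f) (⟪⟫-mon (a ∷ []) (λ u → ⟪ derW F w ∣ (λ v → f (u ++ v)) ⟫))))

⟪⟫-ΔW-∷ : ∀ (a : A) w F →
  ⟪ ΔW (a ∷ w) ∣ F ⟫ ≡ ⟪ ΔW w ∣ (λ (u , v) → F (a ∷ u , v) + F (u , a ∷ v)) ⟫
⟪⟫-ΔW-∷ a w F = ⟪⟫-concatMap F _
  (λ c (u , v) → solve 3 (λ c x y → c :* x :+ (c :* y :+ con 0ℚ) := c :* (x :+ y)) refl c (F (a ∷ u , v)) (F (u , a ∷ v)))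
  (ΔW w)

⟪⟫-Δ : ∀ (p : Poly A) F → ⟪ Δ p ∣ F ⟫ ≡ ⟪ p ∣ (λ w → ⟪ ΔW w ∣ F ⟫) ⟫
⟪⟫-Δ p F = ⟪⟫-concatMap F _ (λ c w → ⟪⟫-map c (λ i → i) (λ _ _ → refl) (ΔW w) F) p

⟪⟫-prim₂ : ∀ (p : Poly A) F → ⟪ prim₂ p ∣ F ⟫ ≡ ⟪ p ∣ (λ w → F (w , []) + F ([] , w)) ⟫
⟪⟫-prim₂ p F = trans (⟪⟫-++ (mapI (λ w → w , []) p) (mapI (λ w → [] , w) p) F) (trans
  (cong₂ _+_ (⟪⟫-mapI (λ w → w , []) p F) (⟪⟫-mapI (λ w → [] , w) p F)) (sym (⟪⟫-+ p _ _)))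

⟪⟫-⊗id : ∀ (f : Poly A → Poly A) t F →
  ⟪ (f ⊗id) t ∣ F ⟫ ≡ ⟪ t ∣ (λ (u , v) → ⟪ f (mon u) ∣ (λ w → F (w , v)) ⟫) ⟫
⟪⟫-⊗id f t F = ⟪⟫-concatMap F _ (λ c (u , v) → ⟪⟫-map c (_, v) (λ _ _ → refl) (f (mon u)) F) t

⟪⟫-id⊗ : ∀ (f : Poly A → Poly A) t F →
  ⟪ (id⊗ f) t ∣ F ⟫ ≡ ⟪ t ∣ (λ (u , v) → ⟪ f (mon v) ∣ (λ w → F (u , w)) ⟫) ⟫
⟪⟫-id⊗ f t F = ⟪⟫-concatMap F _ (λ c (u , v) → ⟪⟫-map c (u ,_) (λ _ _ → refl) (f (mon v)) F) t

⟪⟫-linExt-map : ∀ {F : Word A → Poly A′} (t : A → A′) → F [] ≡ oneP →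
  (∀ a w → F (a ∷ w) ≡ mul (letter (t a)) (F w)) →
  ∀ p f → ⟪ linExt F p ∣ f ⟫ ≡ ⟪ p ∣ (λ w → f (map t w)) ⟫
⟪⟫-linExt-map {F = F} t e[] e∷ p f = trans (⟪⟫-linExt F p f) (⟪⟫-cong p (λ w → onWord w f))
  where
  onWord : ∀ w f → ⟪ F w ∣ f ⟫ ≡ f (map t w)
  onWord [] f = trans (cong (λ q → ⟪ q ∣ f ⟫) e[]) (⟪⟫-mon [] f)
  onWord (a ∷ w) f = begin
    ⟪ F (a ∷ w) ∣ f ⟫                                        ≡⟨ cong (λ q → ⟪ q ∣ f ⟫) (e∷ a w) ⟩
    ⟪ mul (letter (t a)) (F w) ∣ f ⟫                         ≡⟨ ⟪⟫-mul (letter (t a)) (F w) f ⟩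
    ⟪ letter (t a) ∣ (λ u → ⟪ F w ∣ (λ v → f (u ++ v)) ⟫) ⟫  ≡⟨ ⟪⟫-mon (t a ∷ []) (λ u → ⟪ F w ∣ (λ v → f (u ++ v)) ⟫) ⟩
    ⟪ F w ∣ (λ v → f (t a ∷ v)) ⟫                            ≡⟨ onWord w (λ v → f (t a ∷ v)) ⟩
    f (map t (a ∷ w))                                        ∎

letterX : X → B
letterX x₀ = 0
letterX x₁ = 1

⟪⟫-θX : ∀ p f → ⟪ θX p ∣ f ⟫ ≡ ⟪ p ∣ (λ w → f (map letterX w)) ⟫
⟪⟫-θX = ⟪⟫-linExt-map letterX refl (λ { x₀ w → refl ; x₁ w → refl })

revB : Word Y → Word B
revB [] = []
revB (k ∷ v) = revB v ++ suc k ∷ []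

revB-++ : ∀ u v → revB (u ++ v) ≡ revB v ++ revB u
revB-++ [] v = sym (++-identityʳ (revB v))
revB-++ (k ∷ u) v = trans (cong (_++ suc k ∷ []) (revB-++ u v)) (++-assoc (revB v) (revB u) _)

⟪⟫-θY : ∀ p f → ⟪ θY p ∣ f ⟫ ≡ ⟪ p ∣ (λ v → f (revB v)) ⟫
⟪⟫-θY p f = trans (⟪⟫-linExt rev p f) (⟪⟫-cong p (λ v → onWord v f))
  where
  rev : Word Y → Poly B
  rev = foldr (λ k acc → mul acc (letter (suc k))) oneP
  onWord : ∀ v f → ⟪ rev v ∣ f ⟫ ≡ f (revB v)
  onWord [] f = ⟪⟫-mon [] f
  onWord (k ∷ v) f = begin
    ⟪ mul (rev v) (letter (suc k)) ∣ f ⟫                     ≡⟨ ⟪⟫-mul (rev v) (letter (suc k)) f ⟩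
    ⟪ rev v ∣ (λ u → ⟪ letter (suc k) ∣ (λ z → f (u ++ z)) ⟫) ⟫ ≡⟨ ⟪⟫-cong (rev v) (λ u → ⟪⟫-mon (suc k ∷ []) (λ z → f (u ++ z))) ⟩
    ⟪ rev v ∣ (λ u → f (u ++ suc k ∷ [])) ⟫                  ≡⟨ onWord v (λ u → f (u ++ suc k ∷ [])) ⟩
    f (revB (k ∷ v))                                         ∎

-- Words in X, Y and B

-- The pair (u , r) stands for the word ι(u) x₀^r; sp inverts this correspondence.
raise : ℕ → Word Y × ℕ → Word Y × ℕ
raise m ([] , r) = [] , m ℕ.+ r
raise m (k ∷ u , r) = m ℕ.+ k ∷ u , r

sp : Word X → Word Y × ℕ
sp [] = [] , 0
sp (x₀ ∷ w) = raise 1 (sp w)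
sp (x₁ ∷ w) = 0 ∷ proj₁ (sp w) , proj₂ (sp w)

emb : Word Y → ℕ → Word X
emb [] r = replicate r x₀
emb (k ∷ u) r = replicate k x₀ ++ x₁ ∷ emb u r

raise-0 : ∀ s → raise 0 s ≡ s
raise-0 ([] , r) = refl
raise-0 (k ∷ u , r) = refl

raise-+ : ∀ m n s → raise m (raise n s) ≡ raise (m ℕ.+ n) s
raise-+ m n ([] , r) = cong ([] ,_) (sym (ℕₚ.+-assoc m n r))
raise-+ m n (k ∷ u , r) = cong (λ z → z ∷ u , r) (sym (ℕₚ.+-assoc m n k))

sp-x₀^ : ∀ m w → sp (replicate m x₀ ++ w) ≡ raise m (sp w)
sp-x₀^ zero w = sym (raise-0 (sp w))
sp-x₀^ (suc m) w = trans (cong (raise 1) (sp-x₀^ m w)) (raise-+ 1 m (sp w))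

sp-emb : ∀ u r → sp (emb u r) ≡ (u , r)
sp-emb [] r = trans (cong sp (sym (++-identityʳ (replicate r x₀))))
  (trans (sp-x₀^ r []) (cong ([] ,_) (ℕₚ.+-identityʳ r)))
sp-emb (k ∷ u) r = trans (sp-x₀^ k (x₁ ∷ emb u r)) (trans
  (cong (λ s → raise k (0 ∷ proj₁ s , proj₂ s)) (sp-emb u r)) (cong (λ z → z ∷ u , r) (ℕₚ.+-identityʳ k)))

emb-sp : ∀ w → w ≡ emb (proj₁ (sp w)) (proj₂ (sp w))
emb-sp [] = refl
emb-sp (x₁ ∷ w) = cong (x₁ ∷_) (emb-sp w)
emb-sp (x₀ ∷ w) with sp w | emb-sp w
... | [] , r | e = cong (x₀ ∷_) e
... | k ∷ u , r | e = cong (x₀ ∷_) e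

sp-x₁ : ∀ w → sp (w ++ x₁ ∷ []) ≡ (proj₁ (sp w) ++ proj₂ (sp w) ∷ [] , 0)
sp-x₁ [] = refl
sp-x₁ (x₁ ∷ w) rewrite sp-x₁ w = refl
sp-x₁ (x₀ ∷ w) rewrite sp-x₁ w with sp w
... | [] , r = refl
... | k ∷ u , r = refl

sp-snoc-x₀^ : ∀ w m → sp (w ++ replicate m x₀) ≡ (proj₁ (sp w) , proj₂ (sp w) ℕ.+ m)
sp-snoc-x₀^ [] m = sp-emb [] m
sp-snoc-x₀^ (x₁ ∷ w) m rewrite sp-snoc-x₀^ w m = refl
sp-snoc-x₀^ (x₀ ∷ w) m rewrite sp-snoc-x₀^ w m with sp w
... | [] , r = refl
... | k ∷ u , r = refl

-- The transpose of π_Y in the coordinates `(u , r)`.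
onY : (Word Y → ℚ) → Word Y × ℕ → ℚ
onY h (u , zero) = h u
onY h (u , suc _) = 0ℚ

onY-cong : ∀ {h h′ : Word Y → ℚ} → (∀ u → h u ≡ h′ u) → ∀ s → onY h s ≡ onY h′ s
onY-cong e (u , zero) = e u
onY-cong e (u , suc _) = refl

full : Word Y × ℕ → Maybe (Word Y)
full (u , zero) = just u
full (u , suc _) = nothing

πYW-sp : ∀ n w → πYW n w ≡ full (raise n (sp w))
πYW-sp zero [] = refl
πYW-sp (suc n) [] = refl
πYW-sp n (x₀ ∷ w) = trans (help n) (cong full (trans (cong (λ z → raise z (sp w)) (ℕₚ.+-comm 1 n)) (sym (raise-+ n 1 (sp w)))))
  where
  help : ∀ n → πYW n (x₀ ∷ w) ≡ full (raise (suc n) (sp w))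
  help zero = πYW-sp 1 w
  help (suc n) = πYW-sp (suc (suc n)) w
πYW-sp zero (x₁ ∷ w) rewrite trans (πYW-sp zero w) (cong full (raise-0 (sp w))) with sp w
... | u , zero = refl
... | u , suc _ = refl
πYW-sp (suc n) (x₁ ∷ w) rewrite trans (πYW-sp zero w) (cong full (raise-0 (sp w))) with sp w
... | u , zero = cong (λ z → just (suc z ∷ u)) (sym (ℕₚ.+-identityʳ n))
... | u , suc _ = refl

⟪⟫-πY : ∀ p h → ⟪ πY p ∣ h ⟫ ≡ ⟪ p ∣ (λ w → onY h (sp w)) ⟫
⟪⟫-πY [] h = refl
⟪⟫-πY ((c , w) ∷ p) h rewrite trans (πYW-sp zero w) (cong full (raise-0 (sp w))) with sp w
... | u , zero = cong₂ _+_ (cong (_* h u) (*-identityʳ c)) (⟪⟫-πY p h)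
... | u , suc _ = trans (⟪⟫-πY p h) (sym (trans (cong (_+ ⟪ p ∣ (λ w → onY h (sp w)) ⟫) (*-zeroʳ c)) (+-identityˡ _)))

⟪⟫-θYπY : ∀ p f → ⟪ θY (πY p) ∣ f ⟫ ≡ ⟪ p ∣ (λ w → onY (λ u → f (revB u)) (sp w)) ⟫
⟪⟫-θYπY p f = trans (⟪⟫-θY (πY p) f) (⟪⟫-πY p (λ u → f (revB u)))

-- Σ_{l + j = k} (-1)^j (k choose l) (l , j), generated by Pascal's rule.
Bin : ℕ → Lin (ℕ × ℕ)
Bin zero = (1ℚ , 0 , 0) ∷ []
Bin (suc k) = mapI (λ (l , j) → suc l , j) (Bin k) ++ scale (- 1ℚ) (mapI (λ (l , j) → l , suc j) (Bin k))

⟪⟫-Bin-suc : ∀ k G → ⟪ Bin (suc k) ∣ G ⟫ ≡ ⟪ Bin k ∣ (λ (l , j) → G (suc l , j)) ⟫ - ⟪ Bin k ∣ (λ (l , j) → G (l , suc j)) ⟫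
⟪⟫-Bin-suc k G = trans (⟪⟫-++ (mapI (λ (l , j) → suc l , j) (Bin k)) _ G) (cong₂ _+_
  (⟪⟫-mapI _ (Bin k) G)
  (trans (⟪⟫-scale (- 1ℚ) (mapI (λ (l , j) → l , suc j) (Bin k)) G) (trans
    (solve 1 (λ x → :- con 1ℚ :* x := :- x) refl _) (cong -_ (⟪⟫-mapI _ (Bin k) G)))))

-- Binomial sums and the substitutions in ∂_w

sumTo : ℕ → (ℕ → ℚ) → ℚ
sumTo zero g = 0ℚ
sumTo (suc n) g = g 0 + sumTo n (g ∘ suc)

sumTo-cong : ∀ n {g h : ℕ → ℚ} → (∀ l → l ℕ.< n → g l ≡ h l) → sumTo n g ≡ sumTo n h
sumTo-cong zero e = refl
sumTo-cong (suc n) e = cong₂ _+_ (e 0 (s≤s z≤n)) (sumTo-cong n (λ l l<n → e (suc l) (s≤s l<n)))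

sumTo-+ : ∀ n (g h : ℕ → ℚ) → sumTo n (λ l → g l + h l) ≡ sumTo n g + sumTo n h
sumTo-+ zero g h = refl
sumTo-+ (suc n) g h rewrite sumTo-+ n (g ∘ suc) (h ∘ suc) =
  solve 4 (λ a b x y → a :+ b :+ (x :+ y) := a :+ x :+ (b :+ y)) refl (g 0) (h 0) _ _

sumTo-neg : ∀ n (g : ℕ → ℚ) → sumTo n (λ l → - g l) ≡ - sumTo n g
sumTo-neg zero g = refl
sumTo-neg (suc n) g rewrite sumTo-neg n (g ∘ suc) = sym (neg-distrib-+ (g 0) (sumTo n (g ∘ suc)))

sumTo-snoc : ∀ n (g : ℕ → ℚ) → sumTo (suc n) g ≡ sumTo n g + g n
sumTo-snoc zero g = +-comm (g 0) 0ℚ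
sumTo-snoc (suc n) g = trans (cong (g 0 +_) (sumTo-snoc n (g ∘ suc))) (sym (+-assoc (g 0) (sumTo n (g ∘ suc)) (g (suc n))))

fromℕ-+ : ∀ m n → fromℕ (m ℕ.+ n) ≡ fromℕ m + fromℕ n
fromℕ-+ m n = toℚᵘ-injective (begin-equality
    toℚᵘ (fromℕ (m ℕ.+ n))               ≃⟨ toℚᵘ-fromℚᵘ (mkℚᵘ (ℤ.+ (m ℕ.+ n)) 0) ⟩
    mkℚᵘ (ℤ.+ (m ℕ.+ n)) 0               ≃⟨ *≡* (cong (ℤ._* ℤ.+ 1) (cong₂ ℤ._+_ (sym (ℤₚ.*-identityʳ (ℤ.+ m))) (sym (ℤₚ.*-identityʳ (ℤ.+ n))))) ⟩
    mkℚᵘ (ℤ.+ m) 0 ℚᵘ.+ mkℚᵘ (ℤ.+ n) 0   ≃⟨ ℚᵘₚ.+-cong (toℚᵘ-fromℚᵘ (mkℚᵘ (ℤ.+ m) 0)) (toℚᵘ-fromℚᵘ (mkℚᵘ (ℤ.+ n) 0)) ⟨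
    toℚᵘ (fromℕ m) ℚᵘ.+ toℚᵘ (fromℕ n)   ≃⟨ toℚᵘ-homo-+ (fromℕ m) (fromℕ n) ⟨
    toℚᵘ (fromℕ m + fromℕ n)             ∎ᵘ)
  where
  open ℚᵘₚ.≤-Reasoning renaming (_∎ to _∎ᵘ) hiding (begin_)

-- Induction on `k` by Pascal's rule: the `k C l` half of a term raises `l`, the `k C suc l` half
-- raises `k ∸ l` and carries the sign. These are the two halves of `Bin (suc k)`.
binomial-Bin : ∀ (s : ℕ → ℚ) → s 0 ≡ 1ℚ → (∀ n → s (suc n) ≡ - s n) → ∀ k (G : ℕ × ℕ → ℚ) →
  sumTo (suc k) (λ l → s (k ℕ.∸ l) * fromℕ (k C l) * G (l , k ℕ.∸ l)) ≡ ⟪ Bin k ∣ G ⟫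
binomial-Bin s s0 s+ zero G rewrite s0 = solve 1 (λ g → con 1ℚ :* con 1ℚ :* g :+ con 0ℚ := con 1ℚ :* g :+ con 0ℚ) refl (G (0 , 0))
binomial-Bin s s0 s+ (suc k) G = begin
    term (suc k) G 0 + sumTo (suc k) (λ l → term (suc k) G (suc l))
      ≡⟨ cong (term (suc k) G 0 +_) (sumTo-cong (suc k) (λ l _ → pascal l)) ⟩
    term (suc k) G 0 + sumTo (suc k) (λ l → term k G₁ l + rest l)
      ≡⟨ cong (term (suc k) G 0 +_) (sumTo-+ (suc k) (term k G₁) rest) ⟩
    term (suc k) G 0 + (sumTo (suc k) (term k G₁) + sumTo (suc k) rest)
      ≡⟨ cong₂ (λ x y → x + (sumTo (suc k) (term k G₁) + y)) head tail ⟩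
    - term k G₂ 0 + (sumTo (suc k) (term k G₁) + - sumTo k (λ l → term k G₂ (suc l)))
      ≡⟨ solve 3 (λ a b c → :- a :+ (b :+ :- c) := b :- (a :+ c)) refl (term k G₂ 0) (sumTo (suc k) (term k G₁)) (sumTo k (λ l → term k G₂ (suc l))) ⟩
    sumTo (suc k) (term k G₁) - sumTo (suc k) (term k G₂)
      ≡⟨ cong₂ _-_ (binomial-Bin s s0 s+ k G₁) (binomial-Bin s s0 s+ k G₂) ⟩
    ⟪ Bin k ∣ G₁ ⟫ - ⟪ Bin k ∣ G₂ ⟫
      ≡⟨ ⟪⟫-Bin-suc k G ⟨
    ⟪ Bin (suc k) ∣ G ⟫ ∎
  where
  term : ℕ → (ℕ × ℕ → ℚ) → ℕ → ℚ
  term k G l = s (k ℕ.∸ l) * fromℕ (k C l) * G (l , k ℕ.∸ l)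
  G₁ G₂ : ℕ × ℕ → ℚ
  G₁ (l , j) = G (suc l , j)
  G₂ (l , j) = G (l , suc j)
  rest : ℕ → ℚ
  rest l = s (k ℕ.∸ l) * fromℕ (k C suc l) * G (suc l , k ℕ.∸ l)
  pascal : ∀ l → term (suc k) G (suc l) ≡ term k G₁ l + rest l
  pascal l = trans
    (cong (λ c → s (k ℕ.∸ l) * c * G (suc l , k ℕ.∸ l))
      (trans (cong fromℕ (sym (nCk+nC[k+1]≡[n+1]C[k+1] k l))) (fromℕ-+ (k C l) (k C suc l))))
    (solve 4 (λ s a b g → s :* (a :+ b) :* g := s :* a :* g :+ s :* b :* g) refl
      (s (k ℕ.∸ l)) (fromℕ (k C l)) (fromℕ (k C suc l)) (G (suc l , k ℕ.∸ l)))
  head : term (suc k) G 0 ≡ - term k G₂ 0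
  head rewrite s+ k = solve 3 (λ s a g → :- s :* a :* g := :- (s :* a :* g)) refl (s k) (fromℕ (suc k C 0)) (G (0 , suc k))
  shift : ∀ l → l ℕ.< k → rest l ≡ - term k G₂ (suc l)
  shift l l<k = begin
    s (k ℕ.∸ l) * c * G (suc l , k ℕ.∸ l)
      ≡⟨ cong (λ z → s z * c * G (suc l , z)) (ℕₚ.+-∸-assoc 1 l<k) ⟩
    s (suc j) * c * G (suc l , suc j)
      ≡⟨ cong (λ z → z * c * G (suc l , suc j)) (s+ j) ⟩
    - s j * c * G (suc l , suc j)
      ≡⟨ solve 3 (λ s a g → :- s :* a :* g := :- (s :* a :* g)) refl (s j) c (G (suc l , suc j)) ⟩
    - (s j * c * G (suc l , suc j)) ∎
    where
    c = fromℕ (k C suc l)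
    j = k ℕ.∸ suc l
  -- Pascal's rule also produces a term at `l = k`, whose coefficient `k C suc k` is zero.
  last : rest k ≡ 0ℚ
  last rewrite k>n⇒nCk≡0 (ℕₚ.n<1+n k) = solve 2 (λ s g → s :* con 0ℚ :* g := con 0ℚ) refl (s (k ℕ.∸ k)) (G (suc k , k ℕ.∸ k))
  tail : sumTo (suc k) rest ≡ - sumTo k (λ l → term k G₂ (suc l))
  tail = begin
    sumTo (suc k) rest ≡⟨ sumTo-snoc k rest ⟩
    sumTo k rest + rest k ≡⟨ cong₂ _+_ (sumTo-cong k shift) last ⟩
    sumTo k (λ l → - term k G₂ (suc l)) + 0ℚ ≡⟨ +-identityʳ _ ⟩
    sumTo k (λ l → - term k G₂ (suc l)) ≡⟨ sumTo-neg k (λ l → term k G₂ (suc l)) ⟩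
    - sumTo k (λ l → term k G₂ (suc l)) ∎

⟪⟫-concatMap-upTo : ∀ {I : Set} (h : ℕ → Lin I) (t : ℕ → ℕ) n f →
  ⟪ concatMap h (applyUpTo t n) ∣ f ⟫ ≡ sumTo n (λ l → ⟪ h (t l) ∣ f ⟫)
⟪⟫-concatMap-upTo h t zero f = refl
⟪⟫-concatMap-upTo h t (suc n) f = trans (⟪⟫-++ (h (t 0)) (concatMap h (applyUpTo (t ∘ suc) n)) f)
  (cong (⟪ h (t 0) ∣ f ⟫ +_) (⟪⟫-concatMap-upTo h (t ∘ suc) n f))

⟪⟫-br-mon : ∀ {A : Set} (u v : Word A) f → ⟪ br (mon u) (mon v) ∣ f ⟫ ≡ f (u ++ v) - f (v ++ u)
⟪⟫-br-mon u v f = trans (⟪⟫-br (mon u) (mon v) f) (trans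
  (⟪⟫-mon u (λ u → ⟪ mon v ∣ (λ v → f (u ++ v) - f (v ++ u)) ⟫)) (⟪⟫-mon v (λ v → f (u ++ v) - f (v ++ u))))

sign : ℕ → ℚ
sign zero = 1ℚ
sign (suc n) = - sign n

-- The summand of substs and its sign function are local to the definition of substs, so
-- they are named by unification; replacing _*_ by a variable makes that problem solvable.
substsTerm : ∀ k (w : Word B) → ∃ λ (h : ℕ → ℚ × ℕ × Word B → ℚ × ℕ × Word B) →
  substs (suc k ∷ w) ≡ concatMap (λ l → map (h l) (substs w)) (upTo (suc k))
substsTerm k w = _ , refl

mutual
  sgn : ℕ → Word B → ℕ → ℚ
  sgn = _

  substsTerm-≡ : ∀ k w l b r u → proj₁ (substsTerm k w) l (b , r , u)
    ≡ (sign (k ℕ.∸ l) * fromℕ (k C l) * b , (k ℕ.∸ l) ℕ.+ r , suc l ∷ u)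
  substsTerm-≡ k w l b r u with ℚ._*_ | k ℕ.∸ l
  ... | _∙_ | n = scaled _∙_ (sgn≡sign k w n)
    where
    scaled : ∀ (_∙_ : ℚ → ℚ → ℚ) {a a′ c b} {i : ℕ × Word B} → a ≡ a′ → ((a ∙ c) ∙ b , i) ≡ ((a′ ∙ c) ∙ b , i)
    scaled _ refl = refl

  sgn≡sign : ∀ k w n → sgn k w n ≡ sign n
  sgn≡sign k w zero = refl
  sgn≡sign k w (suc n) = cong -_ (sgn≡sign k w n)

⟪⟫-substs-0 : ∀ w G → ⟪ substs (0 ∷ w) ∣ G ⟫ ≡ ⟪ substs w ∣ (λ (r , u) → G (r , 0 ∷ u)) ⟫
⟪⟫-substs-0 w G = ⟪⟫-mapI (λ (r , u) → r , 0 ∷ u) (substs w) G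

⟪⟫-substs-suc : ∀ k w G → ⟪ substs (suc k ∷ w) ∣ G ⟫
  ≡ ⟪ Bin k ∣ (λ (l , j) → ⟪ substs w ∣ (λ (r , u) → G (j ℕ.+ r , suc l ∷ u)) ⟫) ⟫
⟪⟫-substs-suc k w G = begin
    ⟪ substs (suc k ∷ w) ∣ G ⟫ ≡⟨ cong (λ p → ⟪ p ∣ G ⟫) (proj₂ (substsTerm k w)) ⟩
    ⟪ concatMap h (upTo (suc k)) ∣ G ⟫ ≡⟨ ⟪⟫-concatMap-upTo h (λ l → l) (suc k) G ⟩
    sumTo (suc k) (λ l → ⟪ h l ∣ G ⟫)
      ≡⟨ sumTo-cong (suc k) (λ l _ → ⟪⟫-map (sign (k ℕ.∸ l) * fromℕ (k C l)) (λ (r , u) → (k ℕ.∸ l) ℕ.+ r , suc l ∷ u)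
           (λ b (r , u) → substsTerm-≡ k w l b r u) (substs w) G) ⟩
    sumTo (suc k) (λ l → sign (k ℕ.∸ l) * fromℕ (k C l) * G′ (l , k ℕ.∸ l))
      ≡⟨ binomial-Bin sign refl (λ _ → refl) k G′ ⟩
    ⟪ Bin k ∣ G′ ⟫ ∎
  where
  h : ℕ → Lin (ℕ × Word B)
  h l = map (proj₁ (substsTerm k w) l) (substs w)
  G′ : ℕ × ℕ → ℚ
  G′ (l , j) = ⟪ substs w ∣ (λ (r , u) → G (j ℕ.+ r , suc l ∷ u)) ⟫

-- `substs` recurses from the left, but `revB` moves the first letter of a word in Y to the right
-- end.
⟪⟫-substs-snoc : ∀ w k G → ⟪ substs (w ++ suc k ∷ []) ∣ G ⟫
  ≡ ⟪ substs w ∣ (λ (r , u) → ⟪ Bin k ∣ (λ (l , j) → G (j ℕ.+ r , u ++ suc l ∷ [])) ⟫) ⟫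
⟪⟫-substs-snoc [] k G = begin
  ⟪ substs (suc k ∷ []) ∣ G ⟫ ≡⟨ ⟪⟫-substs-suc k [] G ⟩
  ⟪ Bin k ∣ (λ (l , j) → ⟪ substs [] ∣ (λ (r , u) → G (j ℕ.+ r , suc l ∷ u)) ⟫) ⟫
    ≡⟨ ⟪⟫-cong (Bin k) (λ (l , j) → ⟪⟫-single (0 , []) (λ (r , u) → G (j ℕ.+ r , suc l ∷ u))) ⟩
  ⟪ Bin k ∣ (λ (l , j) → G (j ℕ.+ 0 , suc l ∷ [])) ⟫
    ≡⟨ ⟪⟫-single (0 , []) (λ (r , u) → ⟪ Bin k ∣ (λ (l , j) → G (j ℕ.+ r , u ++ suc l ∷ [])) ⟫) ⟨
  ⟪ substs [] ∣ (λ (r , u) → ⟪ Bin k ∣ (λ (l , j) → G (j ℕ.+ r , u ++ suc l ∷ [])) ⟫) ⟫ ∎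
⟪⟫-substs-snoc (zero ∷ w) k G = trans (⟪⟫-substs-0 (w ++ suc k ∷ []) G) (trans
  (⟪⟫-substs-snoc w k (λ (r , u) → G (r , 0 ∷ u)))
  (sym (⟪⟫-substs-0 w (λ (r , u) → ⟪ Bin k ∣ (λ (l , j) → G (j ℕ.+ r , u ++ suc l ∷ [])) ⟫))))
⟪⟫-substs-snoc (suc m ∷ w) k G = begin
  ⟪ substs (suc m ∷ w ++ suc k ∷ []) ∣ G ⟫ ≡⟨ ⟪⟫-substs-suc m (w ++ suc k ∷ []) G ⟩
  ⟪ Bin m ∣ (λ (l , j) → ⟪ substs (w ++ suc k ∷ []) ∣ (λ (r , u) → G (j ℕ.+ r , suc l ∷ u)) ⟫) ⟫
    ≡⟨ ⟪⟫-cong (Bin m) (λ (l , j) → ⟪⟫-substs-snoc w k (λ (r , u) → G (j ℕ.+ r , suc l ∷ u))) ⟩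
  ⟪ Bin m ∣ (λ (l , j) → ⟪ substs w ∣ (λ (r , u) → ⟪ Bin k ∣ (λ (l′ , j′) → G (j ℕ.+ (j′ ℕ.+ r) , suc l ∷ u ++ suc l′ ∷ [])) ⟫) ⟫) ⟫
    ≡⟨ ⟪⟫-cong (Bin m) (λ (l , j) → ⟪⟫-cong (substs w) (λ (r , u) → ⟪⟫-cong (Bin k) (λ (l′ , j′) →
         cong (λ n → G (n , suc l ∷ u ++ suc l′ ∷ [])) (trans (sym (ℕₚ.+-assoc j j′ r)) (trans (cong (ℕ._+ r) (ℕₚ.+-comm j j′)) (ℕₚ.+-assoc j′ j r)))))) ⟩
  ⟪ Bin m ∣ (λ (l , j) → ⟪ substs w ∣ (λ (r , u) → ⟪ Bin k ∣ (λ (l′ , j′) → G (j′ ℕ.+ (j ℕ.+ r) , suc l ∷ u ++ suc l′ ∷ [])) ⟫) ⟫) ⟫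
    ≡⟨ ⟪⟫-substs-suc m w (λ (r , u) → ⟪ Bin k ∣ (λ (l , j) → G (j ℕ.+ r , u ++ suc l ∷ [])) ⟫) ⟨
  ⟪ substs (suc m ∷ w) ∣ (λ (r , u) → ⟪ Bin k ∣ (λ (l , j) → G (j ℕ.+ r , u ++ suc l ∷ [])) ⟫) ⟫ ∎

-- One formula for both clauses of `∂W`: a power of b₀ has only itself as a substitution, with shift
-- zero, and the general sum becomes [b_{i+1}, w].
⟪⟫-∂W-suc : ∀ w i f → ⟪ ∂W w (suc i) ∣ f ⟫
  ≡ ⟪ substs w ∣ (λ (r , u) → f (suc (i ℕ.+ r) ∷ u) - f (u ++ suc (i ℕ.+ r) ∷ [])) ⟫
⟪⟫-∂W-suc w i f with hasNonzero w in eq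
... | true = ⟪⟫-concatMap f (λ (r , u) → f (suc (i ℕ.+ r) ∷ u) - f (u ++ suc (i ℕ.+ r) ∷ []))
      (λ c (r , u) → trans (⟪⟫-· c (br (letter (suc (i ℕ.+ r))) (mon u)) f) (cong (c *_) (⟪⟫-br-mon (suc (i ℕ.+ r) ∷ []) u f))) (substs w)
... | false = trans (⟪⟫-br-mon (suc i ∷ []) w f) (sym (trans (substs-zeros w eq (λ (r , u) → f (suc (i ℕ.+ r) ∷ u) - f (u ++ suc (i ℕ.+ r) ∷ [])))
      (cong (λ n → f (suc n ∷ w) - f (w ++ suc n ∷ [])) (ℕₚ.+-identityʳ i))))
  where
  substs-zeros : ∀ w → hasNonzero w ≡ false → ∀ G → ⟪ substs w ∣ G ⟫ ≡ G (0 , w)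
  substs-zeros [] _ G = ⟪⟫-single (0 , []) G
  substs-zeros (zero ∷ w) e G = trans (⟪⟫-substs-0 w G) (substs-zeros w e (λ (r , u) → G (r , 0 ∷ u)))

-- The operator v ↦ Σ_r (-1)^r/r! ∂₀^r(v) ⊗ r, where ∂₀ is the derivation with x₀ ↦ 1, x₁ ↦ 0.
SubY : Word Y → Lin (Word Y × ℕ)
SubY [] = (1ℚ , [] , 0) ∷ []
SubY (k ∷ v) = bind (Bin k) (λ (l , j) → mapI (λ (u , r) → l ∷ u , j ℕ.+ r) (SubY v))

⟪⟫-SubY-∷ : ∀ k v G → ⟪ SubY (k ∷ v) ∣ G ⟫
  ≡ ⟪ Bin k ∣ (λ (l , j) → ⟪ SubY v ∣ (λ (u , r) → G (l ∷ u , j ℕ.+ r)) ⟫) ⟫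
⟪⟫-SubY-∷ k v G = trans (⟪⟫-bind (Bin k) (λ (l , j) → mapI (λ (u , r) → l ∷ u , j ℕ.+ r) (SubY v)) G)
  (⟪⟫-cong (Bin k) (λ (l , j) → ⟪⟫-mapI (λ (u , r) → l ∷ u , j ℕ.+ r) (SubY v) G))

-- Here the binomial coefficients of ∂_w are recognized as those of Σ_r (-1)^r/r! ∂₀^r: each letter
-- contributes its own factor `Bin k`, and reversal only changes the order of the factors.
⟪⟫-substs-revB : ∀ v G → ⟪ substs (revB v) ∣ G ⟫ ≡ ⟪ SubY v ∣ (λ (u , r) → G (r , revB u)) ⟫
⟪⟫-substs-revB [] G = refl
⟪⟫-substs-revB (k ∷ v) G = begin
  ⟪ substs (revB v ++ suc k ∷ []) ∣ G ⟫ ≡⟨ ⟪⟫-substs-snoc (revB v) k G ⟩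
  ⟪ substs (revB v) ∣ (λ (r , u) → ⟪ Bin k ∣ (λ (l , j) → G (j ℕ.+ r , u ++ suc l ∷ [])) ⟫) ⟫
    ≡⟨ ⟪⟫-substs-revB v (λ (r , u) → ⟪ Bin k ∣ (λ (l , j) → G (j ℕ.+ r , u ++ suc l ∷ [])) ⟫) ⟩
  ⟪ SubY v ∣ (λ (u , r) → ⟪ Bin k ∣ (λ (l , j) → G (j ℕ.+ r , revB u ++ suc l ∷ [])) ⟫) ⟫
    ≡⟨ ⟪⟫-swap (SubY v) (Bin k) (λ (u , r) (l , j) → G (j ℕ.+ r , revB u ++ suc l ∷ [])) ⟩
  ⟪ Bin k ∣ (λ (l , j) → ⟪ SubY v ∣ (λ (u , r) → G (j ℕ.+ r , revB u ++ suc l ∷ [])) ⟫) ⟫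
    ≡⟨ ⟪⟫-SubY-∷ k v (λ (u , r) → G (r , revB u)) ⟨
  ⟪ SubY (k ∷ v) ∣ (λ (u , r) → G (r , revB u)) ⟫ ∎

-- Only b₀ and b₁ occur, and k_i = 1 forces l_i = 1. Hence ∂_a is simply b_i ↦ [b_i, a] for i ≥ 1.
⟪⟫-substs-X : ∀ x G → ⟪ substs (map letterX x) ∣ G ⟫ ≡ G (0 , map letterX x)
⟪⟫-substs-X [] G = ⟪⟫-single (0 , []) G
⟪⟫-substs-X (x₀ ∷ x) G = trans (⟪⟫-substs-0 (map letterX x) G) (⟪⟫-substs-X x (λ (r , u) → G (r , 0 ∷ u)))
⟪⟫-substs-X (x₁ ∷ x) G = trans (⟪⟫-substs-suc 0 (map letterX x) G) (trans
  (⟪⟫-single (0 , 0) (λ (l , j) → ⟪ substs (map letterX x) ∣ (λ (r , u) → G (j ℕ.+ r , suc l ∷ u)) ⟫))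
  (⟪⟫-substs-X x (λ (r , u) → G (r , 1 ∷ u))))

-- Reconstructing a Lie element from π_Y

-- H = id ⋆ Θ (convolution with respect to Δ), where Θ(x₀^n) = (-x₀)^n and Θ
-- kills every other word; on primitive elements H is the identity up to powers of x₀.
H : Word X → Poly X
H [] = oneP
H (x₁ ∷ w) = mapI (x₁ ∷_) (H w)
H (x₀ ∷ w) = mapI (x₀ ∷_) (H w) ⊖ mapI (_++ x₀ ∷ []) (H w)

⟪⟫-H-x₁ : ∀ w f → ⟪ H (x₁ ∷ w) ∣ f ⟫ ≡ ⟪ H w ∣ (λ z → f (x₁ ∷ z)) ⟫
⟪⟫-H-x₁ w f = ⟪⟫-mapI (x₁ ∷_) (H w) f

⟪⟫-H-x₀ : ∀ w f → ⟪ H (x₀ ∷ w) ∣ f ⟫ ≡ ⟪ H w ∣ (λ z → f (x₀ ∷ z)) ⟫ - ⟪ H w ∣ (λ z → f (z ++ x₀ ∷ [])) ⟫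
⟪⟫-H-x₀ w f = trans (⟪⟫-⊖ (mapI (x₀ ∷_) (H w)) (mapI (_++ x₀ ∷ []) (H w)) f)
  (cong₂ _-_ (⟪⟫-mapI (x₀ ∷_) (H w) f) (⟪⟫-mapI (_++ x₀ ∷ []) (H w) f))

-- The scalar by which the map Θ in `H` acts: Θ(v) = `ε v` v.
ε : Word X → ℚ
ε [] = 1ℚ
ε (x₀ ∷ v) = - ε v
ε (x₁ ∷ v) = 0ℚ

-- A power of x₀ is recorded through the two consequences in use: it commutes with x₀, and its
-- Y-part is empty.
ε-zero-or-power : ∀ v → ε v ≡ 0ℚ ⊎ (x₀ ∷ v ≡ v ++ x₀ ∷ [] × proj₁ (sp v) ≡ [])
ε-zero-or-power [] = inj₂ (refl , refl)
ε-zero-or-power (x₁ ∷ v) = inj₁ refl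
ε-zero-or-power (x₀ ∷ v) with ε-zero-or-power v
... | inj₁ e = inj₁ (cong -_ e)
... | inj₂ (e , e′) with sp v
... | [] , r = inj₂ (cong (x₀ ∷_) e , refl)
... | k ∷ u , r with () ← e′

-- Where `ε v` is nonzero, `v` is a power of x₀, so an x₀ put in front of `v` by the coproduct can
-- be moved to the right end of `u ++ v`. This is the subtracted term of `H`.
⟪⟫-ΔW-H : ∀ w f → ⟪ ΔW w ∣ (λ (u , v) → ε v * f (u ++ v)) ⟫ ≡ ⟪ H w ∣ f ⟫
⟪⟫-ΔW-H [] f = cong (λ z → 1ℚ * z + 0ℚ) (*-identityˡ (f []))
⟪⟫-ΔW-H (x₁ ∷ w) f = begin
  ⟪ ΔW (x₁ ∷ w) ∣ (λ (u , v) → ε v * f (u ++ v)) ⟫ ≡⟨ ⟪⟫-ΔW-∷ x₁ w (λ (u , v) → ε v * f (u ++ v)) ⟩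
  ⟪ ΔW w ∣ (λ (u , v) → ε v * f (x₁ ∷ u ++ v) + 0ℚ * f (u ++ x₁ ∷ v)) ⟫
    ≡⟨ ⟪⟫-cong (ΔW w) (λ (u , v) → trans (cong (ε v * f (x₁ ∷ u ++ v) +_) (*-zeroˡ (f (u ++ x₁ ∷ v)))) (+-identityʳ _)) ⟩
  ⟪ ΔW w ∣ (λ (u , v) → ε v * f (x₁ ∷ u ++ v)) ⟫ ≡⟨ ⟪⟫-ΔW-H w (λ z → f (x₁ ∷ z)) ⟩
  ⟪ H w ∣ (λ z → f (x₁ ∷ z)) ⟫ ≡⟨ ⟪⟫-H-x₁ w f ⟨
  ⟪ H (x₁ ∷ w) ∣ f ⟫ ∎
⟪⟫-ΔW-H (x₀ ∷ w) f = begin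
  ⟪ ΔW (x₀ ∷ w) ∣ (λ (u , v) → ε v * f (u ++ v)) ⟫ ≡⟨ ⟪⟫-ΔW-∷ x₀ w (λ (u , v) → ε v * f (u ++ v)) ⟩
  ⟪ ΔW w ∣ (λ (u , v) → ε v * f (x₀ ∷ u ++ v) + - ε v * f (u ++ x₀ ∷ v)) ⟫
    ≡⟨ ⟪⟫-cong (ΔW w) (λ (u , v) → cong (ε v * f (x₀ ∷ u ++ v) +_) (move u v)) ⟩
  ⟪ ΔW w ∣ (λ (u , v) → ε v * f (x₀ ∷ u ++ v) - ε v * f ((u ++ v) ++ x₀ ∷ [])) ⟫
    ≡⟨ ⟪⟫-- (ΔW w) (λ (u , v) → ε v * f (x₀ ∷ u ++ v)) (λ (u , v) → ε v * f ((u ++ v) ++ x₀ ∷ [])) ⟩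
  ⟪ ΔW w ∣ (λ (u , v) → ε v * f (x₀ ∷ u ++ v)) ⟫ - ⟪ ΔW w ∣ (λ (u , v) → ε v * f ((u ++ v) ++ x₀ ∷ [])) ⟫
    ≡⟨ cong₂ _-_ (⟪⟫-ΔW-H w (λ z → f (x₀ ∷ z))) (⟪⟫-ΔW-H w (λ z → f (z ++ x₀ ∷ []))) ⟩
  ⟪ H w ∣ (λ z → f (x₀ ∷ z)) ⟫ - ⟪ H w ∣ (λ z → f (z ++ x₀ ∷ [])) ⟫ ≡⟨ ⟪⟫-H-x₀ w f ⟨
  ⟪ H (x₀ ∷ w) ∣ f ⟫ ∎
  where
  move : ∀ u v → - ε v * f (u ++ x₀ ∷ v) ≡ - (ε v * f ((u ++ v) ++ x₀ ∷ []))
  move u v with ε-zero-or-power v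
  ... | inj₁ e rewrite e = trans (*-zeroˡ (f (u ++ x₀ ∷ v))) (sym (cong -_ (*-zeroˡ (f ((u ++ v) ++ x₀ ∷ [])))))
  ... | inj₂ (e , _) = trans (sym (neg-distribˡ-* (ε v) (f (u ++ x₀ ∷ v))))
    (cong (λ z → - (ε v * f z)) (trans (cong (u ++_) e) (sym (++-assoc u v (x₀ ∷ [])))))

-- The innermost step is x₀ 1 - 1 x₀ = 0, and the remaining letters act linearly. Hence `H` sees
-- only the words with final exponent zero.
⟪⟫-H-snoc-x₀ : ∀ w f → ⟪ H (w ++ x₀ ∷ []) ∣ f ⟫ ≡ 0ℚ
⟪⟫-H-snoc-x₀ [] f = trans (⟪⟫-H-x₀ [] f) (+-inverseʳ ⟪ H [] ∣ (λ z → f (x₀ ∷ [])) ⟫)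
⟪⟫-H-snoc-x₀ (x₁ ∷ w) f = trans (⟪⟫-H-x₁ (w ++ x₀ ∷ []) f) (⟪⟫-H-snoc-x₀ w (λ z → f (x₁ ∷ z)))
⟪⟫-H-snoc-x₀ (x₀ ∷ w) f = trans (⟪⟫-H-x₀ (w ++ x₀ ∷ []) f)
  (cong₂ _-_ (⟪⟫-H-snoc-x₀ w (λ z → f (x₀ ∷ z))) (⟪⟫-H-snoc-x₀ w (λ z → f (z ++ x₀ ∷ []))))

replicate-snoc : ∀ n (a : A) → a ∷ replicate n a ≡ replicate n a ++ a ∷ []
replicate-snoc zero a = refl
replicate-snoc (suc n) a = cong (a ∷_) (replicate-snoc n a)

emb-++-x₀^ : ∀ u r n → emb u r ++ replicate n x₀ ≡ emb u (n ℕ.+ r)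
emb-++-x₀^ [] r zero = ++-identityʳ _
emb-++-x₀^ [] r (suc n) = begin
  replicate r x₀ ++ x₀ ∷ replicate n x₀ ≡⟨ cong (replicate r x₀ ++_) (replicate-snoc n x₀) ⟩
  replicate r x₀ ++ (replicate n x₀ ++ x₀ ∷ []) ≡⟨ ++-assoc (replicate r x₀) (replicate n x₀) _ ⟨
  (replicate r x₀ ++ replicate n x₀) ++ x₀ ∷ [] ≡⟨ cong (_++ x₀ ∷ []) (emb-++-x₀^ [] r n) ⟩
  replicate (n ℕ.+ r) x₀ ++ x₀ ∷ [] ≡⟨ replicate-snoc (n ℕ.+ r) x₀ ⟨
  x₀ ∷ replicate (n ℕ.+ r) x₀ ∎
emb-++-x₀^ (k ∷ u) r n = trans (++-assoc (replicate k x₀) (x₁ ∷ emb u r) (replicate n x₀))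
  (cong (λ z → replicate k x₀ ++ x₁ ∷ z) (emb-++-x₀^ u r n))

-- In `H` a letter x₀ acts as ad x₀, so a block gives ad_{x₀}^k (x₁ H(w)), expanded binomially: `l`
-- factors stay on the left and `j` go to the right end.
⟪⟫-H-block : ∀ k w f → ⟪ H (replicate k x₀ ++ x₁ ∷ w) ∣ f ⟫
  ≡ ⟪ Bin k ∣ (λ (l , j) → ⟪ H w ∣ (λ z → f (replicate l x₀ ++ x₁ ∷ z ++ replicate j x₀)) ⟫) ⟫
⟪⟫-H-block zero w f = trans (⟪⟫-H-x₁ w f) (trans
  (⟪⟫-cong (H w) (λ z → cong (λ y → f (x₁ ∷ y)) (sym (++-identityʳ z))))
  (sym (⟪⟫-single (0 , 0) (λ (l , j) → ⟪ H w ∣ (λ z → f (replicate l x₀ ++ x₁ ∷ z ++ replicate j x₀)) ⟫))))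
⟪⟫-H-block (suc k) w f = begin
  ⟪ H (x₀ ∷ replicate k x₀ ++ x₁ ∷ w) ∣ f ⟫ ≡⟨ ⟪⟫-H-x₀ (replicate k x₀ ++ x₁ ∷ w) f ⟩
  ⟪ H (replicate k x₀ ++ x₁ ∷ w) ∣ (λ z → f (x₀ ∷ z)) ⟫ - ⟪ H (replicate k x₀ ++ x₁ ∷ w) ∣ (λ z → f (z ++ x₀ ∷ [])) ⟫
    ≡⟨ cong₂ _-_ (⟪⟫-H-block k w (λ z → f (x₀ ∷ z)))
         (trans (⟪⟫-H-block k w (λ z → f (z ++ x₀ ∷ []))) (⟪⟫-cong (Bin k) (λ (l , j) → ⟪⟫-cong (H w) (λ z → cong f (shift l j z))))) ⟩
  ⟪ Bin k ∣ (λ (l , j) → G (suc l , j)) ⟫ - ⟪ Bin k ∣ (λ (l , j) → G (l , suc j)) ⟫ ≡⟨ ⟪⟫-Bin-suc k G ⟨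
  ⟪ Bin (suc k) ∣ G ⟫ ∎
  where
  G : ℕ × ℕ → ℚ
  G (l , j) = ⟪ H w ∣ (λ z → f (replicate l x₀ ++ x₁ ∷ z ++ replicate j x₀)) ⟫
  shift : ∀ l j (z : Word X) → (replicate l x₀ ++ x₁ ∷ z ++ replicate j x₀) ++ x₀ ∷ []
    ≡ replicate l x₀ ++ x₁ ∷ z ++ x₀ ∷ replicate j x₀
  shift l j z = trans (++-assoc (replicate l x₀) _ _) (cong (λ y → replicate l x₀ ++ x₁ ∷ y)
    (trans (++-assoc z _ _) (cong (z ++_) (sym (replicate-snoc j x₀)))))

⟪⟫-H-emb : ∀ u r f → ⟪ H (emb u r) ∣ f ⟫ ≡ onY (λ v → ⟪ SubY v ∣ (λ (u , r) → f (emb u r)) ⟫) (u , r)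
⟪⟫-H-emb [] zero f = refl
⟪⟫-H-emb [] (suc r) f = trans (cong (λ z → ⟪ H z ∣ f ⟫) (replicate-snoc r x₀)) (⟪⟫-H-snoc-x₀ (replicate r x₀) f)
⟪⟫-H-emb (k ∷ u) r f = begin
  ⟪ H (replicate k x₀ ++ x₁ ∷ emb u r) ∣ f ⟫ ≡⟨ ⟪⟫-H-block k (emb u r) f ⟩
  ⟪ Bin k ∣ (λ (l , j) → ⟪ H (emb u r) ∣ (λ z → f (replicate l x₀ ++ x₁ ∷ z ++ replicate j x₀)) ⟫) ⟫
    ≡⟨ ⟪⟫-cong (Bin k) (λ (l , j) → trans (⟪⟫-H-emb u r (λ z → f (replicate l x₀ ++ x₁ ∷ z ++ replicate j x₀)))
         (onY-cong (λ v → ⟪⟫-cong (SubY v) (λ (u , r) → cong (λ z → f (replicate l x₀ ++ x₁ ∷ z)) (emb-++-x₀^ u r j))) (u , r))) ⟩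
  ⟪ Bin k ∣ (λ (l , j) → onY (λ v → ⟪ SubY v ∣ (λ (u , r) → f (emb (l ∷ u) (j ℕ.+ r))) ⟫) (u , r)) ⟫
    ≡⟨ collect r ⟩
  onY (λ v → ⟪ SubY v ∣ (λ (u , r) → f (emb u r)) ⟫) (k ∷ u , r) ∎
  where
  collect : ∀ r → ⟪ Bin k ∣ (λ (l , j) → onY (λ v → ⟪ SubY v ∣ (λ (u , r) → f (emb (l ∷ u) (j ℕ.+ r))) ⟫) (u , r)) ⟫
    ≡ onY (λ v → ⟪ SubY v ∣ (λ (u , r) → f (emb u r)) ⟫) (k ∷ u , r)
  collect zero = sym (⟪⟫-SubY-∷ k u (λ (u , r) → f (emb u r)))
  collect (suc r) = ⟪⟫-zero (Bin k) (λ _ → refl)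

LieX-⟪⟫ : ∀ φ → LieX φ → ∀ F → ⟪ φ ∣ (λ w → ⟪ ΔW w ∣ F ⟫) ⟫ ≡ ⟪ φ ∣ (λ w → F (w , []) + F ([] , w)) ⟫
LieX-⟪⟫ φ lie F = trans (sym (⟪⟫-Δ φ F)) (trans (WX.≈₂⇒⟪⟫ (Δ φ) (prim₂ φ) lie F) (⟪⟫-prim₂ φ F))

-- A Lie element is determined by the words ending in x₁ (up to powers of x₀).
Lie-reconstruct : ∀ φ → LieX φ → ∀ g → (∀ r → g ([] , r) ≡ 0ℚ) →
  ⟪ φ ∣ (λ w → g (sp w)) ⟫ ≡ ⟪ φ ∣ (λ w → onY (λ v → ⟪ SubY v ∣ g ⟫) (sp w)) ⟫
Lie-reconstruct φ lie g g0 = begin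
  -- On a primitive φ, id ⋆ Θ gives φ + Θ(φ); the second term lives on powers of x₀, where `g`
  -- vanishes.
  ⟪ φ ∣ (λ w → g (sp w)) ⟫ ≡⟨ ⟪⟫-cong φ (λ w → expand w) ⟩
  ⟪ φ ∣ (λ w → 1ℚ * g (sp (w ++ [])) + ε w * g (sp w)) ⟫ ≡⟨ LieX-⟪⟫ φ lie (λ (u , v) → ε v * g (sp (u ++ v))) ⟨
  ⟪ φ ∣ (λ w → ⟪ ΔW w ∣ (λ (u , v) → ε v * g (sp (u ++ v))) ⟫) ⟫ ≡⟨ ⟪⟫-cong φ (λ w → ⟪⟫-ΔW-H w (λ z → g (sp z))) ⟩
  ⟪ φ ∣ (λ w → ⟪ H w ∣ (λ z → g (sp z)) ⟫) ⟫ ≡⟨ ⟪⟫-cong φ (λ w → trans (cong (λ z → ⟪ H z ∣ (λ z → g (sp z)) ⟫) (emb-sp w))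
      (trans (⟪⟫-H-emb (proj₁ (sp w)) (proj₂ (sp w)) (λ z → g (sp z)))
        (onY-cong (λ v → ⟪⟫-cong (SubY v) (λ (u , r) → cong g (sp-emb u r))) (sp w)))) ⟩
  ⟪ φ ∣ (λ w → onY (λ v → ⟪ SubY v ∣ g ⟫) (sp w)) ⟫ ∎
  where
  vanish : ∀ w → ε w * g (sp w) ≡ 0ℚ
  vanish w with ε-zero-or-power w
  ... | inj₁ e = trans (cong (_* g (sp w)) e) (*-zeroˡ (g (sp w)))
  ... | inj₂ (_ , e) = trans (cong (ε w *_) (trans (cong (λ u → g (u , proj₂ (sp w))) e) (g0 _))) (*-zeroʳ (ε w))
  expand : ∀ w → g (sp w) ≡ 1ℚ * g (sp (w ++ [])) + ε w * g (sp w)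
  expand w = sym (trans (cong₂ _+_ (trans (*-identityˡ (g (sp (w ++ [])))) (cong (λ z → g (sp z)) (++-identityʳ w))) (vanish w)) (+-identityʳ (g (sp w))))

⟪⟫-ΔW-snoc : ∀ (w : Word A) a F →
  ⟪ ΔW (w ++ a ∷ []) ∣ F ⟫ ≡ ⟪ ΔW w ∣ (λ (u , v) → F (u ++ a ∷ [] , v) + F (u , v ++ a ∷ [])) ⟫
⟪⟫-ΔW-snoc [] a F = ⟪⟫-ΔW-∷ a [] F
⟪⟫-ΔW-snoc (b ∷ w) a F = begin
  ⟪ ΔW (b ∷ w ++ a ∷ []) ∣ F ⟫ ≡⟨ ⟪⟫-ΔW-∷ b (w ++ a ∷ []) F ⟩
  ⟪ ΔW (w ++ a ∷ []) ∣ (λ (u , v) → F (b ∷ u , v) + F (u , b ∷ v)) ⟫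
    ≡⟨ ⟪⟫-ΔW-snoc w a (λ (u , v) → F (b ∷ u , v) + F (u , b ∷ v)) ⟩
  ⟪ ΔW w ∣ (λ (u , v) → (F (b ∷ u ++ a ∷ [] , v) + F (u ++ a ∷ [] , b ∷ v)) + (F (b ∷ u , v ++ a ∷ []) + F (u , b ∷ v ++ a ∷ []))) ⟫
    ≡⟨ ⟪⟫-cong (ΔW w) (λ (u , v) → solve 4 (λ p q r s → (p :+ q) :+ (r :+ s) := (p :+ r) :+ (q :+ s)) refl
         (F (b ∷ u ++ a ∷ [] , v)) (F (u ++ a ∷ [] , b ∷ v)) (F (b ∷ u , v ++ a ∷ [])) (F (u , b ∷ v ++ a ∷ []))) ⟩
  ⟪ ΔW w ∣ (λ (u , v) → (F (b ∷ u ++ a ∷ [] , v) + F (b ∷ u , v ++ a ∷ [])) + (F (u ++ a ∷ [] , b ∷ v) + F (u , b ∷ v ++ a ∷ []))) ⟫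
    ≡⟨ ⟪⟫-ΔW-∷ b w (λ (u , v) → F (u ++ a ∷ [] , v) + F (u , v ++ a ∷ [])) ⟨
  ⟪ ΔW (b ∷ w) ∣ (λ (u , v) → F (u ++ a ∷ [] , v) + F (u , v ++ a ∷ [])) ⟫ ∎

-- `SubY` is an algebra morphism into ℚ⟨Y⟩[t], with `r` the degree in a central variable t. It sends
-- letters to combinations of letters, hence primitives to primitives, and so commutes with Δ_Y; the
-- degrees of the two tensor factors add up.
SubY-Δ : ∀ v (F : ℕ → Word Y × Word Y → ℚ) →
  ⟪ SubY v ∣ (λ (u , r) → ⟪ ΔW u ∣ F r ⟫) ⟫
  ≡ ⟪ ΔW v ∣ (λ (p , q) → ⟪ SubY p ∣ (λ (u , r) → ⟪ SubY q ∣ (λ (u′ , r′) → F (r ℕ.+ r′) (u , u′)) ⟫) ⟫) ⟫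
SubY-Δ [] F = begin
  ⟪ SubY [] ∣ (λ (u , r) → ⟪ ΔW u ∣ F r ⟫) ⟫ ≡⟨ ⟪⟫-single ([] , 0) (λ (u , r) → ⟪ ΔW u ∣ F r ⟫) ⟩
  ⟪ ΔW [] ∣ F 0 ⟫ ≡⟨ ⟪⟫-single ([] , []) (F 0) ⟩
  F 0 ([] , []) ≡⟨ ⟪⟫-single ([] , 0) (λ (u′ , r′) → F r′ ([] , u′)) ⟨
  ⟪ SubY [] ∣ (λ (u′ , r′) → F r′ ([] , u′)) ⟫ ≡⟨ ⟪⟫-single ([] , 0) (λ (u , r) → ⟪ SubY [] ∣ (λ (u′ , r′) → F (r ℕ.+ r′) (u , u′)) ⟫) ⟨
  ⟪ SubY [] ∣ (λ (u , r) → ⟪ SubY [] ∣ (λ (u′ , r′) → F (r ℕ.+ r′) (u , u′)) ⟫) ⟫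
    ≡⟨ ⟪⟫-single ([] , []) (λ (p , q) → ⟪ SubY p ∣ (λ (u , r) → ⟪ SubY q ∣ (λ (u′ , r′) → F (r ℕ.+ r′) (u , u′)) ⟫) ⟫) ⟨
  ⟪ ΔW [] ∣ (λ (p , q) → ⟪ SubY p ∣ (λ (u , r) → ⟪ SubY q ∣ (λ (u′ , r′) → F (r ℕ.+ r′) (u , u′)) ⟫) ⟫) ⟫ ∎
SubY-Δ (k ∷ v) F = begin
    ⟪ SubY (k ∷ v) ∣ (λ (u , r) → ⟪ ΔW u ∣ F r ⟫) ⟫
      ≡⟨ ⟪⟫-SubY-∷ k v (λ (u , r) → ⟪ ΔW u ∣ F r ⟫) ⟩
    ⟪ Bin k ∣ (λ (l , j) → ⟪ SubY v ∣ (λ (u , r) → ⟪ ΔW (l ∷ u) ∣ F (j ℕ.+ r) ⟫) ⟫) ⟫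
      ≡⟨ ⟪⟫-cong (Bin k) (λ (l , j) → trans
           (⟪⟫-cong (SubY v) (λ (u , r) → ⟪⟫-ΔW-∷ l u (F (j ℕ.+ r))))
           (SubY-Δ v (F′ l j))) ⟩
    ⟪ Bin k ∣ (λ (l , j) → ⟪ ΔW v ∣ (λ (p , q) → ⟪ SubY p ∣ (λ (u , r) → ⟪ SubY q ∣ (λ (u′ , r′) → F′ l j (r ℕ.+ r′) (u , u′)) ⟫) ⟫) ⟫) ⟫
      ≡⟨ ⟪⟫-swap (Bin k) (ΔW v) (λ (l , j) (p , q) → ⟪ SubY p ∣ (λ (u , r) → ⟪ SubY q ∣ (λ (u′ , r′) → F′ l j (r ℕ.+ r′) (u , u′)) ⟫) ⟫) ⟩
    ⟪ ΔW v ∣ (λ (p , q) → ⟪ Bin k ∣ (λ (l , j) → ⟪ SubY p ∣ (λ (u , r) → ⟪ SubY q ∣ (λ (u′ , r′) → F′ l j (r ℕ.+ r′) (u , u′)) ⟫) ⟫) ⟫) ⟫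
      ≡⟨ ⟪⟫-cong (ΔW v) (λ (p , q) → pointwise p q) ⟩
    ⟪ ΔW v ∣ (λ (p , q) → T (k ∷ p , q) + T (p , k ∷ q)) ⟫
      ≡⟨ ⟪⟫-ΔW-∷ k v T ⟨
    ⟪ ΔW (k ∷ v) ∣ T ⟫ ∎
  where
  F′ : ℕ → ℕ → ℕ → Word Y × Word Y → ℚ
  F′ l j r (p , q) = F (j ℕ.+ r) (l ∷ p , q) + F (j ℕ.+ r) (p , l ∷ q)
  T : Word Y × Word Y → ℚ
  T (p , q) = ⟪ SubY p ∣ (λ (u , r) → ⟪ SubY q ∣ (λ (u′ , r′) → F (r ℕ.+ r′) (u , u′)) ⟫) ⟫
  T₁ T₂ : Word Y → Word Y → ℕ × ℕ → ℚ
  T₁ p q (l , j) = ⟪ SubY p ∣ (λ (u , r) → ⟪ SubY q ∣ (λ (u′ , r′) → F (j ℕ.+ (r ℕ.+ r′)) (l ∷ u , u′)) ⟫) ⟫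
  T₂ p q (l , j) = ⟪ SubY p ∣ (λ (u , r) → ⟪ SubY q ∣ (λ (u′ , r′) → F (j ℕ.+ (r ℕ.+ r′)) (u , l ∷ u′)) ⟫) ⟫
  left : ∀ p q → ⟪ Bin k ∣ T₁ p q ⟫ ≡ T (k ∷ p , q)
  left p q = trans
    (⟪⟫-cong (Bin k) (λ (l , j) → ⟪⟫-cong (SubY p) (λ (u , r) → ⟪⟫-cong (SubY q) (λ (u′ , r′) →
      cong (λ n → F n (l ∷ u , u′)) (sym (ℕₚ.+-assoc j r r′))))))
    (sym (⟪⟫-SubY-∷ k p (λ (u , r) → ⟪ SubY q ∣ (λ (u′ , r′) → F (r ℕ.+ r′) (u , u′)) ⟫)))
  right : ∀ p q → ⟪ Bin k ∣ T₂ p q ⟫ ≡ T (p , k ∷ q)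
  right p q = begin
    ⟪ Bin k ∣ T₂ p q ⟫
      ≡⟨ ⟪⟫-swap (Bin k) (SubY p) (λ (l , j) (u , r) → ⟪ SubY q ∣ (λ (u′ , r′) → F (j ℕ.+ (r ℕ.+ r′)) (u , l ∷ u′)) ⟫) ⟩
    ⟪ SubY p ∣ (λ (u , r) → ⟪ Bin k ∣ (λ (l , j) → ⟪ SubY q ∣ (λ (u′ , r′) → F (j ℕ.+ (r ℕ.+ r′)) (u , l ∷ u′)) ⟫) ⟫) ⟫
      ≡⟨ ⟪⟫-cong (SubY p) (λ (u , r) → ⟪⟫-cong (Bin k) (λ (l , j) → ⟪⟫-cong (SubY q) (λ (u′ , r′) →
           cong (λ n → F n (u , l ∷ u′)) (trans (sym (ℕₚ.+-assoc j r r′)) (trans (cong (ℕ._+ r′) (ℕₚ.+-comm j r)) (ℕₚ.+-assoc r j r′)))))) ⟩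
    ⟪ SubY p ∣ (λ (u , r) → ⟪ Bin k ∣ (λ (l , j) → ⟪ SubY q ∣ (λ (u′ , r′) → F (r ℕ.+ (j ℕ.+ r′)) (u , l ∷ u′)) ⟫) ⟫) ⟫
      ≡⟨ ⟪⟫-cong (SubY p) (λ (u , r) → ⟪⟫-SubY-∷ k q (λ (u′ , r′) → F (r ℕ.+ r′) (u , u′))) ⟨
    T (p , k ∷ q) ∎
  pointwise : ∀ p q → ⟪ Bin k ∣ (λ (l , j) → ⟪ SubY p ∣ (λ (u , r) → ⟪ SubY q ∣ (λ (u′ , r′) → F′ l j (r ℕ.+ r′) (u , u′)) ⟫) ⟫) ⟫
    ≡ T (k ∷ p , q) + T (p , k ∷ q)
  pointwise p q = begin
    ⟪ Bin k ∣ (λ (l , j) → ⟪ SubY p ∣ (λ (u , r) → ⟪ SubY q ∣ (λ (u′ , r′) → F′ l j (r ℕ.+ r′) (u , u′)) ⟫) ⟫) ⟫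
      ≡⟨ ⟪⟫-cong (Bin k) (λ (l , j) → trans
           (⟪⟫-cong (SubY p) (λ (u , r) → ⟪⟫-+ (SubY q) (λ (u′ , r′) → F (j ℕ.+ (r ℕ.+ r′)) (l ∷ u , u′)) (λ (u′ , r′) → F (j ℕ.+ (r ℕ.+ r′)) (u , l ∷ u′))))
           (⟪⟫-+ (SubY p) (λ (u , r) → ⟪ SubY q ∣ (λ (u′ , r′) → F (j ℕ.+ (r ℕ.+ r′)) (l ∷ u , u′)) ⟫)
                          (λ (u , r) → ⟪ SubY q ∣ (λ (u′ , r′) → F (j ℕ.+ (r ℕ.+ r′)) (u , l ∷ u′)) ⟫))) ⟩
    ⟪ Bin k ∣ (λ lj → T₁ p q lj + T₂ p q lj) ⟫ ≡⟨ ⟪⟫-+ (Bin k) (T₁ p q) (T₂ p q) ⟩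
    ⟪ Bin k ∣ T₁ p q ⟫ + ⟪ Bin k ∣ T₂ p q ⟫ ≡⟨ cong₂ _+_ (left p q) (right p q) ⟩
    T (k ∷ p , q) + T (p , k ∷ q) ∎

-- The operators s_ψ and σ_ψ on words

⟪⟫-derW-linear : ∀ {I : Set} {F : A → Poly A} {G : I → A → Poly A} (φ : Lin I) →
  (∀ b f → ⟪ F b ∣ f ⟫ ≡ ⟪ φ ∣ (λ x → ⟪ G x b ∣ f ⟫) ⟫) →
  ∀ w f → ⟪ derW F w ∣ f ⟫ ≡ ⟪ φ ∣ (λ x → ⟪ derW (G x) w ∣ f ⟫) ⟫
⟪⟫-derW-linear φ e [] f = sym (⟪⟫-zero φ (λ _ → refl))
⟪⟫-derW-linear {F = F} {G} φ e (a ∷ w) f = begin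
  ⟪ derW F (a ∷ w) ∣ f ⟫ ≡⟨ ⟪⟫-derW-∷ F a w f ⟩
  ⟪ F a ∣ (λ z → f (z ++ w)) ⟫ + ⟪ derW F w ∣ (λ z → f (a ∷ z)) ⟫
    ≡⟨ cong₂ _+_ (e a (λ z → f (z ++ w))) (⟪⟫-derW-linear φ e w (λ z → f (a ∷ z))) ⟩
  ⟪ φ ∣ (λ x → ⟪ G x a ∣ (λ z → f (z ++ w)) ⟫) ⟫ + ⟪ φ ∣ (λ x → ⟪ derW (G x) w ∣ (λ z → f (a ∷ z)) ⟫) ⟫
    ≡⟨ ⟪⟫-+ φ (λ x → ⟪ G x a ∣ (λ z → f (z ++ w)) ⟫) (λ x → ⟪ derW (G x) w ∣ (λ z → f (a ∷ z)) ⟫) ⟨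
  ⟪ φ ∣ (λ x → ⟪ G x a ∣ (λ z → f (z ++ w)) ⟫ + ⟪ derW (G x) w ∣ (λ z → f (a ∷ z)) ⟫) ⟫
    ≡⟨ ⟪⟫-cong φ (λ x → ⟪⟫-derW-∷ (G x) a w f) ⟨
  ⟪ φ ∣ (λ x → ⟪ derW (G x) (a ∷ w) ∣ f ⟫) ⟫ ∎

-- The common shape of `sX` and `σ` when ψ is the single word `x`: left multiplication plus a
-- derivation. `⟪⟫-mul-der` recovers the general case by linearity in ψ.
act : (A → Poly A) → Word A → Word A → Poly A
act G x w = (1ℚ , x ++ w) ∷ derW G w

⟪⟫-act : ∀ (G : A → Poly A) x w f → ⟪ act G x w ∣ f ⟫ ≡ f (x ++ w) + ⟪ derW G w ∣ f ⟫
⟪⟫-act G x w f = cong (_+ ⟪ derW G w ∣ f ⟫) (*-identityˡ (f (x ++ w)))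

⟪⟫-mul-der : ∀ {F : A → Poly A} {G : Word A → A → Poly A} (φ : Poly A) →
  (∀ b f → ⟪ F b ∣ f ⟫ ≡ ⟪ φ ∣ (λ x → ⟪ G x b ∣ f ⟫) ⟫) →
  ∀ p f → ⟪ mul φ p ⊕ der F p ∣ f ⟫ ≡ ⟪ φ ∣ (λ x → ⟪ p ∣ (λ w → ⟪ act (G x) x w ∣ f ⟫) ⟫) ⟫
⟪⟫-mul-der {F = F} {G} φ e p f = begin
  ⟪ mul φ p ⊕ der F p ∣ f ⟫ ≡⟨ ⟪⟫-++ (mul φ p) (der F p) f ⟩
  ⟪ mul φ p ∣ f ⟫ + ⟪ der F p ∣ f ⟫
    ≡⟨ cong₂ _+_ (⟪⟫-mul φ p f) (trans (⟪⟫-linExt (derW F) p f) (trans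
         (⟪⟫-cong p (λ w → ⟪⟫-derW-linear φ e w f)) (⟪⟫-swap p φ (λ w x → ⟪ derW (G x) w ∣ f ⟫)))) ⟩
  ⟪ φ ∣ (λ x → ⟪ p ∣ (λ w → f (x ++ w)) ⟫) ⟫ + ⟪ φ ∣ (λ x → ⟪ p ∣ (λ w → ⟪ derW (G x) w ∣ f ⟫) ⟫) ⟫
    ≡⟨ ⟪⟫-+ φ (λ x → ⟪ p ∣ (λ w → f (x ++ w)) ⟫) (λ x → ⟪ p ∣ (λ w → ⟪ derW (G x) w ∣ f ⟫) ⟫) ⟨
  ⟪ φ ∣ (λ x → ⟪ p ∣ (λ w → f (x ++ w)) ⟫ + ⟪ p ∣ (λ w → ⟪ derW (G x) w ∣ f ⟫) ⟫) ⟫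
    ≡⟨ ⟪⟫-cong φ (λ x → ⟪⟫-+ p (λ w → f (x ++ w)) (λ w → ⟪ derW (G x) w ∣ f ⟫)) ⟨
  ⟪ φ ∣ (λ x → ⟪ p ∣ (λ w → f (x ++ w) + ⟪ derW (G x) w ∣ f ⟫) ⟫) ⟫
    ≡⟨ ⟪⟫-cong φ (λ x → ⟪⟫-cong p (λ w → ⟪⟫-act (G x) x w f)) ⟨
  ⟪ φ ∣ (λ x → ⟪ p ∣ (λ w → ⟪ act (G x) x w ∣ f ⟫) ⟫) ⟫ ∎

dXW : Word X → X → Poly X
dXW x x₀ = zeroP
dXW x x₁ = br (letter x₁) (mon x)

⟪⟫-br-linear : ∀ u (ψ : Poly A) f → ⟪ br (mon u) ψ ∣ f ⟫ ≡ ⟪ ψ ∣ (λ x → ⟪ br (mon u) (mon x) ∣ f ⟫) ⟫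
⟪⟫-br-linear u ψ f = trans (⟪⟫-br (mon u) ψ f) (trans
  (⟪⟫-mon u (λ u → ⟪ ψ ∣ (λ v → f (u ++ v) - f (v ++ u)) ⟫))
  (⟪⟫-cong ψ (λ x → sym (⟪⟫-br-mon u x f))))

⟪⟫-sX : ∀ φ p f → ⟪ sX φ p ∣ f ⟫ ≡ ⟪ φ ∣ (λ x → ⟪ p ∣ (λ w → ⟪ act (dXW x) x w ∣ f ⟫) ⟫) ⟫
⟪⟫-sX φ = ⟪⟫-mul-der φ (λ { x₀ f → sym (⟪⟫-zero φ (λ _ → refl)) ; x₁ f → ⟪⟫-br-linear (x₁ ∷ []) φ f })

⟪⟫-σ : ∀ ψ p f → ⟪ σ ψ p ∣ f ⟫ ≡ ⟪ ψ ∣ (λ z → ⟪ p ∣ (λ w → ⟪ act (∂W z) z w ∣ f ⟫) ⟫) ⟫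
⟪⟫-σ ψ = ⟪⟫-mul-der ψ (λ b f → ⟪⟫-linExt (λ w → ∂W w b) ψ f)

-- Left multiplication by x₀^m, read through y_{k+1} = x₀^k x₁. The value on `[]` is a convention.
raiseW : ℕ → Word Y → Word Y
raiseW m [] = []
raiseW m (k ∷ u) = m ℕ.+ k ∷ u

onY-∷ : ∀ (h : Word Y → ℚ) m u r → onY h (m ∷ u , r) ≡ onY (λ u → h (m ∷ u)) (u , r)
onY-∷ h m u zero = refl
onY-∷ h m u (suc r) = refl

onY-snoc : ∀ h m u r → onY h (raise m (u ++ r ∷ [] , 0)) ≡ h (raiseW m (u ++ r ∷ []))
onY-snoc h m [] r = refl
onY-snoc h m (k ∷ u) r = refl

-- Consequences of the stabilizer condition

⟪⟫-ιY-y : ∀ m f → ⟪ ιY (mon (m ∷ [])) ∣ f ⟫ ≡ f (replicate m x₀ ++ x₁ ∷ [])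
⟪⟫-ιY-y m f = begin
    ⟪ ιY (mon (m ∷ [])) ∣ f ⟫ ≡⟨ ⟪⟫-linExt ι (mon (m ∷ [])) f ⟩
    ⟪ mon (m ∷ []) ∣ (λ w → ⟪ ι w ∣ f ⟫) ⟫ ≡⟨ ⟪⟫-mon (m ∷ []) (λ w → ⟪ ι w ∣ f ⟫) ⟩
    ⟪ mul (mon y) oneP ∣ f ⟫ ≡⟨ ⟪⟫-mul (mon y) oneP f ⟩
    ⟪ mon y ∣ (λ u → ⟪ oneP ∣ (λ v → f (u ++ v)) ⟫) ⟫ ≡⟨ ⟪⟫-mon y (λ u → ⟪ oneP ∣ (λ v → f (u ++ v)) ⟫) ⟩
    ⟪ oneP ∣ (λ v → f (y ++ v)) ⟫ ≡⟨ ⟪⟫-mon [] (λ v → f (y ++ v)) ⟩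
    f (y ++ []) ≡⟨ cong f (++-identityʳ y) ⟩
    f y ∎
  where
  y = replicate m x₀ ++ x₁ ∷ []
  ι : Word Y → Poly X
  ι = foldr (λ k acc → mul (mon (replicate k x₀ ++ (x₁ ∷ []))) acc) oneP

⟪⟫-ιY-1 : ∀ f → ⟪ ιY (mon []) ∣ f ⟫ ≡ f []
⟪⟫-ιY-1 f = ⟪⟫-mon [] f

⟪⟫-derW-x₀^ : ∀ x m w f → ⟪ derW (dXW x) (replicate m x₀ ++ w) ∣ f ⟫ ≡ ⟪ derW (dXW x) w ∣ (λ z → f (replicate m x₀ ++ z)) ⟫
⟪⟫-derW-x₀^ x zero w f = refl
⟪⟫-derW-x₀^ x (suc m) w f = trans (⟪⟫-derW-∷ (dXW x) x₀ (replicate m x₀ ++ w) f) (trans (+-identityˡ _)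
  (⟪⟫-derW-x₀^ x m w (λ z → f (x₀ ∷ z))))

⟪⟫-sX-y : ∀ x m f → ⟪ act (dXW x) x (replicate m x₀ ++ x₁ ∷ []) ∣ f ⟫
  ≡ f (x ++ replicate m x₀ ++ x₁ ∷ []) + (f (replicate m x₀ ++ x₁ ∷ x) - f (replicate m x₀ ++ x ++ x₁ ∷ []))
⟪⟫-sX-y x m f = trans (⟪⟫-act (dXW x) x y f) (cong (f (x ++ y) +_) (begin
    ⟪ derW (dXW x) y ∣ f ⟫ ≡⟨ ⟪⟫-derW-x₀^ x m (x₁ ∷ []) f ⟩
    ⟪ derW (dXW x) (x₁ ∷ []) ∣ f′ ⟫ ≡⟨ ⟪⟫-derW-∷ (dXW x) x₁ [] f′ ⟩
    ⟪ br (letter x₁) (mon x) ∣ (λ z → f′ (z ++ [])) ⟫ + 0ℚ ≡⟨ +-identityʳ _ ⟩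
    ⟪ br (letter x₁) (mon x) ∣ (λ z → f′ (z ++ [])) ⟫ ≡⟨ ⟪⟫-br-mon (x₁ ∷ []) x (λ z → f′ (z ++ [])) ⟩
    f′ (x₁ ∷ x ++ []) - f′ ((x ++ x₁ ∷ []) ++ []) ≡⟨ cong₂ (λ a b → f′ a - f′ b) (++-identityʳ (x₁ ∷ x)) (++-identityʳ (x ++ x₁ ∷ [])) ⟩
    f′ (x₁ ∷ x) - f′ (x ++ x₁ ∷ []) ∎))
  where
  y = replicate m x₀ ++ x₁ ∷ []
  f′ : Word X → ℚ
  f′ z = f (replicate m x₀ ++ z)

⟪⟫-sY-1 : ∀ φ h → ⟪ sY φ (mon []) ∣ h ⟫ ≡ ⟪ φ ∣ (λ x → onY h (sp x)) ⟫
⟪⟫-sY-1 φ h = begin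
  ⟪ sY φ (mon []) ∣ h ⟫ ≡⟨ ⟪⟫-πY (sX φ (ιY (mon []))) h ⟩
  ⟪ sX φ (ιY (mon [])) ∣ (λ w → onY h (sp w)) ⟫ ≡⟨ ⟪⟫-sX φ (ιY (mon [])) (λ w → onY h (sp w)) ⟩
  ⟪ φ ∣ (λ x → ⟪ ιY (mon []) ∣ (λ w → ⟪ act (dXW x) x w ∣ (λ w → onY h (sp w)) ⟫) ⟫) ⟫
    ≡⟨ ⟪⟫-cong φ (λ x → trans (⟪⟫-ιY-1 (λ w → ⟪ act (dXW x) x w ∣ (λ w → onY h (sp w)) ⟫))
         (trans (⟪⟫-mon (x ++ []) (λ w → onY h (sp w))) (cong (λ w → onY h (sp w)) (++-identityʳ x)))) ⟩
  ⟪ φ ∣ (λ x → onY h (sp x)) ⟫ ∎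

-- Transposes of φ ↦ π_Y([φ, x₀^m] x₁) (Pm), φ ↦ Σ_r [φ_r, y_{r+m+1}] (Qm) and
-- φ ↦ x₀^m E (Em), with E as in the header.
Pm : ℕ → (Word Y → ℚ) → Word Y × ℕ → ℚ
Pm m h (u , r) = h (u ++ r ℕ.+ m ∷ []) - h (raiseW m (u ++ r ∷ []))

-- s_φ(x₀^m x₁) = φ x₀^m x₁ + x₀^m [x₁, φ] = [φ, x₀^m] x₁ + x₀^m x₁ φ, and π_Y turns the last term
-- into y_{m+1} π_Y(φ).
⟪⟫-sY-y : ∀ φ m h → ⟪ sY φ (mon (m ∷ [])) ∣ h ⟫
  ≡ ⟪ φ ∣ (λ x → Pm m h (sp x) + onY (λ u → h (m ∷ u)) (sp x)) ⟫
⟪⟫-sY-y φ m h = begin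
  ⟪ sY φ (mon (m ∷ [])) ∣ h ⟫ ≡⟨ ⟪⟫-πY (sX φ (ιY (mon (m ∷ [])))) h ⟩
  ⟪ sX φ (ιY (mon (m ∷ []))) ∣ f ⟫ ≡⟨ ⟪⟫-sX φ (ιY (mon (m ∷ []))) f ⟩
  ⟪ φ ∣ (λ x → ⟪ ιY (mon (m ∷ [])) ∣ (λ w → ⟪ act (dXW x) x w ∣ f ⟫) ⟫) ⟫
    ≡⟨ ⟪⟫-cong φ (λ x → trans (⟪⟫-ιY-y m (λ w → ⟪ act (dXW x) x w ∣ f ⟫)) (trans (⟪⟫-sX-y x m f) (pointwise x))) ⟩
  ⟪ φ ∣ (λ x → Pm m h (sp x) + onY (λ u → h (m ∷ u)) (sp x)) ⟫ ∎
  where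
  f : Word X → ℚ
  f w = onY h (sp w)
  e₁ : ∀ x → f (x ++ replicate m x₀ ++ x₁ ∷ []) ≡ h (proj₁ (sp x) ++ proj₂ (sp x) ℕ.+ m ∷ [])
  e₁ x = cong (onY h) (trans (cong sp (sym (++-assoc x (replicate m x₀) (x₁ ∷ []))))
    (trans (sp-x₁ (x ++ replicate m x₀)) (cong (λ s → proj₁ s ++ proj₂ s ∷ [] , 0) (sp-snoc-x₀^ x m))))
  e₂ : ∀ x → f (replicate m x₀ ++ x₁ ∷ x) ≡ onY (λ u → h (m ∷ u)) (sp x)
  e₂ x = trans (cong (onY h) (trans (sp-x₀^ m (x₁ ∷ x)) (cong (λ k → k ∷ proj₁ (sp x) , proj₂ (sp x)) (ℕₚ.+-identityʳ m))))
    (onY-∷ h m (proj₁ (sp x)) (proj₂ (sp x)))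
  e₃ : ∀ x → f (replicate m x₀ ++ x ++ x₁ ∷ []) ≡ h (raiseW m (proj₁ (sp x) ++ proj₂ (sp x) ∷ []))
  e₃ x = trans (cong (onY h) (trans (sp-x₀^ m (x ++ x₁ ∷ [])) (cong (raise m) (sp-x₁ x)))) (onY-snoc h m (proj₁ (sp x)) (proj₂ (sp x)))
  pointwise : ∀ x → f (x ++ replicate m x₀ ++ x₁ ∷ []) + (f (replicate m x₀ ++ x₁ ∷ x) - f (replicate m x₀ ++ x ++ x₁ ∷ []))
    ≡ Pm m h (sp x) + onY (λ u → h (m ∷ u)) (sp x)
  pointwise x = trans (cong₂ _+_ (e₁ x) (cong₂ _-_ (e₂ x) (e₃ x)))
    (solve 3 (λ a b c → a :+ (b :- c) := (a :- c) :+ b) refl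
      (h (proj₁ (sp x) ++ proj₂ (sp x) ℕ.+ m ∷ [])) (onY (λ u → h (m ∷ u)) (sp x)) (h (raiseW m (proj₁ (sp x) ++ proj₂ (sp x) ∷ []))))

stab-⟪⟫ : ∀ φ → StabX φ → ∀ v F →
  ⟪ ΔW v ∣ (λ (p , q) → ⟪ sY φ (mon p) ∣ (λ u → F (u , q)) ⟫ + ⟪ sY φ (mon q) ∣ (λ u → F (p , u)) ⟫) ⟫
  ≡ ⟪ sY φ (mon v) ∣ (λ u → ⟪ ΔW u ∣ F ⟫) ⟫
stab-⟪⟫ φ (_ , st) v F = begin
  ⟪ ΔW v ∣ (λ (p , q) → L (p , q) + R (p , q)) ⟫ ≡⟨ ⟪⟫-+ (ΔW v) L R ⟩
  ⟪ ΔW v ∣ L ⟫ + ⟪ ΔW v ∣ R ⟫ ≡⟨ cong₂ _+_ (unit L) (unit R) ⟨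
  ⟪ Δ (mon v) ∣ L ⟫ + ⟪ Δ (mon v) ∣ R ⟫ ≡⟨ cong₂ _+_ (⟪⟫-⊗id (sY φ) (Δ (mon v)) F) (⟪⟫-id⊗ (sY φ) (Δ (mon v)) F) ⟨
  ⟪ (sY φ ⊗id) (Δ (mon v)) ∣ F ⟫ + ⟪ (id⊗ sY φ) (Δ (mon v)) ∣ F ⟫ ≡⟨ ⟪⟫-++ ((sY φ ⊗id) (Δ (mon v))) ((id⊗ sY φ) (Δ (mon v))) F ⟨
  ⟪ (sY φ ⊗id) (Δ (mon v)) ++ (id⊗ sY φ) (Δ (mon v)) ∣ F ⟫
    ≡⟨ WN.≈₂⇒⟪⟫ ((sY φ ⊗id) (Δ (mon v)) ++ (id⊗ sY φ) (Δ (mon v))) (Δ (sY φ (mon v))) (st (mon v)) F ⟩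
  ⟪ Δ (sY φ (mon v)) ∣ F ⟫ ≡⟨ ⟪⟫-Δ (sY φ (mon v)) F ⟩
  ⟪ sY φ (mon v) ∣ (λ u → ⟪ ΔW u ∣ F ⟫) ⟫ ∎
  where
  L R : Word Y × Word Y → ℚ
  L (p , q) = ⟪ sY φ (mon p) ∣ (λ u → F (u , q)) ⟫
  R (p , q) = ⟪ sY φ (mon q) ∣ (λ u → F (p , u)) ⟫
  unit : ∀ G → ⟪ Δ (mon v) ∣ G ⟫ ≡ ⟪ ΔW v ∣ G ⟫
  unit G = trans (⟪⟫-Δ (mon v) G) (⟪⟫-mon v (λ w → ⟪ ΔW w ∣ G ⟫))

-- The stabilizer condition at the empty word, where s^Y_φ(1) = π_Y(φ).
stab-πY-primitive : ∀ φ → StabX φ → ∀ F →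
  ⟪ φ ∣ (λ x → onY (λ v → ⟪ ΔW v ∣ F ⟫) (sp x)) ⟫ ≡ ⟪ φ ∣ (λ x → onY (λ v → F (v , []) + F ([] , v)) (sp x)) ⟫
stab-πY-primitive φ st F = begin
  ⟪ φ ∣ (λ x → onY (λ v → ⟪ ΔW v ∣ F ⟫) (sp x)) ⟫ ≡⟨ ⟪⟫-sY-1 φ (λ v → ⟪ ΔW v ∣ F ⟫) ⟨
  ⟪ sY φ (mon []) ∣ (λ v → ⟪ ΔW v ∣ F ⟫) ⟫ ≡⟨ stab-⟪⟫ φ st [] F ⟨
  ⟪ ΔW [] ∣ (λ (p , q) → ⟪ sY φ (mon p) ∣ (λ u → F (u , q)) ⟫ + ⟪ sY φ (mon q) ∣ (λ u → F (p , u)) ⟫) ⟫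
    ≡⟨ ⟪⟫-single ([] , []) (λ (p , q) → ⟪ sY φ (mon p) ∣ (λ u → F (u , q)) ⟫ + ⟪ sY φ (mon q) ∣ (λ u → F (p , u)) ⟫) ⟩
  ⟪ sY φ (mon []) ∣ (λ u → F (u , [])) ⟫ + ⟪ sY φ (mon []) ∣ (λ u → F ([] , u)) ⟫
    ≡⟨ ⟪⟫-+ (sY φ (mon [])) (λ u → F (u , [])) (λ u → F ([] , u)) ⟨
  ⟪ sY φ (mon []) ∣ (λ u → F (u , []) + F ([] , u)) ⟫ ≡⟨ ⟪⟫-sY-1 φ (λ u → F (u , []) + F ([] , u)) ⟩
  ⟪ φ ∣ (λ x → onY (λ v → F (v , []) + F ([] , v)) (sp x)) ⟫ ∎

-- Such an `F` ignores the terms a ⊗ 1 and 1 ⊗ b, so primitivity becomes the vanishing of a pairing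
-- and passes to linear combinations.
record Reduced (F : Word Y × Word Y → ℚ) : Set where
  field
    emptyˡ : ∀ u → F ([] , u) ≡ 0ℚ
    emptyʳ : ∀ u → F (u , []) ≡ 0ℚ
open Reduced

-- The stabilizer condition at y_{m+1}. Up to terms ignored by `F`, one side is π_Y(φ) ⊗ y_{m+1} +
-- y_{m+1} ⊗ π_Y(φ), which is also the contribution of y_{m+1} π_Y(φ), a product of primitives, to
-- the other side. What is left there is the coproduct of π_Y([φ, x₀^m] x₁).
P-primitive : ∀ φ → StabX φ → ∀ m F → Reduced F → ⟪ φ ∣ (λ x → Pm m (λ z → ⟪ ΔW z ∣ F ⟫) (sp x)) ⟫ ≡ 0ℚ
P-primitive φ st m F red = cancel (begin
    ⟪ φ ∣ (λ x → onY F′ (sp x)) ⟫ ≡⟨ lhs ⟨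
    ⟪ ΔW (m ∷ []) ∣ T ⟫ ≡⟨ stab-⟪⟫ φ st (m ∷ []) F ⟩
    ⟪ sY φ (mon (m ∷ [])) ∣ (λ u → ⟪ ΔW u ∣ F ⟫) ⟫ ≡⟨ ⟪⟫-sY-y φ m (λ u → ⟪ ΔW u ∣ F ⟫) ⟩
    ⟪ φ ∣ (λ x → Pm m (λ u → ⟪ ΔW u ∣ F ⟫) (sp x) + onY (λ u → ⟪ ΔW (m ∷ u) ∣ F ⟫) (sp x)) ⟫
      ≡⟨ ⟪⟫-+ φ (λ x → Pm m (λ u → ⟪ ΔW u ∣ F ⟫) (sp x)) (λ x → onY (λ u → ⟪ ΔW (m ∷ u) ∣ F ⟫) (sp x)) ⟩
    P + ⟪ φ ∣ (λ x → onY (λ u → ⟪ ΔW (m ∷ u) ∣ F ⟫) (sp x)) ⟫ ≡⟨ cong (P +_) rhs ⟩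
    P + ⟪ φ ∣ (λ x → onY F′ (sp x)) ⟫ ∎)
  where
  P = ⟪ φ ∣ (λ x → Pm m (λ z → ⟪ ΔW z ∣ F ⟫) (sp x)) ⟫
  F′ : Word Y → ℚ
  F′ v = F (v , m ∷ []) + F (m ∷ [] , v)
  T : Word Y × Word Y → ℚ
  T (p , q) = ⟪ sY φ (mon p) ∣ (λ u → F (u , q)) ⟫ + ⟪ sY φ (mon q) ∣ (λ u → F (p , u)) ⟫
  cancel : ∀ {a b : ℚ} → a ≡ b + a → b ≡ 0ℚ
  cancel {a} {b} e = trans (solve 2 (λ a b → b := (b :+ a) :- a) refl a b) (trans (cong (_- a) (sym e)) (+-inverseʳ a))
  lhs : ⟪ ΔW (m ∷ []) ∣ T ⟫ ≡ ⟪ φ ∣ (λ x → onY F′ (sp x)) ⟫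
  lhs = begin
    ⟪ ΔW (m ∷ []) ∣ T ⟫ ≡⟨ ⟪⟫-ΔW-∷ m [] T ⟩
    ⟪ ΔW [] ∣ (λ (u , v) → T (m ∷ u , v) + T (u , m ∷ v)) ⟫ ≡⟨ ⟪⟫-single ([] , []) (λ (u , v) → T (m ∷ u , v) + T (u , m ∷ v)) ⟩
    (⟪ sY φ (mon (m ∷ [])) ∣ (λ u → F (u , [])) ⟫ + ⟪ sY φ (mon []) ∣ (λ u → F (m ∷ [] , u)) ⟫)
      + (⟪ sY φ (mon []) ∣ (λ u → F (u , m ∷ [])) ⟫ + ⟪ sY φ (mon (m ∷ [])) ∣ (λ u → F ([] , u)) ⟫)
      ≡⟨ cong₂ (λ a b → (a + ⟪ sY φ (mon []) ∣ (λ u → F (m ∷ [] , u)) ⟫) + (⟪ sY φ (mon []) ∣ (λ u → F (u , m ∷ [])) ⟫ + b))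
           (⟪⟫-zero (sY φ (mon (m ∷ []))) (emptyʳ red)) (⟪⟫-zero (sY φ (mon (m ∷ []))) (emptyˡ red)) ⟩
    (0ℚ + ⟪ sY φ (mon []) ∣ (λ u → F (m ∷ [] , u)) ⟫) + (⟪ sY φ (mon []) ∣ (λ u → F (u , m ∷ [])) ⟫ + 0ℚ)
      ≡⟨ solve 2 (λ a b → (con 0ℚ :+ a) :+ (b :+ con 0ℚ) := b :+ a) refl ⟪ sY φ (mon []) ∣ (λ u → F (m ∷ [] , u)) ⟫ ⟪ sY φ (mon []) ∣ (λ u → F (u , m ∷ [])) ⟫ ⟩
    ⟪ sY φ (mon []) ∣ (λ u → F (u , m ∷ [])) ⟫ + ⟪ sY φ (mon []) ∣ (λ u → F (m ∷ [] , u)) ⟫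
      ≡⟨ ⟪⟫-+ (sY φ (mon [])) (λ u → F (u , m ∷ [])) (λ u → F (m ∷ [] , u)) ⟨
    ⟪ sY φ (mon []) ∣ F′ ⟫ ≡⟨ ⟪⟫-sY-1 φ F′ ⟩
    ⟪ φ ∣ (λ x → onY F′ (sp x)) ⟫ ∎
  rhs : ⟪ φ ∣ (λ x → onY (λ u → ⟪ ΔW (m ∷ u) ∣ F ⟫) (sp x)) ⟫ ≡ ⟪ φ ∣ (λ x → onY F′ (sp x)) ⟫
  rhs = begin
    ⟪ φ ∣ (λ x → onY (λ u → ⟪ ΔW (m ∷ u) ∣ F ⟫) (sp x)) ⟫ ≡⟨ ⟪⟫-cong φ (λ x → onY-cong (λ u → ⟪⟫-ΔW-∷ m u F) (sp x)) ⟩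
    ⟪ φ ∣ (λ x → onY (λ u → ⟪ ΔW u ∣ (λ (p , q) → F (m ∷ p , q) + F (p , m ∷ q)) ⟫) (sp x)) ⟫
      ≡⟨ stab-πY-primitive φ st (λ (p , q) → F (m ∷ p , q) + F (p , m ∷ q)) ⟩
    ⟪ φ ∣ (λ x → onY (λ u → (F (m ∷ u , []) + F (u , m ∷ [])) + (F (m ∷ [] , u) + F ([] , m ∷ u))) (sp x)) ⟫
      ≡⟨ ⟪⟫-cong φ (λ x → onY-cong (λ u → trans
           (cong₂ (λ a b → (a + F (u , m ∷ [])) + (F (m ∷ [] , u) + b)) (emptyʳ red (m ∷ u)) (emptyˡ red (m ∷ u)))
           (solve 2 (λ a b → (con 0ℚ :+ a) :+ (b :+ con 0ℚ) := a :+ b) refl (F (u , m ∷ [])) (F (m ∷ [] , u)))) (sp x)) ⟩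
    ⟪ φ ∣ (λ x → onY F′ (sp x)) ⟫ ∎

Qm : ℕ → (Word Y → ℚ) → Word Y × ℕ → ℚ
Qm m h (u , r) = h (u ++ r ℕ.+ m ∷ []) - h (r ℕ.+ m ∷ u)

-- By reconstruction the φ_r are the components of `SubY` on the primitive element π_Y(φ). By
-- `SubY-Δ` they are primitive, and so are their commutators with letters. Powers of x₀ in φ
-- contribute [1, y] = 0, which is `g0`.
Q-primitive : ∀ φ → StabX φ → ∀ m F → Reduced F → ⟪ φ ∣ (λ x → Qm m (λ z → ⟪ ΔW z ∣ F ⟫) (sp x)) ⟫ ≡ 0ℚ
Q-primitive φ st m F red = begin
    ⟪ φ ∣ (λ x → Qm m (λ z → ⟪ ΔW z ∣ F ⟫) (sp x)) ⟫ ≡⟨ ⟪⟫-cong φ (λ x → commutator (proj₁ (sp x)) (proj₂ (sp x))) ⟩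
    ⟪ φ ∣ (λ x → g (sp x)) ⟫ ≡⟨ Lie-reconstruct φ (proj₁ st) g g0 ⟩
    ⟪ φ ∣ (λ x → onY (λ v → ⟪ SubY v ∣ g ⟫) (sp x)) ⟫ ≡⟨ ⟪⟫-cong φ (λ x → onY-cong (λ v → SubY-Δ v F′) (sp x)) ⟩
    ⟪ φ ∣ (λ x → onY (λ v → ⟪ ΔW v ∣ T ⟫) (sp x)) ⟫ ≡⟨ stab-πY-primitive φ st T ⟩
    ⟪ φ ∣ (λ x → onY (λ v → T (v , []) + T ([] , v)) (sp x)) ⟫ ≡⟨ ⟪⟫-zero φ (λ x → vanish (sp x)) ⟩
    0ℚ ∎
  where
  F′ : ℕ → Word Y × Word Y → ℚ
  F′ r (p , q) = (F (p ++ r ℕ.+ m ∷ [] , q) + F (p , q ++ r ℕ.+ m ∷ [])) - (F (r ℕ.+ m ∷ p , q) + F (p , r ℕ.+ m ∷ q))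
  g : Word Y × ℕ → ℚ
  g (u , r) = ⟪ ΔW u ∣ F′ r ⟫
  T : Word Y × Word Y → ℚ
  T (p , q) = ⟪ SubY p ∣ (λ (u , r) → ⟪ SubY q ∣ (λ (u′ , r′) → F′ (r ℕ.+ r′) (u , u′)) ⟫) ⟫
  commutator : ∀ u r → Qm m (λ z → ⟪ ΔW z ∣ F ⟫) (u , r) ≡ g (u , r)
  commutator u r = trans (cong₂ _-_ (⟪⟫-ΔW-snoc u (r ℕ.+ m) F) (⟪⟫-ΔW-∷ (r ℕ.+ m) u F))
    (sym (⟪⟫-- (ΔW u) (λ (p , q) → F (p ++ r ℕ.+ m ∷ [] , q) + F (p , q ++ r ℕ.+ m ∷ [])) (λ (p , q) → F (r ℕ.+ m ∷ p , q) + F (p , r ℕ.+ m ∷ q))))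
  g0 : ∀ r → g ([] , r) ≡ 0ℚ
  g0 r = trans (⟪⟫-single ([] , []) (F′ r)) (+-inverseʳ (F (r ℕ.+ m ∷ [] , []) + F ([] , r ℕ.+ m ∷ [])))
  red′ : ∀ r u → F′ r (u , []) ≡ 0ℚ
  red′ r u = trans (cong₂ (λ a b → (a + F (u , r ℕ.+ m ∷ [])) - (b + F (u , r ℕ.+ m ∷ []))) (emptyʳ red _) (emptyʳ red _))
    (+-inverseʳ (0ℚ + F (u , r ℕ.+ m ∷ [])))
  red″ : ∀ r u → F′ r ([] , u) ≡ 0ℚ
  red″ r u = trans (cong₂ (λ a b → (F (r ℕ.+ m ∷ [] , u) + a) - (F (r ℕ.+ m ∷ [] , u) + b)) (emptyˡ red _) (emptyˡ red _))
    (+-inverseʳ (F (r ℕ.+ m ∷ [] , u) + 0ℚ))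
  vanish : ∀ s → onY (λ v → T (v , []) + T ([] , v)) s ≡ 0ℚ
  vanish (v , suc _) = refl
  vanish (v , zero) = cong₂ _+_
    (⟪⟫-zero (SubY v) (λ (u , r) → trans (⟪⟫-single ([] , 0) (λ (u′ , r′) → F′ (r ℕ.+ r′) (u , u′))) (red′ (r ℕ.+ 0) u)))
    (trans (⟪⟫-single ([] , 0) (λ (u , r) → ⟪ SubY v ∣ (λ (u′ , r′) → F′ (r ℕ.+ r′) (u , u′)) ⟫))
      (⟪⟫-zero (SubY v) (λ (u′ , r′) → red″ r′ u′)))

Em : ℕ → (Word Y → ℚ) → Word Y × ℕ → ℚ
Em m h (u , r) = h (raiseW m (u ++ r ∷ [])) - h (raiseW m (r ∷ u))

E-primitive : ∀ φ → StabX φ → ∀ m F → Reduced F → ⟪ φ ∣ (λ x → Em m (λ z → ⟪ ΔW z ∣ F ⟫) (sp x)) ⟫ ≡ 0ℚ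
E-primitive φ st m F red = begin
  ⟪ φ ∣ (λ x → Em m h (sp x)) ⟫ ≡⟨ ⟪⟫-cong φ (λ x → split (proj₁ (sp x)) (proj₂ (sp x))) ⟩
  ⟪ φ ∣ (λ x → Qm m h (sp x) - Pm m h (sp x)) ⟫ ≡⟨ ⟪⟫-- φ (λ x → Qm m h (sp x)) (λ x → Pm m h (sp x)) ⟩
  ⟪ φ ∣ (λ x → Qm m h (sp x)) ⟫ - ⟪ φ ∣ (λ x → Pm m h (sp x)) ⟫ ≡⟨ cong₂ _-_ (Q-primitive φ st m F red) (P-primitive φ st m F red) ⟩
  0ℚ ∎
  where
  h : Word Y → ℚ
  h z = ⟪ ΔW z ∣ F ⟫
  split : ∀ u r → Em m h (u , r) ≡ Qm m h (u , r) - Pm m h (u , r)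
  split u r = trans (cong (λ k → h (raiseW m (u ++ r ∷ [])) - h (k ∷ u)) (ℕₚ.+-comm m r))
    (solve 3 (λ a b c → a :- b := (c :- b) :- (c :- a)) refl (h (raiseW m (u ++ r ∷ []))) (h (r ℕ.+ m ∷ u)) (h (u ++ r ℕ.+ m ∷ [])))

-- The counit axiom, for any `η` that agrees with the indicator of the empty word. The one in use is
-- a delta function with its first letter stripped.
counit : ∀ (η : Word Y → ℚ) → η [] ≡ 1ℚ → (∀ a p → η (a ∷ p) ≡ 0ℚ) →
  ∀ z (g : Word Y → ℚ) → ⟪ ΔW z ∣ (λ (p , q) → η p * g q) ⟫ ≡ g z
counit η η[] η∷ [] g = trans (⟪⟫-single ([] , []) (λ (p , q) → η p * g q)) (trans (cong (_* g []) η[]) (*-identityˡ (g [])))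
counit η η[] η∷ (a ∷ z) g = trans (⟪⟫-ΔW-∷ a z (λ (p , q) → η p * g q)) (trans
  (⟪⟫-cong (ΔW z) (λ (p , q) → trans (cong (λ e → e * g q + η p * g (a ∷ q)) (η∷ a p))
    (trans (cong (_+ η p * g (a ∷ q)) (*-zeroˡ (g q))) (+-identityˡ (η p * g (a ∷ q))))))
  (counit η η[] η∷ z (λ q → g (a ∷ q))))

-- With m exceeding the first letter of w, deleting the letter m + k from a word
-- whose first letter is at least m can leave w only if that first letter is deleted.
module Deletion (k k′ : ℕ) (w″ : Word Y) where
  w : Word Y
  w = k′ ∷ w″
  m : ℕ
  m = suc k′
  F : Word Y × Word Y → ℚ
  F (p , q) = WN.δW (m ℕ.+ k ∷ []) p * WN.δW w q

  reduced : Reduced F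
  reduced .emptyˡ u = trans (cong (_* WN.δW w u) (WN.δW-≢ (m ℕ.+ k ∷ []) [] (λ ()))) (*-zeroˡ (WN.δW w u))
  reduced .emptyʳ u = trans (cong (WN.δW (m ℕ.+ k ∷ []) u *_) (WN.δW-≢ w [] (λ ()))) (*-zeroʳ (WN.δW (m ℕ.+ k ∷ []) u))

  second : ∀ z p q → F (p , m ℕ.+ z ∷ q) ≡ 0ℚ
  second z p q = trans (cong (WN.δW (m ℕ.+ k ∷ []) p *_) (WN.δW-≢ w (m ℕ.+ z ∷ q)
    (λ e → ℕₚ.m≢1+m+n k′ (sym (∷-injectiveˡ e))))) (*-zeroʳ (WN.δW (m ℕ.+ k ∷ []) p))

  ⟪⟫-ΔW-raise : ∀ z → ⟪ ΔW (raiseW m z) ∣ F ⟫ ≡ WN.δW (k ∷ w) z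
  ⟪⟫-ΔW-raise [] = trans (⟪⟫-single ([] , []) F) (trans (reduced .emptyˡ []) (sym (WN.δW-≢ (k ∷ w) [] (λ ()))))
  ⟪⟫-ΔW-raise (z ∷ zs) = trans (⟪⟫-ΔW-∷ (m ℕ.+ z) zs F) (trans
      (⟪⟫-cong (ΔW zs) (λ (p , q) → trans (cong (F (m ℕ.+ z ∷ p , q) +_) (second z p q)) (+-identityʳ (F (m ℕ.+ z ∷ p , q)))))
      (first (z ℕ.≟ k)))
    where
    first : Dec (z ≡ k) → ⟪ ΔW zs ∣ (λ (p , q) → F (m ℕ.+ z ∷ p , q)) ⟫ ≡ WN.δW (k ∷ w) (z ∷ zs)
    first (no z≢k) = trans (⟪⟫-zero (ΔW zs) (λ (p , q) → trans (cong (_* WN.δW w q) (WN.δW-≢ (m ℕ.+ k ∷ []) (m ℕ.+ z ∷ p)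
            (λ e → z≢k (ℕₚ.+-cancelˡ-≡ m z k (∷-injectiveˡ e))))) (*-zeroˡ (WN.δW w q))))
          (sym (WN.δW-≢ (k ∷ w) (z ∷ zs) (λ e → z≢k (∷-injectiveˡ e))))
    -- Once the first letter has gone to the left factor, that factor is complete and all other
    -- letters stay on the right.
    first (yes refl) = trans (counit (λ p → WN.δW (m ℕ.+ k ∷ []) (m ℕ.+ k ∷ p)) (WN.δW-refl (m ℕ.+ k ∷ []))
            (λ a p → WN.δW-≢ (m ℕ.+ k ∷ []) (m ℕ.+ k ∷ a ∷ p) (λ ())) zs (WN.δW w)) (sym cons)
      where
      cons : WN.δW (k ∷ w) (k ∷ zs) ≡ WN.δW w zs
      cons = [ equal , unequal ]′ (Delta.δ-dec WN.δW-delta w zs)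
        where
        0≢1 : 0ℚ ≢ 1ℚ
        0≢1 ()
        equal : w ≡ zs → WN.δW (k ∷ w) (k ∷ zs) ≡ WN.δW w zs
        equal refl = trans (WN.δW-refl (k ∷ w)) (sym (WN.δW-refl w))
        unequal : WN.δW w zs ≡ 0ℚ → WN.δW (k ∷ w) (k ∷ zs) ≡ WN.δW w zs
        unequal e = trans (WN.δW-≢ (k ∷ w) (k ∷ zs) (λ eq → 0≢1 (trans (sym e) (trans (cong (WN.δW w) (∷-injectiveʳ eq)) (WN.δW-refl w))))) (sym e)

module _ (φ : Poly X) (st : StabX φ) where

  private
    rotation : Word X → Poly Y
    rotation x = (1ℚ , proj₁ (sp x) ++ proj₂ (sp x) ∷ []) ∷ (- 1ℚ , proj₂ (sp x) ∷ proj₁ (sp x)) ∷ []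

    E : Poly Y
    E = bind φ rotation

    ⟪⟫-E : ∀ h → ⟪ E ∣ h ⟫ ≡ ⟪ φ ∣ (λ x → h (proj₁ (sp x) ++ proj₂ (sp x) ∷ []) - h (proj₂ (sp x) ∷ proj₁ (sp x))) ⟫
    ⟪⟫-E h = trans (⟪⟫-bind φ rotation h) (⟪⟫-cong φ (λ x →
      solve 2 (λ a b → con 1ℚ :* a :+ (:- con 1ℚ :* b :+ con 0ℚ) := a :- b) refl
        (h (proj₁ (sp x) ++ proj₂ (sp x) ∷ [])) (h (proj₂ (sp x) ∷ proj₁ (sp x)))))

    -- The exponent `m = suc k′` depends on the coefficient to be isolated, which is why primitivity
    -- of x₀^m E is established for every `m`.
    E-coeff : ∀ w → ⟪ E ∣ WN.δW w ⟫ ≡ 0ℚ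
    E-coeff [] = trans (⟪⟫-E (WN.δW [])) (⟪⟫-zero φ (λ x → pointwise (proj₁ (sp x)) (proj₂ (sp x))))
      where
      pointwise : ∀ u r → WN.δW [] (u ++ r ∷ []) - WN.δW [] (r ∷ u) ≡ 0ℚ
      pointwise [] r = refl
      pointwise (_ ∷ _) r = refl
    -- `Deletion` requires a nonempty remaining word, so lengths below two are treated apart; in
    -- length one both terms of E are the same letter.
    E-coeff (k ∷ []) = trans (⟪⟫-E (WN.δW (k ∷ []))) (⟪⟫-zero φ (λ x → pointwise (proj₁ (sp x)) (proj₂ (sp x))))
      where
      pointwise : ∀ u r → WN.δW (k ∷ []) (u ++ r ∷ []) - WN.δW (k ∷ []) (r ∷ u) ≡ 0ℚ
      pointwise [] r = +-inverseʳ (WN.δW (k ∷ []) (r ∷ []))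
      pointwise (l ∷ []) r = cong₂ _-_ (WN.δW-≢ (k ∷ []) (l ∷ r ∷ []) (λ ())) (WN.δW-≢ (k ∷ []) (r ∷ l ∷ []) (λ ()))
      pointwise (l ∷ l′ ∷ u) r = cong₂ _-_ (WN.δW-≢ (k ∷ []) (l ∷ l′ ∷ u ++ r ∷ []) (λ ())) (WN.δW-≢ (k ∷ []) (r ∷ l ∷ l′ ∷ u) (λ ()))
    E-coeff (k ∷ k′ ∷ w″) = begin
      ⟪ E ∣ WN.δW (k ∷ k′ ∷ w″) ⟫ ≡⟨ ⟪⟫-E (WN.δW (k ∷ k′ ∷ w″)) ⟩
      ⟪ φ ∣ (λ x → WN.δW (k ∷ k′ ∷ w″) (proj₁ (sp x) ++ proj₂ (sp x) ∷ []) - WN.δW (k ∷ k′ ∷ w″) (proj₂ (sp x) ∷ proj₁ (sp x))) ⟫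
        ≡⟨ ⟪⟫-cong φ (λ x → cong₂ _-_ (⟪⟫-ΔW-raise (proj₁ (sp x) ++ proj₂ (sp x) ∷ [])) (⟪⟫-ΔW-raise (proj₂ (sp x) ∷ proj₁ (sp x)))) ⟨
      ⟪ φ ∣ (λ x → Em m (λ z → ⟪ ΔW z ∣ F ⟫) (sp x)) ⟫ ≡⟨ E-primitive φ st m F reduced ⟩
      0ℚ ∎
      where open Deletion k k′ w″

  -- This is E = 0: in the coordinates `(u , r)`, φ x₁ appends `r` as a letter to `u`, and Σ_r x₀^r
  -- x₁ φ_r prepends it.
  stab-rotate : ∀ (h : Word Y → ℚ) →
    ⟪ φ ∣ (λ x → h (proj₁ (sp x) ++ proj₂ (sp x) ∷ [])) ⟫ ≡ ⟪ φ ∣ (λ x → h (proj₂ (sp x) ∷ proj₁ (sp x))) ⟫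
  stab-rotate h = cancel (begin
      ⟪ φ ∣ h₁ ⟫ - ⟪ φ ∣ h₂ ⟫ ≡⟨ ⟪⟫-- φ h₁ h₂ ⟨
      ⟪ φ ∣ (λ x → h₁ x - h₂ x) ⟫ ≡⟨ ⟪⟫-E h ⟨
      ⟪ E ∣ h ⟫ ≡⟨ separate-zero WN.δW-delta E E-coeff h ⟩
      0ℚ ∎)
    where
    h₁ h₂ : Word X → ℚ
    h₁ x = h (proj₁ (sp x) ++ proj₂ (sp x) ∷ [])
    h₂ x = h (proj₂ (sp x) ∷ proj₁ (sp x))
    cancel : ∀ {a b : ℚ} → a - b ≡ 0ℚ → a ≡ b
    cancel {a} {b} e = trans (solve 2 (λ a b → a := (a :- b) :+ b) refl a b) (trans (cong (_+ b) e) (+-identityˡ b))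

-- For c = θ_Y(π_Y φ): ∂_c(b_{m+1}) = θ_Y(π_Y([φ, x₀^m] x₁)).
∂-formula : Poly X → Set
∂-formula φ = ∀ m f → ⟪ linExt (λ w → ∂W w (suc m)) (θY (πY φ)) ∣ f ⟫ ≡ ⟪ φ ∣ (λ x → Pm m (λ u → f (revB u)) (sp x)) ⟫

-- θ_Y reverses products, so [b_{r+m+1}, θ_Y(u)] = θ_Y([u, y_{r+m+1}]), which is the commutator in
-- `Qm`.
⟪⟫-∂W-revB : ∀ φ m f → ⟪ linExt (λ w → ∂W w (suc m)) (θY (πY φ)) ∣ f ⟫
  ≡ ⟪ φ ∣ (λ x → onY (λ v → ⟪ SubY v ∣ Qm m (λ u → f (revB u)) ⟫) (sp x)) ⟫
⟪⟫-∂W-revB φ m f = begin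
  ⟪ linExt (λ w → ∂W w (suc m)) (θY (πY φ)) ∣ f ⟫ ≡⟨ ⟪⟫-linExt (λ w → ∂W w (suc m)) (θY (πY φ)) f ⟩
  ⟪ θY (πY φ) ∣ (λ w → ⟪ ∂W w (suc m) ∣ f ⟫) ⟫ ≡⟨ ⟪⟫-θYπY φ (λ w → ⟪ ∂W w (suc m) ∣ f ⟫) ⟩
  ⟪ φ ∣ (λ x → onY (λ v → ⟪ ∂W (revB v) (suc m) ∣ f ⟫) (sp x)) ⟫
    ≡⟨ ⟪⟫-cong φ (λ x → onY-cong (λ v → trans (⟪⟫-∂W-suc (revB v) m f)
         (trans (⟪⟫-substs-revB v (λ (r , u) → f (suc (m ℕ.+ r) ∷ u) - f (u ++ suc (m ℕ.+ r) ∷ [])))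
           (⟪⟫-cong (SubY v) (λ (u , r) → cong₂ (λ a b → f a - f b)
             (trans (cong (λ n → suc n ∷ revB u) (ℕₚ.+-comm m r)) (sym (revB-++ u (r ℕ.+ m ∷ []))))
             (cong (λ n → revB u ++ suc n ∷ []) (ℕₚ.+-comm m r)))))) (sp x)) ⟩
  ⟪ φ ∣ (λ x → onY (λ v → ⟪ SubY v ∣ Qm m (λ u → f (revB u)) ⟫) (sp x)) ⟫ ∎

stab-∂-formula : ∀ φ → StabX φ → ∂-formula φ
stab-∂-formula φ st m f = begin
    ⟪ linExt (λ w → ∂W w (suc m)) (θY (πY φ)) ∣ f ⟫ ≡⟨ ⟪⟫-∂W-revB φ m f ⟩
    ⟪ φ ∣ (λ x → onY (λ v → ⟪ SubY v ∣ Qm m h ⟫) (sp x)) ⟫ ≡⟨ Lie-reconstruct φ (proj₁ st) (Qm m h) (λ r → +-inverseʳ (h (r ℕ.+ m ∷ []))) ⟨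
    ⟪ φ ∣ (λ x → Qm m h (sp x)) ⟫ ≡⟨ ⟪⟫-- φ h₀ (λ x → h (proj₂ (sp x) ℕ.+ m ∷ proj₁ (sp x))) ⟩
    ⟪ φ ∣ h₀ ⟫ - ⟪ φ ∣ (λ x → h (proj₂ (sp x) ℕ.+ m ∷ proj₁ (sp x))) ⟫
      ≡⟨ cong (λ a → ⟪ φ ∣ h₀ ⟫ - a) (⟪⟫-cong φ (λ x → cong (λ n → h (n ∷ proj₁ (sp x))) (ℕₚ.+-comm (proj₂ (sp x)) m))) ⟩
    ⟪ φ ∣ h₀ ⟫ - ⟪ φ ∣ (λ x → h (raiseW m (proj₂ (sp x) ∷ proj₁ (sp x)))) ⟫
      -- E = 0, multiplied on the left by x₀^m.
      ≡⟨ cong (λ a → ⟪ φ ∣ h₀ ⟫ - a) (stab-rotate φ st (λ z → h (raiseW m z))) ⟨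
    ⟪ φ ∣ h₀ ⟫ - ⟪ φ ∣ (λ x → h (raiseW m (proj₁ (sp x) ++ proj₂ (sp x) ∷ []))) ⟫
      ≡⟨ ⟪⟫-- φ h₀ (λ x → h (raiseW m (proj₁ (sp x) ++ proj₂ (sp x) ∷ []))) ⟨
    ⟪ φ ∣ (λ x → Pm m h (sp x)) ⟫ ∎
  where
  h : Word Y → ℚ
  h u = f (revB u)
  h₀ : Word X → ℚ
  h₀ x = h (proj₁ (sp x) ++ proj₂ (sp x) ℕ.+ m ∷ [])

-- Checked directly, since `SubY` does not change y₁. It lets b₁ be treated both as θ_X(x₁) and as
-- θ_Y(π_Y x₁).
x₁-∂-formula : ∂-formula (letter x₁)
x₁-∂-formula m f = begin
    ⟪ linExt (λ w → ∂W w (suc m)) (θY (πY (letter x₁))) ∣ f ⟫ ≡⟨ ⟪⟫-∂W-revB (letter x₁) m f ⟩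
    ⟪ letter x₁ ∣ (λ x → onY (λ v → ⟪ SubY v ∣ Qm m h ⟫) (sp x)) ⟫ ≡⟨ ⟪⟫-mon (x₁ ∷ []) (λ x → onY (λ v → ⟪ SubY v ∣ Qm m h ⟫) (sp x)) ⟩
    ⟪ SubY (0 ∷ []) ∣ Qm m h ⟫ ≡⟨ ⟪⟫-SubY-∷ 0 [] (Qm m h) ⟩
    ⟪ Bin 0 ∣ (λ (l , j) → ⟪ SubY [] ∣ (λ (u , r) → Qm m h (l ∷ u , j ℕ.+ r)) ⟫) ⟫
      ≡⟨ ⟪⟫-single (0 , 0) (λ (l , j) → ⟪ SubY [] ∣ (λ (u , r) → Qm m h (l ∷ u , j ℕ.+ r)) ⟫) ⟩
    ⟪ SubY [] ∣ (λ (u , r) → Qm m h (0 ∷ u , r)) ⟫ ≡⟨ ⟪⟫-single ([] , 0) (λ (u , r) → Qm m h (0 ∷ u , r)) ⟩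
    h (0 ∷ m ∷ []) - h (m ∷ 0 ∷ []) ≡⟨ cong (λ n → h (0 ∷ m ∷ []) - h (n ∷ 0 ∷ [])) (ℕₚ.+-identityʳ m) ⟨
    h (0 ∷ m ∷ []) - h (m ℕ.+ 0 ∷ 0 ∷ []) ≡⟨ ⟪⟫-mon (x₁ ∷ []) (λ x → Pm m h (sp x)) ⟨
    ⟪ letter x₁ ∣ (λ x → Pm m h (sp x)) ⟫ ∎
  where
  h : Word Y → ℚ
  h u = f (revB u)

-- The operators σ_a and σ_c, summed over the words of φ

⟪⟫-derW-cong : ∀ {F G : A → Poly A} → (∀ b f → ⟪ F b ∣ f ⟫ ≡ ⟪ G b ∣ f ⟫) →
  ∀ w f → ⟪ derW F w ∣ f ⟫ ≡ ⟪ derW G w ∣ f ⟫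
⟪⟫-derW-cong e [] f = refl
⟪⟫-derW-cong {F = F} {G} e (a ∷ w) f = trans (⟪⟫-derW-∷ F a w f) (trans
  (cong₂ _+_ (e a (λ z → f (z ++ w))) (⟪⟫-derW-cong e w (λ z → f (a ∷ z)))) (sym (⟪⟫-derW-∷ G a w f)))

∂A : Word X → B → Poly B
∂A x zero = zeroP
∂A x (suc i) = br (letter (suc i)) (mon (map letterX x))

actA : Word X → Word B → Poly B
actA x = act (∂A x) (map letterX x)

⟪⟫-σA : ∀ φ p f → ⟪ σ (θX φ) p ∣ f ⟫ ≡ ⟪ φ ∣ (λ x → ⟪ p ∣ (λ w → ⟪ actA x w ∣ f ⟫) ⟫) ⟫
⟪⟫-σA φ p f = begin
    ⟪ σ (θX φ) p ∣ f ⟫ ≡⟨ ⟪⟫-σ (θX φ) p f ⟩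
    ⟪ θX φ ∣ (λ z → ⟪ p ∣ (λ w → ⟪ act (∂W z) z w ∣ f ⟫) ⟫) ⟫ ≡⟨ ⟪⟫-θX φ (λ z → ⟪ p ∣ (λ w → ⟪ act (∂W z) z w ∣ f ⟫) ⟫) ⟩
    ⟪ φ ∣ (λ x → ⟪ p ∣ (λ w → ⟪ act (∂W (map letterX x)) (map letterX x) w ∣ f ⟫) ⟫) ⟫
      ≡⟨ ⟪⟫-cong φ (λ x → ⟪⟫-cong p (λ w → cong (1ℚ * f (map letterX x ++ w) +_) (⟪⟫-derW-cong (same x) w f))) ⟩
    ⟪ φ ∣ (λ x → ⟪ p ∣ (λ w → ⟪ actA x w ∣ f ⟫) ⟫) ⟫ ∎
  where
  same : ∀ x b f → ⟪ ∂W (map letterX x) b ∣ f ⟫ ≡ ⟪ ∂A x b ∣ f ⟫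
  same x zero f = refl
  same x (suc i) f = begin
    ⟪ ∂W (map letterX x) (suc i) ∣ f ⟫ ≡⟨ ⟪⟫-∂W-suc (map letterX x) i f ⟩
    ⟪ substs (map letterX x) ∣ (λ (r , u) → f (suc (i ℕ.+ r) ∷ u) - f (u ++ suc (i ℕ.+ r) ∷ [])) ⟫
      ≡⟨ ⟪⟫-substs-X x (λ (r , u) → f (suc (i ℕ.+ r) ∷ u) - f (u ++ suc (i ℕ.+ r) ∷ [])) ⟩
    f (suc (i ℕ.+ 0) ∷ map letterX x) - f (map letterX x ++ suc (i ℕ.+ 0) ∷ [])
      ≡⟨ cong (λ n → f (suc n ∷ map letterX x) - f (map letterX x ++ suc n ∷ [])) (ℕₚ.+-identityʳ i) ⟩
    f (suc i ∷ map letterX x) - f (map letterX x ++ suc i ∷ []) ≡⟨ ⟪⟫-br-mon (suc i ∷ []) (map letterX x) f ⟨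
    ⟪ ∂A x (suc i) ∣ f ⟫ ∎

-- The contribution of the word `x` to `∂-formula`. It may differ from ∂_w with w = θ_Y(π_Y x): for
-- x = x₁ x₀ the latter is zero. The two agree after summation over φ.
∂C : Word X → B → Poly B
∂C x zero = zeroP
∂C x (suc m) = mon (revB (proj₁ (sp x) ++ proj₂ (sp x) ℕ.+ m ∷ [])) ⊖ mon (revB (raiseW m (proj₁ (sp x) ++ proj₂ (sp x) ∷ [])))

⟪⟫-∂C : ∀ x m f → ⟪ ∂C x (suc m) ∣ f ⟫ ≡ Pm m (λ u → f (revB u)) (sp x)
⟪⟫-∂C x m f = trans (⟪⟫-⊖ (mon v) (mon v′) f) (cong₂ _-_ (⟪⟫-mon v f) (⟪⟫-mon v′ f))
  where
  v = revB (proj₁ (sp x) ++ proj₂ (sp x) ℕ.+ m ∷ [])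
  v′ = revB (raiseW m (proj₁ (sp x) ++ proj₂ (sp x) ∷ []))

lead : Word Y × ℕ → Word B → Poly B
lead (u , zero) w = mon (revB u ++ w)
lead (u , suc _) w = zeroP

⟪⟫-lead : ∀ s w f → ⟪ lead s w ∣ f ⟫ ≡ onY (λ u → f (revB u ++ w)) s
⟪⟫-lead (u , zero) w f = ⟪⟫-mon (revB u ++ w) f
⟪⟫-lead (u , suc _) w f = refl

actC : Word X → Word B → Poly B
actC x w = lead (sp x) w ⊕ derW (∂C x) w

⟪⟫-actC : ∀ x w f → ⟪ actC x w ∣ f ⟫ ≡ onY (λ u → f (revB u ++ w)) (sp x) + ⟪ derW (∂C x) w ∣ f ⟫
⟪⟫-actC x w f = trans (⟪⟫-++ (lead (sp x) w) (derW (∂C x) w) f) (cong (_+ ⟪ derW (∂C x) w ∣ f ⟫) (⟪⟫-lead (sp x) w f))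

⟪⟫-σC : ∀ φ → ∂-formula φ → ∀ p f → ⟪ σ (θY (πY φ)) p ∣ f ⟫ ≡ ⟪ φ ∣ (λ x → ⟪ p ∣ (λ w → ⟪ actC x w ∣ f ⟫) ⟫) ⟫
⟪⟫-σC φ K p f = begin
    ⟪ σ ψ p ∣ f ⟫ ≡⟨ ⟪⟫-++ (mul ψ p) (∂ ψ p) f ⟩
    ⟪ mul ψ p ∣ f ⟫ + ⟪ ∂ ψ p ∣ f ⟫ ≡⟨ cong₂ _+_ left right ⟩
    ⟪ φ ∣ L ⟫ + ⟪ φ ∣ R ⟫ ≡⟨ ⟪⟫-+ φ L R ⟨
    ⟪ φ ∣ (λ x → L x + R x) ⟫ ≡⟨ ⟪⟫-cong φ (λ x → trans (sym (⟪⟫-+ p _ _)) (⟪⟫-cong p (λ w → sym (⟪⟫-actC x w f)))) ⟩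
    ⟪ φ ∣ (λ x → ⟪ p ∣ (λ w → ⟪ actC x w ∣ f ⟫) ⟫) ⟫ ∎
  where
  ψ = θY (πY φ)
  L R : Word X → ℚ
  L x = ⟪ p ∣ (λ w → onY (λ u → f (revB u ++ w)) (sp x)) ⟫
  R x = ⟪ p ∣ (λ w → ⟪ derW (∂C x) w ∣ f ⟫) ⟫
  onY-swap : ∀ s → onY (λ u → ⟪ p ∣ (λ w → f (revB u ++ w)) ⟫) s ≡ ⟪ p ∣ (λ w → onY (λ u → f (revB u ++ w)) s) ⟫
  onY-swap (u , zero) = refl
  onY-swap (u , suc _) = sym (⟪⟫-zero p (λ _ → refl))
  left : ⟪ mul ψ p ∣ f ⟫ ≡ ⟪ φ ∣ L ⟫
  left = begin
    ⟪ mul ψ p ∣ f ⟫ ≡⟨ ⟪⟫-mul ψ p f ⟩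
    ⟪ ψ ∣ (λ z → ⟪ p ∣ (λ w → f (z ++ w)) ⟫) ⟫ ≡⟨ ⟪⟫-θYπY φ (λ z → ⟪ p ∣ (λ w → f (z ++ w)) ⟫) ⟩
    ⟪ φ ∣ (λ x → onY (λ u → ⟪ p ∣ (λ w → f (revB u ++ w)) ⟫) (sp x)) ⟫ ≡⟨ ⟪⟫-cong φ (λ x → onY-swap (sp x)) ⟩
    ⟪ φ ∣ L ⟫ ∎
  onLetter : ∀ b f → ⟪ linExt (λ w → ∂W w b) ψ ∣ f ⟫ ≡ ⟪ φ ∣ (λ x → ⟪ ∂C x b ∣ f ⟫) ⟫
  onLetter zero f = trans (⟪⟫-linExt (λ w → zeroP) ψ f) (trans (⟪⟫-zero ψ (λ _ → refl)) (sym (⟪⟫-zero φ (λ _ → refl))))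
  onLetter (suc m) f = trans (K m f) (⟪⟫-cong φ (λ x → sym (⟪⟫-∂C x m f)))
  right : ⟪ ∂ ψ p ∣ f ⟫ ≡ ⟪ φ ∣ R ⟫
  right = trans (⟪⟫-linExt (derW (λ b → linExt (λ w → ∂W w b) ψ)) p f) (trans
    (⟪⟫-cong p (λ w → ⟪⟫-derW-linear φ onLetter w f)) (⟪⟫-swap p φ (λ w x → ⟪ derW (∂C x) w ∣ f ⟫)))

-- Compatibility with τ

-- The block (m , k) stands for b₀^m b_{k+1}; τ reverses the blocks and swaps their entries.
Block : Set
Block = ℕ × ℕ

word : List Block → Word B
word [] = []
word ((m , k) ∷ bs) = replicate m 0 ++ suc k ∷ word bs

rs : List Block → List Block
rs [] = []
rs ((m , k) ∷ bs) = rs bs ++ (k , m) ∷ []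

rs-++ : ∀ as bs → rs (as ++ bs) ≡ rs bs ++ rs as
rs-++ [] bs = sym (++-identityʳ (rs bs))
rs-++ ((m , k) ∷ as) bs = trans (cong (_++ (k , m) ∷ []) (rs-++ as bs)) (++-assoc (rs bs) (rs as) _)

rs-involutive : ∀ bs → rs (rs bs) ≡ bs
rs-involutive [] = refl
rs-involutive ((m , k) ∷ bs) = trans (rs-++ (rs bs) ((k , m) ∷ [])) (cong ((m , k) ∷_) (rs-involutive bs))

word-++ : ∀ as bs → word (as ++ bs) ≡ word as ++ word bs
word-++ [] bs = refl
word-++ ((m , k) ∷ as) bs = trans (cong (λ z → replicate m 0 ++ suc k ∷ z) (word-++ as bs))
  (sym (++-assoc (replicate m 0) (suc k ∷ word as) (word bs)))

blY : Word Y → List Block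
blY = map (_, 0)

raiseB : ℕ → List Block → List Block
raiseB m [] = []
raiseB m ((a , b) ∷ bs) = (m ℕ.+ a , b) ∷ bs

-- With x = ι(u) x₀^r, these are the blocks of x b₀^m b_{k+1} and b₀^m x b_{k+1}; their difference
-- is [x, b₀^m] b_{k+1}.
blA blA′ : Word Y × ℕ → ℕ → ℕ → List Block
blA (u , r) m k = blY u ++ (r ℕ.+ m , k) ∷ []
blA′ (u , r) m k = raiseB m (blY u ++ (r , k) ∷ [])

-- σ_a and σ_c on words of blocks, for a single word φ = ι(u) x₀^r.  In KA the insertions of a
-- before and after each letter telescope to commutators with the powers of b₀.
KA KD KC : Word Y × ℕ → List Block → (List Block → ℚ) → ℚ
KA s [] h = onY (λ u → h (blY u)) s
KA s ((m , k) ∷ bs) h = (h (blA s m k ++ bs) - h (blA′ s m k ++ bs)) + KA s bs (λ z → h ((m , k) ∷ z))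
KD s [] h = 0ℚ
KD s ((m , k) ∷ bs) h = (h (rs (blA s k m) ++ bs) - h (rs (blA′ s k m) ++ bs)) + KD s bs (λ z → h ((m , k) ∷ z))
KC s bs h = onY (λ u → h (rs (blY u) ++ bs)) s + KD s bs h

KA-cong : ∀ s bs {h h′ : List Block → ℚ} → (∀ z → h z ≡ h′ z) → KA s bs h ≡ KA s bs h′
KA-cong s [] e = onY-cong (λ u → e (blY u)) s
KA-cong s ((m , k) ∷ bs) e = cong₂ _+_ (cong₂ _-_ (e _) (e _)) (KA-cong s bs (λ z → e ((m , k) ∷ z)))

KD-cong : ∀ s bs {h h′ : List Block → ℚ} → (∀ z → h z ≡ h′ z) → KD s bs h ≡ KD s bs h′
KD-cong s [] e = refl
KD-cong s ((m , k) ∷ bs) e = cong₂ _+_ (cong₂ _-_ (e _) (e _)) (KD-cong s bs (λ z → e ((m , k) ∷ z)))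

KC-cong : ∀ s bs {h h′ : List Block → ℚ} → (∀ z → h z ≡ h′ z) → KC s bs h ≡ KC s bs h′
KC-cong s bs e = cong₂ _+_ (onY-cong (λ u → e _) s) (KD-cong s bs e)

KD-snoc : ∀ s bs m k h → KD s (bs ++ (m , k) ∷ []) h
  ≡ KD s bs (λ z → h (z ++ (m , k) ∷ [])) + (h (bs ++ rs (blA s k m)) - h (bs ++ rs (blA′ s k m)))
KD-snoc s [] m k h = trans (cong₂ (λ a b → (h a - h b) + 0ℚ) (++-identityʳ (rs (blA s k m))) (++-identityʳ (rs (blA′ s k m))))
  (+-comm (h (rs (blA s k m)) - h (rs (blA′ s k m))) 0ℚ)
KD-snoc s ((a , b) ∷ bs) m k h = trans
  (cong₂ _+_ (cong₂ (λ y z → h y - h z) (sym (++-assoc (rs (blA s b a)) bs ((m , k) ∷ []))) (sym (++-assoc (rs (blA′ s b a)) bs ((m , k) ∷ []))))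
    (KD-snoc s bs m k (λ z → h ((a , b) ∷ z))))
  (sym (+-assoc (h ((rs (blA s b a) ++ bs) ++ (m , k) ∷ []) - h ((rs (blA′ s b a) ++ bs) ++ (m , k) ∷ []))
    (KD s bs (λ z → h ((a , b) ∷ z ++ (m , k) ∷ [])))
    (h ((a , b) ∷ bs ++ rs (blA s k m)) - h ((a , b) ∷ bs ++ rs (blA′ s k m)))))

-- After telescoping, σ_a puts commutators into the blocks and one copy of a at the right end.
-- Reversing the blocks gives the reversed commutators and a copy of c at the left end.
KC-rs : ∀ s bs h → KC s (rs bs) h ≡ KA s bs (λ z → h (rs z))
KC-rs s [] h = trans (+-identityʳ _) (onY-cong (λ u → cong h (++-identityʳ (rs (blY u)))) s)
KC-rs s ((m , k) ∷ bs) h = begin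
  onY (λ u → h (rs (blY u) ++ rs bs ++ (k , m) ∷ [])) s + KD s (rs bs ++ (k , m) ∷ []) h
    ≡⟨ cong₂ _+_ (onY-cong (λ u → cong h (sym (++-assoc (rs (blY u)) (rs bs) ((k , m) ∷ [])))) s) (KD-snoc s (rs bs) k m h) ⟩
  a + (b + c) ≡⟨ solve 3 (λ a b c → a :+ (b :+ c) := c :+ (a :+ b)) refl a b c ⟩
  c + (a + b) ≡⟨ cong₂ _+_ (cong₂ (λ y z → h y - h z) (sym (rs-++ (blA s m k) bs)) (sym (rs-++ (blA′ s m k) bs)))
                   (KC-rs s bs (λ z → h (z ++ (k , m) ∷ []))) ⟩
  KA s ((m , k) ∷ bs) (λ z → h (rs z)) ∎
  where
  a = onY (λ u → h ((rs (blY u) ++ rs bs) ++ (k , m) ∷ [])) s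
  b = KD s (rs bs) (λ z → h (z ++ (k , m) ∷ []))
  c = h (rs bs ++ rs (blA s m k)) - h (rs bs ++ rs (blA′ s m k))

replicate-+ : ∀ (a : A) m n → replicate (m ℕ.+ n) a ≡ replicate m a ++ replicate n a
replicate-+ a zero n = refl
replicate-+ a (suc m) n = cong (a ∷_) (replicate-+ a m n)

map-letterX-x₀^ : ∀ r → map letterX (replicate r x₀) ≡ replicate r 0
map-letterX-x₀^ zero = refl
map-letterX-x₀^ (suc r) = cong (0 ∷_) (map-letterX-x₀^ r)

map-letterX-emb : ∀ u r → map letterX (emb u r) ≡ word (blY u) ++ replicate r 0
map-letterX-emb [] r = map-letterX-x₀^ r
map-letterX-emb (k ∷ u) r = trans (map-++ letterX (replicate k x₀) (x₁ ∷ emb u r)) (trans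
  (cong₂ (λ a b → a ++ 1 ∷ b) (map-letterX-x₀^ k) (map-letterX-emb u r))
  (sym (++-assoc (replicate k 0) (1 ∷ word (blY u)) (replicate r 0))))

map-letterX-sp : ∀ x → map letterX x ≡ word (blY (proj₁ (sp x))) ++ replicate (proj₂ (sp x)) 0
map-letterX-sp x = trans (cong (map letterX) (emb-sp x)) (map-letterX-emb (proj₁ (sp x)) (proj₂ (sp x)))

blA-word : ∀ u r m k → (word (blY u) ++ replicate r 0) ++ replicate m 0 ++ suc k ∷ [] ≡ word (blA (u , r) m k)
blA-word u r m k = begin
  (word (blY u) ++ replicate r 0) ++ replicate m 0 ++ suc k ∷ [] ≡⟨ ++-assoc (word (blY u)) (replicate r 0) _ ⟩
  word (blY u) ++ replicate r 0 ++ replicate m 0 ++ suc k ∷ [] ≡⟨ cong (word (blY u) ++_) (++-assoc (replicate r 0) (replicate m 0) _) ⟨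
  word (blY u) ++ (replicate r 0 ++ replicate m 0) ++ suc k ∷ [] ≡⟨ cong (λ z → word (blY u) ++ z ++ suc k ∷ []) (replicate-+ 0 r m) ⟨
  word (blY u) ++ replicate (r ℕ.+ m) 0 ++ suc k ∷ [] ≡⟨ word-++ (blY u) ((r ℕ.+ m , k) ∷ []) ⟨
  word (blA (u , r) m k) ∎

raiseB-word : ∀ m b bs → replicate m 0 ++ word (b ∷ bs) ≡ word (raiseB m (b ∷ bs))
raiseB-word m (a , k) bs = trans (sym (++-assoc (replicate m 0) (replicate a 0) _)) (cong (_++ suc k ∷ word bs) (sym (replicate-+ 0 m a)))

blA′-word : ∀ u r m k → replicate m 0 ++ (word (blY u) ++ replicate r 0) ++ suc k ∷ [] ≡ word (blA′ (u , r) m k)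
blA′-word u r m k = trans (cong (replicate m 0 ++_) (trans (++-assoc (word (blY u)) (replicate r 0) _) (sym (word-++ (blY u) ((r , k) ∷ []))))) (nonempty u)
  where
  nonempty : ∀ u → replicate m 0 ++ word (blY u ++ (r , k) ∷ []) ≡ word (raiseB m (blY u ++ (r , k) ∷ []))
  nonempty [] = raiseB-word m (r , k) []
  nonempty (a ∷ u) = raiseB-word m (a , 0) (blY u ++ (r , k) ∷ [])

revB-word : ∀ u → revB u ≡ word (rs (blY u))
revB-word [] = refl
revB-word (k ∷ u) = trans (cong (_++ suc k ∷ []) (revB-word u)) (sym (word-++ (rs (blY u)) ((0 , k) ∷ [])))

⟪⟫-derW-0^ : ∀ {G : B → Poly B} → G 0 ≡ zeroP → ∀ m w f →
  ⟪ derW G (replicate m 0 ++ w) ∣ f ⟫ ≡ ⟪ derW G w ∣ (λ z → f (replicate m 0 ++ z)) ⟫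
⟪⟫-derW-0^ e zero w f = refl
⟪⟫-derW-0^ {G} e (suc m) w f = trans (⟪⟫-derW-∷ G 0 (replicate m 0 ++ w) f) (trans
  (cong (λ p → ⟪ p ∣ (λ z → f (z ++ replicate m 0 ++ w)) ⟫ + ⟪ derW G (replicate m 0 ++ w) ∣ (λ z → f (0 ∷ z)) ⟫) e)
  (trans (+-identityˡ _) (⟪⟫-derW-0^ e m w (λ z → f (0 ∷ z)))))

⟪⟫-derW-snoc-0 : ∀ {G : B → Poly B} → G 0 ≡ zeroP → ∀ w f → (∀ z → f (z ++ 0 ∷ []) ≡ 0ℚ) → ⟪ derW G (w ++ 0 ∷ []) ∣ f ⟫ ≡ 0ℚ
⟪⟫-derW-snoc-0 {G} e [] f z = trans (⟪⟫-derW-∷ G 0 [] f) (cong (λ p → ⟪ p ∣ (λ z → f (z ++ [])) ⟫ + 0ℚ) e)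
⟪⟫-derW-snoc-0 {G} e (a ∷ w) f z = trans (⟪⟫-derW-∷ G a (w ++ 0 ∷ []) f) (cong₂ _+_
  (⟪⟫-zero (G a) (λ y → trans (cong f (sym (++-assoc y w (0 ∷ [])))) (z (y ++ w))))
  (⟪⟫-derW-snoc-0 e w (λ y → f (a ∷ y)) (λ y → z (a ∷ y))))

-- With W the remaining blocks, x b₀^m b_{k+1} W + b₀^m [b_{k+1}, x] W + b₀^m b_{k+1} ∂_x(W)
-- regroups as [x, b₀^m] b_{k+1} W + b₀^m b_{k+1} σ_x(W). The condition on `f` removes the last
-- insertion, W x, when x ends in x₀.
⟪⟫-actA-word : ∀ x bs f → (∀ z → f (z ++ 0 ∷ []) ≡ 0ℚ) → ⟪ actA x (word bs) ∣ f ⟫ ≡ KA (sp x) bs (λ z → f (word z))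
⟪⟫-actA-word x [] f v = trans (⟪⟫-mon (map letterX x ++ []) f) (trans
    (cong f (trans (++-identityʳ _) (map-letterX-sp x))) (base (proj₁ (sp x)) (proj₂ (sp x))))
  where
  base : ∀ u r → f (word (blY u) ++ replicate r 0) ≡ onY (λ u → f (word (blY u))) (u , r)
  base u zero = cong f (++-identityʳ (word (blY u)))
  base u (suc r) = trans (cong f (trans (cong (word (blY u) ++_) (replicate-snoc r 0)) (sym (++-assoc (word (blY u)) (replicate r 0) _)))) (v _)
⟪⟫-actA-word x ((m , k) ∷ bs) f v = begin
    ⟪ actA x (word ((m , k) ∷ bs)) ∣ f ⟫ ≡⟨ ⟪⟫-act (∂A x) Λ (word ((m , k) ∷ bs)) f ⟩
    f (Λ ++ word ((m , k) ∷ bs)) + ⟪ derW (∂A x) (word ((m , k) ∷ bs)) ∣ f ⟫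
      ≡⟨ cong (f (Λ ++ word ((m , k) ∷ bs)) +_) (trans (⟪⟫-derW-0^ refl m (suc k ∷ W) f) (trans (⟪⟫-derW-∷ (∂A x) (suc k) W f′)
           (cong (_+ D) (⟪⟫-br-mon (suc k ∷ []) Λ (λ z → f′ (z ++ W)))))) ⟩
    f (Λ ++ word ((m , k) ∷ bs)) + ((f′ (suc k ∷ Λ ++ W) - f′ ((Λ ++ suc k ∷ []) ++ W)) + D)
      ≡⟨ solve 4 (λ a b c d → a :+ ((b :- c) :+ d) := (a :- c) :+ (b :+ d)) refl
           (f (Λ ++ word ((m , k) ∷ bs))) (f′ (suc k ∷ Λ ++ W)) (f′ ((Λ ++ suc k ∷ []) ++ W)) D ⟩
    (f (Λ ++ word ((m , k) ∷ bs)) - f′ ((Λ ++ suc k ∷ []) ++ W)) + (f″ (Λ ++ W) + D)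
      ≡⟨ cong₂ _+_ (cong₂ (λ a b → f a - f b) e₁ e₂) (trans (sym (⟪⟫-act (∂A x) Λ W f″)) (⟪⟫-actA-word x bs f″ v″)) ⟩
    KA (sp x) ((m , k) ∷ bs) (λ z → f (word z)) ∎
  where
  Λ = map letterX x
  W = word bs
  f′ f″ : Word B → ℚ
  f′ z = f (replicate m 0 ++ z)
  f″ z = f (replicate m 0 ++ suc k ∷ z)
  D = ⟪ derW (∂A x) W ∣ f″ ⟫
  v″ : ∀ z → f″ (z ++ 0 ∷ []) ≡ 0ℚ
  v″ z = trans (cong f (sym (++-assoc (replicate m 0) (suc k ∷ z) (0 ∷ [])))) (v _)
  e₁ : Λ ++ word ((m , k) ∷ bs) ≡ word (blA (sp x) m k ++ bs)
  e₁ = begin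
    Λ ++ replicate m 0 ++ suc k ∷ W ≡⟨ cong (Λ ++_) (++-assoc (replicate m 0) (suc k ∷ []) W) ⟨
    Λ ++ (replicate m 0 ++ suc k ∷ []) ++ W ≡⟨ ++-assoc Λ _ W ⟨
    (Λ ++ replicate m 0 ++ suc k ∷ []) ++ W ≡⟨ cong (λ z → (z ++ replicate m 0 ++ suc k ∷ []) ++ W) (map-letterX-sp x) ⟩
    _ ≡⟨ cong (_++ W) (blA-word (proj₁ (sp x)) (proj₂ (sp x)) m k) ⟩
    word (blA (sp x) m k) ++ W ≡⟨ word-++ (blA (sp x) m k) bs ⟨
    word (blA (sp x) m k ++ bs) ∎
  e₂ : replicate m 0 ++ (Λ ++ suc k ∷ []) ++ W ≡ word (blA′ (sp x) m k ++ bs)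
  e₂ = begin
    replicate m 0 ++ (Λ ++ suc k ∷ []) ++ W ≡⟨ ++-assoc (replicate m 0) _ W ⟨
    (replicate m 0 ++ (Λ ++ suc k ∷ [])) ++ W ≡⟨ cong (λ z → (replicate m 0 ++ (z ++ suc k ∷ [])) ++ W) (map-letterX-sp x) ⟩
    _ ≡⟨ cong (_++ W) (blA′-word (proj₁ (sp x)) (proj₂ (sp x)) m k) ⟩
    word (blA′ (sp x) m k) ++ W ≡⟨ word-++ (blA′ (sp x) m k) bs ⟨
    word (blA′ (sp x) m k ++ bs) ∎

rs-blA-word : ∀ u r m k → replicate m 0 ++ revB (u ++ r ℕ.+ k ∷ []) ≡ word (rs (blA (u , r) k m))
rs-blA-word u r m k = trans (cong (replicate m 0 ++_) (trans (revB-++ u (r ℕ.+ k ∷ [])) (cong (suc (r ℕ.+ k) ∷_) (revB-word u))))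
  (cong word (sym (rs-++ (blY u) ((r ℕ.+ k , m) ∷ []))))

rs-blA′-word : ∀ u r m k → replicate m 0 ++ revB (raiseW k (u ++ r ∷ [])) ≡ word (rs (blA′ (u , r) k m))
rs-blA′-word [] r m k = refl
rs-blA′-word (a ∷ u) r m k = begin
  replicate m 0 ++ (revB (u ++ r ∷ []) ++ suc (k ℕ.+ a) ∷ []) ≡⟨ ++-assoc (replicate m 0) _ _ ⟨
  (replicate m 0 ++ revB (u ++ r ∷ [])) ++ suc (k ℕ.+ a) ∷ []
    ≡⟨ cong (λ n → (replicate m 0 ++ revB (u ++ n ∷ [])) ++ suc (k ℕ.+ a) ∷ []) (ℕₚ.+-identityʳ r) ⟨
  (replicate m 0 ++ revB (u ++ r ℕ.+ 0 ∷ [])) ++ suc (k ℕ.+ a) ∷ [] ≡⟨ cong (_++ suc (k ℕ.+ a) ∷ []) (rs-blA-word u r m 0) ⟩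
  word (rs (blA (u , r) 0 m)) ++ suc (k ℕ.+ a) ∷ [] ≡⟨ word-++ (rs (blA (u , r) 0 m)) ((0 , k ℕ.+ a) ∷ []) ⟨
  word (rs ((k ℕ.+ a , 0) ∷ blA (u , r) 0 m)) ≡⟨ cong (λ n → word (rs ((k ℕ.+ a , 0) ∷ blY u ++ (n , m) ∷ []))) (ℕₚ.+-identityʳ r) ⟩
  word (rs (blA′ (a ∷ u , r) k m)) ∎

⟪⟫-actC-word : ∀ x bs f → ⟪ actC x (word bs) ∣ f ⟫ ≡ KC (sp x) bs (λ z → f (word z))
⟪⟫-actC-word x bs f = trans (⟪⟫-actC x (word bs) f) (cong₂ _+_
    (onY-cong (λ u → cong f (trans (cong (_++ word bs) (revB-word u)) (sym (word-++ (rs (blY u)) bs)))) (sp x))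
    (der-word bs f))
  where
  der-word : ∀ bs f → ⟪ derW (∂C x) (word bs) ∣ f ⟫ ≡ KD (sp x) bs (λ z → f (word z))
  der-word [] f = refl
  der-word ((m , k) ∷ bs) f = begin
    ⟪ derW (∂C x) (replicate m 0 ++ suc k ∷ word bs) ∣ f ⟫ ≡⟨ ⟪⟫-derW-0^ refl m (suc k ∷ word bs) f ⟩
    ⟪ derW (∂C x) (suc k ∷ word bs) ∣ (λ z → f (replicate m 0 ++ z)) ⟫ ≡⟨ ⟪⟫-derW-∷ (∂C x) (suc k) (word bs) (λ z → f (replicate m 0 ++ z)) ⟩
    ⟪ ∂C x (suc k) ∣ (λ z → f (replicate m 0 ++ z ++ word bs)) ⟫ + ⟪ derW (∂C x) (word bs) ∣ (λ z → f (replicate m 0 ++ suc k ∷ z)) ⟫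
      ≡⟨ cong₂ _+_ (trans (⟪⟫-∂C x k (λ z → f (replicate m 0 ++ z ++ word bs)))
           (cong₂ (λ a b → f a - f b)
             (regroup (rs (blA (sp x) k m)) (rs-blA-word (proj₁ (sp x)) (proj₂ (sp x)) m k))
             (regroup (rs (blA′ (sp x) k m)) (rs-blA′-word (proj₁ (sp x)) (proj₂ (sp x)) m k))))
           (der-word bs (λ z → f (replicate m 0 ++ suc k ∷ z))) ⟩
    KD (sp x) ((m , k) ∷ bs) (λ z → f (word z)) ∎
    where
    regroup : ∀ {z} cs → replicate m 0 ++ z ≡ word cs → replicate m 0 ++ z ++ word bs ≡ word (cs ++ bs)
    regroup {z} cs e = trans (sym (++-assoc (replicate m 0) z (word bs))) (trans (cong (_++ word bs) e) (sym (word-++ cs bs)))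

-- Words ending in b₀, and the maps τ and π₀

data Ending : Word B → Set where
  blocks : ∀ bs → Ending (word bs)
  zeroEnd : ∀ w → Ending (w ++ 0 ∷ [])

-- The dichotomy behind all statements on τ: on products of blocks τ is `rs` and π₀ is the identity,
-- and both kill the remaining words.
ending : ∀ w → Ending w
ending [] = blocks []
ending (a ∷ w) with ending w
ending (suc k ∷ _) | blocks bs = blocks ((0 , k) ∷ bs)
ending (zero ∷ _) | blocks [] = zeroEnd []
ending (zero ∷ _) | blocks ((m , k) ∷ bs) = blocks ((suc m , k) ∷ bs)
ending (a ∷ _) | zeroEnd w = zeroEnd (a ∷ w)

onJust : (Word B → ℚ) → Maybe (Word B) → ℚ
onJust f (just v) = f v
onJust f nothing = 0ℚ

⟪⟫-τ : ∀ p f → ⟪ τ p ∣ f ⟫ ≡ ⟪ p ∣ (λ w → onJust f (τW 0 w)) ⟫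
⟪⟫-τ [] f = refl
⟪⟫-τ ((c , w) ∷ p) f with τW 0 w
... | just v = cong₂ _+_ (cong (_* f v) (*-identityʳ c)) (⟪⟫-τ p f)
... | nothing = trans (⟪⟫-τ p f) (sym (trans (cong (_+ ⟪ p ∣ (λ w → onJust f (τW 0 w)) ⟫) (*-zeroʳ c)) (+-identityˡ _)))

τW-0 : ∀ n w → τW n (0 ∷ w) ≡ τW (suc n) w
τW-0 zero w = refl
τW-0 (suc n) w = refl

τW-0^ : ∀ n m w → τW n (replicate m 0 ++ w) ≡ τW (n ℕ.+ m) w
τW-0^ n zero w = cong (λ k → τW k w) (sym (ℕₚ.+-identityʳ n))
τW-0^ n (suc m) w = trans (τW-0 n (replicate m 0 ++ w)) (trans (τW-0^ (suc n) m w) (cong (λ k → τW k w) (sym (ℕₚ.+-suc n m))))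

τW-suc : ∀ n k w {v} → τW 0 w ≡ just v → τW n (suc k ∷ w) ≡ just (v ++ (replicate k 0 ++ (suc n ∷ [])))
τW-suc zero k w e rewrite e = refl
τW-suc (suc n) k w e rewrite e = refl

τW-suc-nothing : ∀ n k w → τW 0 w ≡ nothing → τW n (suc k ∷ w) ≡ nothing
τW-suc-nothing zero k w e rewrite e = refl
τW-suc-nothing (suc n) k w e rewrite e = refl

τW-word : ∀ bs → τW 0 (word bs) ≡ just (word (rs bs))
τW-word [] = refl
τW-word ((m , k) ∷ bs) = trans (τW-0^ 0 m (suc k ∷ word bs)) (trans (τW-suc m k (word bs) (τW-word bs))
  (cong just (sym (word-++ (rs bs) ((k , m) ∷ [])))))

τW-snoc-0 : ∀ n w → τW n (w ++ 0 ∷ []) ≡ nothing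
τW-snoc-0 n [] = τW-0 n []
τW-snoc-0 n (zero ∷ w) = trans (τW-0 n (w ++ 0 ∷ [])) (τW-snoc-0 (suc n) w)
τW-snoc-0 n (suc k ∷ w) = τW-suc-nothing n k (w ++ 0 ∷ []) (τW-snoc-0 0 w)

endsInB0-∷ : ∀ a b w → endsInB0 (a ∷ b ∷ w) ≡ endsInB0 (b ∷ w)
endsInB0-∷ zero b w = refl
endsInB0-∷ (suc a) b w = refl

endsInB0-block : ∀ m k w → endsInB0 w ≡ false → endsInB0 (replicate m 0 ++ suc k ∷ w) ≡ false
endsInB0-block zero k [] e = refl
endsInB0-block zero k (b ∷ w) e = e
endsInB0-block (suc zero) k w e = endsInB0-block zero k w e
endsInB0-block (suc (suc m)) k w e = endsInB0-block (suc m) k w e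

endsInB0-word : ∀ bs → endsInB0 (word bs) ≡ false
endsInB0-word [] = refl
endsInB0-word ((m , k) ∷ bs) = endsInB0-block m k (word bs) (endsInB0-word bs)

endsInB0-snoc-0 : ∀ w → endsInB0 (w ++ 0 ∷ []) ≡ true
endsInB0-snoc-0 [] = refl
endsInB0-snoc-0 (a ∷ []) = endsInB0-∷ a 0 []
endsInB0-snoc-0 (a ∷ b ∷ w) = trans (endsInB0-∷ a b (w ++ 0 ∷ [])) (endsInB0-snoc-0 (b ∷ w))

keep : (Word B → ℚ) → Word B → ℚ
keep f w = if endsInB0 w then 0ℚ else f w

⟪⟫-π₀ : ∀ p f → ⟪ π₀ p ∣ f ⟫ ≡ ⟪ p ∣ keep f ⟫
⟪⟫-π₀ [] f = refl
⟪⟫-π₀ ((c , w) ∷ p) f with endsInB0 w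
... | false = cong₂ _+_ (cong (_* f w) (*-identityʳ c)) (⟪⟫-π₀ p f)
... | true = trans (⟪⟫-π₀ p f) (sym (trans (cong (_+ ⟪ p ∣ keep f ⟫) (*-zeroʳ c)) (+-identityˡ _)))

keep-word : ∀ f bs → keep f (word bs) ≡ f (word bs)
keep-word f bs = cong (λ b → if b then 0ℚ else f (word bs)) (endsInB0-word bs)

keep-snoc-0 : ∀ f w → keep f (w ++ 0 ∷ []) ≡ 0ℚ
keep-snoc-0 f w = cong (λ b → if b then 0ℚ else f (w ++ 0 ∷ [])) (endsInB0-snoc-0 w)

τ* : (Word B → ℚ) → Word B → ℚ
τ* f w = onJust f (τW 0 w)

τ*-word : ∀ f bs → τ* f (word bs) ≡ f (word (rs bs))
τ*-word f bs = cong (onJust f) (τW-word bs)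

τ*-snoc-0 : ∀ f w → τ* f (w ++ 0 ∷ []) ≡ 0ℚ
τ*-snoc-0 f w = cong (onJust f) (τW-snoc-0 0 w)

keep-τ* : ∀ f w → keep (τ* f) w ≡ τ* f w
keep-τ* f w with ending w
... | blocks bs = keep-word (τ* f) bs
... | zeroEnd w′ = trans (keep-snoc-0 (τ* f) w′) (sym (τ*-snoc-0 f w′))

τ*-keep : ∀ f w → τ* (keep f) w ≡ τ* f w
τ*-keep f w with ending w
... | blocks bs = trans (τ*-word (keep f) bs) (trans (keep-word f (rs bs)) (sym (τ*-word f bs)))
... | zeroEnd w′ = trans (τ*-snoc-0 (keep f) w′) (sym (τ*-snoc-0 f w′))

-- On blocks this is `KC-rs`. On words ending in b₀ both sides vanish, because left multiplication
-- and a derivation that kills b₀ preserve the final b₀.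
actA-τ : ∀ x w f → ⟪ actA x w ∣ τ* f ⟫ ≡ τ* (λ v → ⟪ actC x v ∣ f ⟫) w
actA-τ x w f with ending w
... | blocks bs = begin
  ⟪ actA x (word bs) ∣ τ* f ⟫ ≡⟨ ⟪⟫-actA-word x bs (τ* f) (τ*-snoc-0 f) ⟩
  KA (sp x) bs (λ z → τ* f (word z)) ≡⟨ KA-cong (sp x) bs (τ*-word f) ⟩
  KA (sp x) bs (λ z → f (word (rs z))) ≡⟨ KC-rs (sp x) bs (λ z → f (word z)) ⟨
  KC (sp x) (rs bs) (λ z → f (word z)) ≡⟨ ⟪⟫-actC-word x (rs bs) f ⟨
  ⟪ actC x (word (rs bs)) ∣ f ⟫ ≡⟨ τ*-word (λ v → ⟪ actC x v ∣ f ⟫) bs ⟨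
  τ* (λ v → ⟪ actC x v ∣ f ⟫) (word bs) ∎
... | zeroEnd w′ = begin
  ⟪ actA x (w′ ++ 0 ∷ []) ∣ τ* f ⟫ ≡⟨ ⟪⟫-act (∂A x) (map letterX x) (w′ ++ 0 ∷ []) (τ* f) ⟩
  τ* f (map letterX x ++ w′ ++ 0 ∷ []) + ⟪ derW (∂A x) (w′ ++ 0 ∷ []) ∣ τ* f ⟫
    ≡⟨ cong₂ _+_ (trans (cong (τ* f) (sym (++-assoc (map letterX x) w′ (0 ∷ [])))) (τ*-snoc-0 f (map letterX x ++ w′)))
         (⟪⟫-derW-snoc-0 refl w′ (τ* f) (τ*-snoc-0 f)) ⟩
  0ℚ ≡⟨ τ*-snoc-0 (λ v → ⟪ actC x v ∣ f ⟫) w′ ⟨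
  τ* (λ v → ⟪ actC x v ∣ f ⟫) (w′ ++ 0 ∷ []) ∎

-- `KC-rs` again, read through the involution `rs`. Unlike `τ* f`, a general `f` does not vanish on
-- words ending in b₀, as `⟪⟫-actA-word` demands; hence `keep f`.
actC-τ : ∀ x w f → ⟪ actC x w ∣ τ* f ⟫ ≡ τ* (λ v → ⟪ actA x v ∣ keep f ⟫) w
actC-τ x w f with ending w
... | blocks bs = begin
  ⟪ actC x (word bs) ∣ τ* f ⟫ ≡⟨ ⟪⟫-actC-word x bs (τ* f) ⟩
  KC (sp x) bs (λ z → τ* f (word z)) ≡⟨ KC-cong (sp x) bs (τ*-word f) ⟩
  KC (sp x) bs (λ z → f (word (rs z))) ≡⟨ cong (λ cs → KC (sp x) cs (λ z → f (word (rs z)))) (rs-involutive bs) ⟨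
  KC (sp x) (rs (rs bs)) (λ z → f (word (rs z))) ≡⟨ KC-rs (sp x) (rs bs) (λ z → f (word (rs z))) ⟩
  KA (sp x) (rs bs) (λ z → f (word (rs (rs z)))) ≡⟨ KA-cong (sp x) (rs bs) (λ z → trans (cong (λ cs → f (word cs)) (rs-involutive z)) (sym (keep-word f z))) ⟩
  KA (sp x) (rs bs) (λ z → keep f (word z)) ≡⟨ ⟪⟫-actA-word x (rs bs) (keep f) (keep-snoc-0 f) ⟨
  ⟪ actA x (word (rs bs)) ∣ keep f ⟫ ≡⟨ τ*-word (λ v → ⟪ actA x v ∣ keep f ⟫) bs ⟨
  τ* (λ v → ⟪ actA x v ∣ keep f ⟫) (word bs) ∎
... | zeroEnd w′ = begin
  ⟪ actC x (w′ ++ 0 ∷ []) ∣ τ* f ⟫ ≡⟨ ⟪⟫-actC x (w′ ++ 0 ∷ []) (τ* f) ⟩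
  onY (λ u → τ* f (revB u ++ w′ ++ 0 ∷ [])) (sp x) + ⟪ derW (∂C x) (w′ ++ 0 ∷ []) ∣ τ* f ⟫
    ≡⟨ cong₂ _+_ (trans (onY-cong (λ u → trans (cong (τ* f) (sym (++-assoc (revB u) w′ (0 ∷ [])))) (τ*-snoc-0 f (revB u ++ w′))) (sp x)) (onY-0 (sp x)))
         (⟪⟫-derW-snoc-0 refl w′ (τ* f) (τ*-snoc-0 f)) ⟩
  0ℚ ≡⟨ τ*-snoc-0 (λ v → ⟪ actA x v ∣ keep f ⟫) w′ ⟨
  τ* (λ v → ⟪ actA x v ∣ keep f ⟫) (w′ ++ 0 ∷ []) ∎
  where
  onY-0 : ∀ s → onY (λ _ → 0ℚ) s ≡ 0ℚ
  onY-0 (u , zero) = refl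
  onY-0 (u , suc _) = refl

τ-σA : ∀ φ → ∂-formula φ → ∀ p f → ⟪ σ (θX φ) p ∣ τ* f ⟫ ≡ ⟪ σ (θY (πY φ)) (τ p) ∣ f ⟫
τ-σA φ K p f = begin
  ⟪ σ (θX φ) p ∣ τ* f ⟫ ≡⟨ ⟪⟫-σA φ p (τ* f) ⟩
  ⟪ φ ∣ (λ x → ⟪ p ∣ (λ w → ⟪ actA x w ∣ τ* f ⟫) ⟫) ⟫ ≡⟨ ⟪⟫-cong φ (λ x → ⟪⟫-cong p (λ w → actA-τ x w f)) ⟩
  ⟪ φ ∣ (λ x → ⟪ p ∣ τ* (λ v → ⟪ actC x v ∣ f ⟫) ⟫) ⟫ ≡⟨ ⟪⟫-cong φ (λ x → ⟪⟫-τ p (λ v → ⟪ actC x v ∣ f ⟫)) ⟨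
  ⟪ φ ∣ (λ x → ⟪ τ p ∣ (λ v → ⟪ actC x v ∣ f ⟫) ⟫) ⟫ ≡⟨ ⟪⟫-σC φ K (τ p) f ⟨
  ⟪ σ (θY (πY φ)) (τ p) ∣ f ⟫ ∎

τ-σC : ∀ φ → ∂-formula φ → ∀ p f → ⟪ σ (θY (πY φ)) p ∣ τ* f ⟫ ≡ ⟪ σ (θX φ) (τ p) ∣ keep f ⟫
τ-σC φ K p f = begin
  ⟪ σ (θY (πY φ)) p ∣ τ* f ⟫ ≡⟨ ⟪⟫-σC φ K p (τ* f) ⟩
  ⟪ φ ∣ (λ x → ⟪ p ∣ (λ w → ⟪ actC x w ∣ τ* f ⟫) ⟫) ⟫ ≡⟨ ⟪⟫-cong φ (λ x → ⟪⟫-cong p (λ w → actC-τ x w f)) ⟩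
  ⟪ φ ∣ (λ x → ⟪ p ∣ τ* (λ v → ⟪ actA x v ∣ keep f ⟫) ⟫) ⟫ ≡⟨ ⟪⟫-cong φ (λ x → ⟪⟫-τ p (λ v → ⟪ actA x v ∣ keep f ⟫)) ⟨
  ⟪ φ ∣ (λ x → ⟪ τ p ∣ (λ v → ⟪ actA x v ∣ keep f ⟫) ⟫) ⟫ ≡⟨ ⟪⟫-σA φ (τ p) (keep f) ⟨
  ⟪ σ (θX φ) (τ p) ∣ keep f ⟫ ∎

T : Word X → Word B
T = map letterX

-- The map θ^(10)

⟪⟫-ΔW-map : ∀ (t : A → A′) w F → ⟪ ΔW (map t w) ∣ F ⟫ ≡ ⟪ ΔW w ∣ (λ (p , q) → F (map t p , map t q)) ⟫
⟪⟫-ΔW-map t [] F = refl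
⟪⟫-ΔW-map t (a ∷ w) F = trans (⟪⟫-ΔW-∷ (t a) (map t w) F) (trans
  (⟪⟫-ΔW-map t w (λ (u , v) → F (t a ∷ u , v) + F (u , t a ∷ v)))
  (sym (⟪⟫-ΔW-∷ a w (λ (p , q) → F (map t p , map t q)))))

⟪⟫-ΔW-revB : ∀ w F → ⟪ ΔW (revB w) ∣ F ⟫ ≡ ⟪ ΔW w ∣ (λ (p , q) → F (revB p , revB q)) ⟫
⟪⟫-ΔW-revB [] F = refl
⟪⟫-ΔW-revB (a ∷ w) F = trans (⟪⟫-ΔW-snoc (revB w) (suc a) F) (trans
  (⟪⟫-ΔW-revB w (λ (u , v) → F (u ++ suc a ∷ [] , v) + F (u , v ++ suc a ∷ [])))
  (sym (⟪⟫-ΔW-∷ a w (λ (p , q) → F (revB p , revB q)))))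

-- The identity θ_Y π_Y = τ θ_X: the block b₀^k b₁ of y_{k+1} is turned by τ into b_{k+1}, and both
-- sides kill words ending in x₀.
onY-revB : ∀ f x → onY (λ u → f (revB u)) (sp x) ≡ τ* f (T x)
onY-revB f x = sym (trans (cong (τ* f) (map-letterX-sp x)) (cases (proj₁ (sp x)) (proj₂ (sp x))))
  where
  cases : ∀ u r → τ* f (word (blY u) ++ replicate r 0) ≡ onY (λ u → f (revB u)) (u , r)
  cases u zero = trans (cong (τ* f) (++-identityʳ (word (blY u)))) (trans (τ*-word f (blY u)) (cong f (sym (revB-word u))))
  cases u (suc r) = trans (cong (τ* f) (trans (cong (word (blY u) ++_) (replicate-snoc r 0)) (sym (++-assoc (word (blY u)) (replicate r 0) (0 ∷ [])))))
    (τ*-snoc-0 f (word (blY u) ++ replicate r 0))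

⟪⟫-θYπY-τ : ∀ φ f → ⟪ θY (πY φ) ∣ f ⟫ ≡ ⟪ φ ∣ (λ x → τ* f (T x)) ⟫
⟪⟫-θYπY-τ φ f = trans (⟪⟫-θYπY φ f) (⟪⟫-cong φ (onY-revB f))

δx₁ : Word X → ℚ
δx₁ = WX.δW (x₁ ∷ [])

-- The transpose of θ^(10). Its last term corrects θ(x₁) = 2 b₁ to b₁; x₀ calls for no correction,
-- since π_Y(x₀) = 0 gives θ(x₀) = b₀.
θ10* : (Word B → ℚ) → Word X → ℚ
θ10* f x = (f (T x) + τ* f (T x)) - δx₁ x * f (1 ∷ [])

⟪⟫-θ10 : ∀ φ f → ⟪ θ10 φ ∣ f ⟫ ≡ ⟪ φ ∣ θ10* f ⟫
⟪⟫-θ10 φ f = begin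
    ⟪ θ10 φ ∣ f ⟫ ≡⟨ ⟪⟫-++ (θ φ′ ⊕ λ₁ · letter 1) (λ₀ · letter 0) f ⟩
    ⟪ θ φ′ ⊕ λ₁ · letter 1 ∣ f ⟫ + ⟪ λ₀ · letter 0 ∣ f ⟫
      ≡⟨ cong₂ _+_ (trans (⟪⟫-++ (θ φ′) (λ₁ · letter 1) f) (cong₂ _+_ (θ-part) (mono λ₁ (1 ∷ []) f))) (mono λ₀ (0 ∷ []) f) ⟩
    (((⟪ φ ∣ g ⟫ - λ₁ * (f (1 ∷ []) + f (1 ∷ []))) - λ₀ * (f (0 ∷ []) + 0ℚ)) + λ₁ * f (1 ∷ [])) + λ₀ * f (0 ∷ [])
      ≡⟨ solve 5 (λ p a b x y → (((p :- a :* (x :+ x)) :- b :* (y :+ con 0ℚ)) :+ a :* x) :+ b :* y := p :- x :* a) refl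
           ⟪ φ ∣ g ⟫ λ₁ λ₀ (f (1 ∷ [])) (f (0 ∷ [])) ⟩
    ⟪ φ ∣ g ⟫ - f (1 ∷ []) * λ₁ ≡⟨ cong (λ c → ⟪ φ ∣ g ⟫ - f (1 ∷ []) * c) (WX.coeff-⟪⟫ φ (x₁ ∷ [])) ⟩
    ⟪ φ ∣ g ⟫ - f (1 ∷ []) * ⟪ φ ∣ δx₁ ⟫ ≡⟨ cong (λ c → ⟪ φ ∣ g ⟫ - c) (⟪⟫-* φ (f (1 ∷ [])) δx₁) ⟨
    ⟪ φ ∣ g ⟫ - ⟪ φ ∣ (λ x → f (1 ∷ []) * δx₁ x) ⟫ ≡⟨ ⟪⟫-- φ g (λ x → f (1 ∷ []) * δx₁ x) ⟨
    ⟪ φ ∣ (λ x → g x - f (1 ∷ []) * δx₁ x) ⟫ ≡⟨ ⟪⟫-cong φ (λ x → cong (λ c → g x - c) (*-comm (f (1 ∷ [])) (δx₁ x))) ⟩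
    ⟪ φ ∣ θ10* f ⟫ ∎
  where
  λ₀ = coeffX φ (x₀ ∷ [])
  λ₁ = coeffX φ (x₁ ∷ [])
  φ₁ = φ ⊖ λ₁ · letter x₁
  φ′ = φ₁ ⊖ λ₀ · letter x₀
  g : Word X → ℚ
  g x = f (T x) + τ* f (T x)
  mono : ∀ {A : Set} c (w : Word A) h → ⟪ c · mon w ∣ h ⟫ ≡ c * h w
  mono c w h = trans (⟪⟫-· c (mon w) h) (cong (c *_) (⟪⟫-mon w h))
  ⟪⟫-θ : ∀ p → ⟪ θ p ∣ f ⟫ ≡ ⟪ p ∣ g ⟫
  ⟪⟫-θ p = trans (⟪⟫-++ (θX p) (θY (πY p)) f) (trans (cong₂ _+_ (⟪⟫-θX p f) (⟪⟫-θYπY-τ p f))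
    (sym (⟪⟫-+ p (λ x → f (T x)) (λ x → τ* f (T x)))))
  θ-part : ⟪ θ φ′ ∣ f ⟫ ≡ (⟪ φ ∣ g ⟫ - λ₁ * (f (1 ∷ []) + f (1 ∷ []))) - λ₀ * (f (0 ∷ []) + 0ℚ)
  θ-part = trans (⟪⟫-θ φ′) (trans (⟪⟫-⊖ φ₁ (λ₀ · letter x₀) g) (cong₂ _-_
    (trans (⟪⟫-⊖ φ (λ₁ · letter x₁) g) (cong (λ c → ⟪ φ ∣ g ⟫ - c) (mono λ₁ (x₁ ∷ []) g)))
    (mono λ₀ (x₀ ∷ []) g)))

⟪⟫-θ10-split : ∀ φ f → ⟪ θ10 φ ∣ f ⟫ ≡ (⟪ θX φ ∣ f ⟫ + ⟪ θY (πY φ) ∣ f ⟫) - ⟪ φ ∣ δx₁ ⟫ * ⟪ letter 1 ∣ f ⟫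
⟪⟫-θ10-split φ f = begin
  ⟪ θ10 φ ∣ f ⟫ ≡⟨ ⟪⟫-θ10 φ f ⟩
  ⟪ φ ∣ θ10* f ⟫ ≡⟨ ⟪⟫-- φ (λ x → f (T x) + τ* f (T x)) (λ x → δx₁ x * f (1 ∷ [])) ⟩
  ⟪ φ ∣ (λ x → f (T x) + τ* f (T x)) ⟫ - ⟪ φ ∣ (λ x → δx₁ x * f (1 ∷ [])) ⟫
    ≡⟨ cong₂ _-_ (trans (⟪⟫-+ φ (λ x → f (T x)) (λ x → τ* f (T x))) (sym (cong₂ _+_ (⟪⟫-θX φ f) (⟪⟫-θYπY-τ φ f))))
         (trans (⟪⟫-cong φ (λ x → *-comm (δx₁ x) (f (1 ∷ [])))) (trans (⟪⟫-* φ (f (1 ∷ [])) δx₁)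
           (trans (*-comm (f (1 ∷ [])) ⟪ φ ∣ δx₁ ⟫) (cong (⟪ φ ∣ δx₁ ⟫ *_) (sym (⟪⟫-mon (1 ∷ []) f)))))) ⟩
  (⟪ θX φ ∣ f ⟫ + ⟪ θY (πY φ) ∣ f ⟫) - ⟪ φ ∣ δx₁ ⟫ * ⟪ letter 1 ∣ f ⟫ ∎

θ10-linear : ∀ a b φ₁ φ₂ → θ10 (a · φ₁ ⊕ b · φ₂) ≈N (a · θ10 φ₁ ⊕ b · θ10 φ₂)
θ10-linear a b φ₁ φ₂ = WN.⟪⟫⇒≈ (θ10 (a · φ₁ ⊕ b · φ₂)) (a · θ10 φ₁ ⊕ b · θ10 φ₂) (λ f → begin
  ⟪ θ10 (a · φ₁ ⊕ b · φ₂) ∣ f ⟫ ≡⟨ ⟪⟫-θ10 (a · φ₁ ⊕ b · φ₂) f ⟩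
  ⟪ a · φ₁ ⊕ b · φ₂ ∣ θ10* f ⟫ ≡⟨ lin φ₁ φ₂ (θ10* f) ⟩
  a * ⟪ φ₁ ∣ θ10* f ⟫ + b * ⟪ φ₂ ∣ θ10* f ⟫ ≡⟨ cong₂ (λ x y → a * x + b * y) (⟪⟫-θ10 φ₁ f) (⟪⟫-θ10 φ₂ f) ⟨
  a * ⟪ θ10 φ₁ ∣ f ⟫ + b * ⟪ θ10 φ₂ ∣ f ⟫ ≡⟨ lin (θ10 φ₁) (θ10 φ₂) f ⟨
  ⟪ a · θ10 φ₁ ⊕ b · θ10 φ₂ ∣ f ⟫ ∎)
  where
  lin : ∀ {A : Set} (p q : Poly A) f → ⟪ a · p ⊕ b · q ∣ f ⟫ ≡ a * ⟪ p ∣ f ⟫ + b * ⟪ q ∣ f ⟫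
  lin p q f = trans (⟪⟫-++ (a · p) (b · q) f) (cong₂ _+_ (⟪⟫-· a p f) (⟪⟫-· b q f))

x₁-θX : ∀ f → ⟪ letter 1 ∣ f ⟫ ≡ ⟪ θX (letter x₁) ∣ f ⟫
x₁-θX f = trans (⟪⟫-mon (1 ∷ []) f) (sym (trans (⟪⟫-θX (letter x₁) f) (⟪⟫-mon (x₁ ∷ []) (λ x → f (T x)))))

x₁-θY : ∀ f → ⟪ letter 1 ∣ f ⟫ ≡ ⟪ θY (πY (letter x₁)) ∣ f ⟫
x₁-θY f = trans (⟪⟫-mon (1 ∷ []) f) (sym (trans (⟪⟫-θYπY-τ (letter x₁) f) (⟪⟫-mon (x₁ ∷ []) (λ x → τ* f (T x)))))

σ-congˡ : ∀ ψ ψ′ → (∀ f → ⟪ ψ ∣ f ⟫ ≡ ⟪ ψ′ ∣ f ⟫) → ∀ p f → ⟪ σ ψ p ∣ f ⟫ ≡ ⟪ σ ψ′ p ∣ f ⟫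
σ-congˡ ψ ψ′ e p f = trans (⟪⟫-σ ψ p f) (trans (e _) (sym (⟪⟫-σ ψ′ p f)))

σ-congʳ : ∀ ψ p p′ → (∀ f → ⟪ p ∣ f ⟫ ≡ ⟪ p′ ∣ f ⟫) → ∀ f → ⟪ σ ψ p ∣ f ⟫ ≡ ⟪ σ ψ p′ ∣ f ⟫
σ-congʳ ψ p p′ e f = trans (⟪⟫-σ ψ p f) (trans (⟪⟫-cong ψ (λ z → e _)) (sym (⟪⟫-σ ψ p′ f)))

σ-θ10ˡ : ∀ φ p f → ⟪ σ (θ10 φ) p ∣ f ⟫ ≡ (⟪ σ (θX φ) p ∣ f ⟫ + ⟪ σ (θY (πY φ)) p ∣ f ⟫) - ⟪ φ ∣ δx₁ ⟫ * ⟪ σ (letter 1) p ∣ f ⟫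
σ-θ10ˡ φ p f = trans (⟪⟫-σ (θ10 φ) p f) (trans (⟪⟫-θ10-split φ (λ z → ⟪ p ∣ (λ w → ⟪ act (∂W z) z w ∣ f ⟫) ⟫))
  (sym (cong₂ (λ a b → a - ⟪ φ ∣ δx₁ ⟫ * b) (cong₂ _+_ (⟪⟫-σ (θX φ) p f) (⟪⟫-σ (θY (πY φ)) p f)) (⟪⟫-σ (letter 1) p f))))

σ-swap : ∀ ψ p f → ⟪ σ ψ p ∣ f ⟫ ≡ ⟪ p ∣ (λ w → ⟪ ψ ∣ (λ z → ⟪ act (∂W z) z w ∣ f ⟫) ⟫) ⟫
σ-swap ψ p f = trans (⟪⟫-σ ψ p f) (⟪⟫-swap ψ p (λ z w → ⟪ act (∂W z) z w ∣ f ⟫))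

σ-θ10ʳ : ∀ ψ φ f → ⟪ σ ψ (θ10 φ) ∣ f ⟫ ≡ (⟪ σ ψ (θX φ) ∣ f ⟫ + ⟪ σ ψ (θY (πY φ)) ∣ f ⟫) - ⟪ φ ∣ δx₁ ⟫ * ⟪ σ ψ (letter 1) ∣ f ⟫
σ-θ10ʳ ψ φ f = trans (σ-swap ψ (θ10 φ) f) (trans (⟪⟫-θ10-split φ (λ w → ⟪ ψ ∣ (λ z → ⟪ act (∂W z) z w ∣ f ⟫) ⟫))
  (sym (cong₂ (λ a b → a - ⟪ φ ∣ δx₁ ⟫ * b) (cong₂ _+_ (σ-swap ψ (θX φ) f) (σ-swap ψ (θY (πY φ)) f)) (σ-swap ψ (letter 1) f))))

θ10-Lie : ∀ φ → StabX φ → LieB (θ10 φ)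
θ10-Lie φ st = WN.⟪⟫⇒≈₂ (Δ (θ10 φ)) (prim₂ (θ10 φ)) (λ F → let
    G = λ w → ⟪ ΔW w ∣ F ⟫
    P = λ w → F (w , []) + F ([] , w) in begin
    ⟪ Δ (θ10 φ) ∣ F ⟫ ≡⟨ ⟪⟫-Δ (θ10 φ) F ⟩
    ⟪ θ10 φ ∣ G ⟫ ≡⟨ ⟪⟫-θ10-split φ G ⟩
    (⟪ θX φ ∣ G ⟫ + ⟪ θY (πY φ) ∣ G ⟫) - ⟪ φ ∣ δx₁ ⟫ * ⟪ letter 1 ∣ G ⟫
      ≡⟨ cong₂ (λ a b → a - ⟪ φ ∣ δx₁ ⟫ * b) (cong₂ _+_ (onX F) (onYπ F)) (onx₁ F) ⟩
    (⟪ θX φ ∣ P ⟫ + ⟪ θY (πY φ) ∣ P ⟫) - ⟪ φ ∣ δx₁ ⟫ * ⟪ letter 1 ∣ P ⟫ ≡⟨ ⟪⟫-θ10-split φ P ⟨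
    ⟪ θ10 φ ∣ P ⟫ ≡⟨ ⟪⟫-prim₂ (θ10 φ) F ⟨
    ⟪ prim₂ (θ10 φ) ∣ F ⟫ ∎)
  where
  onX : ∀ F → ⟪ θX φ ∣ (λ w → ⟪ ΔW w ∣ F ⟫) ⟫ ≡ ⟪ θX φ ∣ (λ w → F (w , []) + F ([] , w)) ⟫
  onX F = begin
    ⟪ θX φ ∣ (λ w → ⟪ ΔW w ∣ F ⟫) ⟫ ≡⟨ ⟪⟫-θX φ (λ w → ⟪ ΔW w ∣ F ⟫) ⟩
    ⟪ φ ∣ (λ x → ⟪ ΔW (T x) ∣ F ⟫) ⟫ ≡⟨ ⟪⟫-cong φ (λ x → ⟪⟫-ΔW-map letterX x F) ⟩
    ⟪ φ ∣ (λ x → ⟪ ΔW x ∣ (λ (p , q) → F (T p , T q)) ⟫) ⟫ ≡⟨ LieX-⟪⟫ φ (proj₁ st) (λ (p , q) → F (T p , T q)) ⟩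
    ⟪ φ ∣ (λ x → F (T x , []) + F ([] , T x)) ⟫ ≡⟨ ⟪⟫-θX φ (λ w → F (w , []) + F ([] , w)) ⟨
    ⟪ θX φ ∣ (λ w → F (w , []) + F ([] , w)) ⟫ ∎
  onYπ : ∀ F → ⟪ θY (πY φ) ∣ (λ w → ⟪ ΔW w ∣ F ⟫) ⟫ ≡ ⟪ θY (πY φ) ∣ (λ w → F (w , []) + F ([] , w)) ⟫
  onYπ F = begin
    ⟪ θY (πY φ) ∣ (λ w → ⟪ ΔW w ∣ F ⟫) ⟫ ≡⟨ ⟪⟫-θYπY φ (λ w → ⟪ ΔW w ∣ F ⟫) ⟩
    ⟪ φ ∣ (λ x → onY (λ u → ⟪ ΔW (revB u) ∣ F ⟫) (sp x)) ⟫ ≡⟨ ⟪⟫-cong φ (λ x → onY-cong (λ u → ⟪⟫-ΔW-revB u F) (sp x)) ⟩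
    ⟪ φ ∣ (λ x → onY (λ u → ⟪ ΔW u ∣ (λ (p , q) → F (revB p , revB q)) ⟫) (sp x)) ⟫ ≡⟨ stab-πY-primitive φ st (λ (p , q) → F (revB p , revB q)) ⟩
    ⟪ φ ∣ (λ x → onY (λ u → F (revB u , []) + F ([] , revB u)) (sp x)) ⟫ ≡⟨ ⟪⟫-θYπY φ (λ w → F (w , []) + F ([] , w)) ⟨
    ⟪ θY (πY φ) ∣ (λ w → F (w , []) + F ([] , w)) ⟫ ∎
  onx₁ : ∀ F → ⟪ letter 1 ∣ (λ w → ⟪ ΔW w ∣ F ⟫) ⟫ ≡ ⟪ letter 1 ∣ (λ w → F (w , []) + F ([] , w)) ⟫
  onx₁ F = trans (⟪⟫-mon (1 ∷ []) (λ w → ⟪ ΔW w ∣ F ⟫)) (trans (⟪⟫-ΔW-∷ 1 [] F) (trans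
    (⟪⟫-single ([] , []) (λ (u , v) → F (1 ∷ u , v) + F (u , 1 ∷ v))) (sym (⟪⟫-mon (1 ∷ []) (λ w → F (w , []) + F ([] , w))))))

-- Conjugation with τ exchanges σ_a with σ_c and fixes the operator of b₁, which enters as θ_X(x₁)
-- and leaves as θ_Y(π_Y x₁).
θ10-τ : ∀ φ → StabX φ → ∀ p → σ⁰ (θ10 φ) (τ p) ≈N τ (σ⁰ (θ10 φ) p)
θ10-τ φ st p = WN.⟪⟫⇒≈ (σ⁰ (θ10 φ) (τ p)) (τ (σ⁰ (θ10 φ) p)) (λ f → begin
    ⟪ σ⁰ (θ10 φ) (τ p) ∣ f ⟫ ≡⟨ ⟪⟫-π₀ (σ (θ10 φ) (τ p)) f ⟩
    ⟪ σ (θ10 φ) (τ p) ∣ keep f ⟫ ≡⟨ σ-θ10ˡ φ (τ p) (keep f) ⟩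
    (⟪ σ (θX φ) (τ p) ∣ keep f ⟫ + ⟪ σ (θY (πY φ)) (τ p) ∣ keep f ⟫) - ⟪ φ ∣ δx₁ ⟫ * ⟪ σ (letter 1) (τ p) ∣ keep f ⟫
      ≡⟨ cong₂ (λ a b → a - ⟪ φ ∣ δx₁ ⟫ * b) (cong₂ _+_ (sym (τ-σC φ K p f)) (sym (A→C φ K f))) (sym (onx₁ f)) ⟩
    (⟪ σ (θY (πY φ)) p ∣ τ* f ⟫ + ⟪ σ (θX φ) p ∣ τ* f ⟫) - ⟪ φ ∣ δx₁ ⟫ * ⟪ σ (letter 1) p ∣ τ* f ⟫
      ≡⟨ cong (λ a → a - ⟪ φ ∣ δx₁ ⟫ * ⟪ σ (letter 1) p ∣ τ* f ⟫) (+-comm ⟪ σ (θY (πY φ)) p ∣ τ* f ⟫ ⟪ σ (θX φ) p ∣ τ* f ⟫) ⟩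
    (⟪ σ (θX φ) p ∣ τ* f ⟫ + ⟪ σ (θY (πY φ)) p ∣ τ* f ⟫) - ⟪ φ ∣ δx₁ ⟫ * ⟪ σ (letter 1) p ∣ τ* f ⟫ ≡⟨ σ-θ10ˡ φ p (τ* f) ⟨
    ⟪ σ (θ10 φ) p ∣ τ* f ⟫ ≡⟨ ⟪⟫-cong (σ (θ10 φ) p) (keep-τ* f) ⟨
    ⟪ σ (θ10 φ) p ∣ keep (τ* f) ⟫ ≡⟨ ⟪⟫-π₀ (σ (θ10 φ) p) (τ* f) ⟨
    ⟪ σ⁰ (θ10 φ) p ∣ τ* f ⟫ ≡⟨ ⟪⟫-τ (σ⁰ (θ10 φ) p) f ⟨
    ⟪ τ (σ⁰ (θ10 φ) p) ∣ f ⟫ ∎)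
  where
  K = stab-∂-formula φ st
  A→C : ∀ φ → ∂-formula φ → ∀ f → ⟪ σ (θX φ) p ∣ τ* f ⟫ ≡ ⟪ σ (θY (πY φ)) (τ p) ∣ keep f ⟫
  A→C φ K f = trans (⟪⟫-cong (σ (θX φ) p) (λ w → sym (τ*-keep f w))) (τ-σA φ K p (keep f))
  onx₁ : ∀ f → ⟪ σ (letter 1) p ∣ τ* f ⟫ ≡ ⟪ σ (letter 1) (τ p) ∣ keep f ⟫
  onx₁ f = trans (σ-congˡ (letter 1) (θX (letter x₁)) x₁-θX p (τ* f)) (trans (A→C (letter x₁) x₁-∂-formula f) (sym (σ-congˡ (letter 1) (θY (πY (letter x₁))) x₁-θY (τ p) (keep f))))

-- Compatibility with the Lie brackets

⟪⟫-mul-der-bracket : ∀ (φ₁ φ₂ d₁₂ d₂₁ : Poly A) f →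
  ⟪ d₁₂ ⊖ d₂₁ ⊕ br φ₁ φ₂ ∣ f ⟫ ≡ ⟪ mul φ₁ φ₂ ⊕ d₁₂ ∣ f ⟫ - ⟪ mul φ₂ φ₁ ⊕ d₂₁ ∣ f ⟫
⟪⟫-mul-der-bracket φ₁ φ₂ d₁₂ d₂₁ f = begin
  ⟪ d₁₂ ⊖ d₂₁ ⊕ br φ₁ φ₂ ∣ f ⟫ ≡⟨ ⟪⟫-++ (d₁₂ ⊖ d₂₁) (br φ₁ φ₂) f ⟩
  ⟪ d₁₂ ⊖ d₂₁ ∣ f ⟫ + ⟪ br φ₁ φ₂ ∣ f ⟫ ≡⟨ cong₂ _+_ (⟪⟫-⊖ d₁₂ d₂₁ f) (⟪⟫-⊖ (mul φ₁ φ₂) (mul φ₂ φ₁) f) ⟩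
  (⟪ d₁₂ ∣ f ⟫ - ⟪ d₂₁ ∣ f ⟫) + (⟪ mul φ₁ φ₂ ∣ f ⟫ - ⟪ mul φ₂ φ₁ ∣ f ⟫)
    ≡⟨ solve 4 (λ a b c d → (a :- b) :+ (c :- d) := (c :+ a) :- (d :+ b)) refl ⟪ d₁₂ ∣ f ⟫ ⟪ d₂₁ ∣ f ⟫ ⟪ mul φ₁ φ₂ ∣ f ⟫ ⟪ mul φ₂ φ₁ ∣ f ⟫ ⟩
  (⟪ mul φ₁ φ₂ ∣ f ⟫ + ⟪ d₁₂ ∣ f ⟫) - (⟪ mul φ₂ φ₁ ∣ f ⟫ + ⟪ d₂₁ ∣ f ⟫) ≡⟨ cong₂ _-_ (⟪⟫-++ (mul φ₁ φ₂) d₁₂ f) (⟪⟫-++ (mul φ₂ φ₁) d₂₁ f) ⟨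
  ⟪ mul φ₁ φ₂ ⊕ d₁₂ ∣ f ⟫ - ⟪ mul φ₂ φ₁ ⊕ d₂₁ ∣ f ⟫ ∎

⟪⟫-ihara : ∀ φ₁ φ₂ f → ⟪ ihara φ₁ φ₂ ∣ f ⟫ ≡ ⟪ sX φ₁ φ₂ ∣ f ⟫ - ⟪ sX φ₂ φ₁ ∣ f ⟫
⟪⟫-ihara φ₁ φ₂ = ⟪⟫-mul-der-bracket φ₁ φ₂ (dX φ₁ φ₂) (dX φ₂ φ₁)

⟪⟫-bracketA : ∀ ψ₁ ψ₂ f → ⟪ bracketA ψ₁ ψ₂ ∣ f ⟫ ≡ ⟪ σ ψ₁ ψ₂ ∣ f ⟫ - ⟪ σ ψ₂ ψ₁ ∣ f ⟫
⟪⟫-bracketA ψ₁ ψ₂ = ⟪⟫-mul-der-bracket ψ₁ ψ₂ (∂ ψ₁ ψ₂) (∂ ψ₂ ψ₁)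

-- On the subalgebra generated by b₀ and b₁, ∂_a is d_φ transported by θ_X: it kills b₀ and sends b₁
-- to [b₁, a].
σ-θX-θX : ∀ φ₁ φ₂ f → ⟪ σ (θX φ₁) (θX φ₂) ∣ f ⟫ ≡ ⟪ sX φ₁ φ₂ ∣ (λ x → f (T x)) ⟫
σ-θX-θX φ₁ φ₂ f = begin
    ⟪ σ (θX φ₁) (θX φ₂) ∣ f ⟫ ≡⟨ ⟪⟫-σA φ₁ (θX φ₂) f ⟩
    ⟪ φ₁ ∣ (λ x → ⟪ θX φ₂ ∣ (λ w → ⟪ actA x w ∣ f ⟫) ⟫) ⟫
      ≡⟨ ⟪⟫-cong φ₁ (λ x → trans (⟪⟫-θX φ₂ (λ w → ⟪ actA x w ∣ f ⟫)) (⟪⟫-cong φ₂ (λ y → pointwise x y))) ⟩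
    ⟪ φ₁ ∣ (λ x → ⟪ φ₂ ∣ (λ y → ⟪ act (dXW x) x y ∣ (λ x → f (T x)) ⟫) ⟫) ⟫ ≡⟨ ⟪⟫-sX φ₁ φ₂ (λ x → f (T x)) ⟨
    ⟪ sX φ₁ φ₂ ∣ (λ x → f (T x)) ⟫ ∎
  where
  der-T : ∀ x y f → ⟪ derW (∂A x) (T y) ∣ f ⟫ ≡ ⟪ derW (dXW x) y ∣ (λ z → f (T z)) ⟫
  letter-T : ∀ x a y f → ⟪ ∂A x (letterX a) ∣ (λ z → f (z ++ T y)) ⟫ ≡ ⟪ dXW x a ∣ (λ z → f (T (z ++ y))) ⟫
  letter-T x x₀ y f = refl
  letter-T x x₁ y f = trans (⟪⟫-br-mon (1 ∷ []) (T x) (λ z → f (z ++ T y))) (trans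
    (cong₂ (λ a b → f a - f b) (sym (map-++ letterX (x₁ ∷ x) y))
      (sym (trans (map-++ letterX (x ++ x₁ ∷ []) y) (cong (_++ T y) (map-++ letterX x (x₁ ∷ []))))))
    (sym (⟪⟫-br-mon (x₁ ∷ []) x (λ z → f (T (z ++ y))))))
  der-T x [] f = refl
  der-T x (a ∷ y) f = trans (⟪⟫-derW-∷ (∂A x) (letterX a) (T y) f) (trans
    (cong₂ _+_ (letter-T x a y f) (der-T x y (λ z → f (letterX a ∷ z))))
    (sym (⟪⟫-derW-∷ (dXW x) a y (λ z → f (T z)))))
  pointwise : ∀ x y → ⟪ actA x (T y) ∣ f ⟫ ≡ ⟪ act (dXW x) x y ∣ (λ x → f (T x)) ⟫
  pointwise x y = cong₂ (λ a b → 1ℚ * f a + b) (sym (map-++ letterX x y)) (der-T x y f)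

⟪⟫-τ-θX : ∀ φ f → ⟪ θY (πY φ) ∣ f ⟫ ≡ ⟪ τ (θX φ) ∣ f ⟫
⟪⟫-τ-θX φ f = trans (⟪⟫-θYπY-τ φ f) (sym (trans (⟪⟫-τ (θX φ) f) (⟪⟫-θX φ (τ* f))))

-- As c₂ = τ(a₂), conjugation with τ turns σ_{c₁}(c₂) into τ(σ_{a₁}(a₂)).
σ-θY-θY : ∀ φ₁ φ₂ → ∂-formula φ₁ → ∀ f → ⟪ σ (θY (πY φ₁)) (θY (πY φ₂)) ∣ f ⟫ ≡ ⟪ sX φ₁ φ₂ ∣ (λ x → τ* f (T x)) ⟫
σ-θY-θY φ₁ φ₂ K f = begin
  ⟪ σ (θY (πY φ₁)) (θY (πY φ₂)) ∣ f ⟫ ≡⟨ σ-congʳ (θY (πY φ₁)) (θY (πY φ₂)) (τ (θX φ₂)) (⟪⟫-τ-θX φ₂) f ⟩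
  ⟪ σ (θY (πY φ₁)) (τ (θX φ₂)) ∣ f ⟫ ≡⟨ τ-σA φ₁ K (θX φ₂) f ⟨
  ⟪ σ (θX φ₁) (θX φ₂) ∣ τ* f ⟫ ≡⟨ σ-θX-θX φ₁ φ₂ (τ* f) ⟩
  ⟪ sX φ₁ φ₂ ∣ (λ x → τ* f (T x)) ⟫ ∎

revB-map : ∀ u → ∃ λ v → revB u ≡ map suc v
revB-map [] = [] , refl
revB-map (k ∷ u) = let v , e = revB-map u in
  v ++ k ∷ [] , trans (cong (_++ suc k ∷ []) e) (sym (map-++ suc v (k ∷ [])))

-- σ_a(b_i w) = a b_i w + [b_i, a] w + b_i ∂_a(w) = b_i σ_a(w) for i ≥ 1, so a travels to the right
-- end of a word without b₀.
⟪⟫-actA-suc : ∀ x v f → ⟪ actA x (map suc v) ∣ f ⟫ ≡ f (map suc v ++ T x)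
⟪⟫-actA-suc x [] f = trans (⟪⟫-mon (T x ++ []) f) (cong f (++-identityʳ (T x)))
⟪⟫-actA-suc x (k ∷ v) f = begin
    ⟪ actA x (suc k ∷ w) ∣ f ⟫ ≡⟨ ⟪⟫-act (∂A x) (T x) (suc k ∷ w) f ⟩
    f (T x ++ suc k ∷ w) + ⟪ derW (∂A x) (suc k ∷ w) ∣ f ⟫
      ≡⟨ cong (f (T x ++ suc k ∷ w) +_) (trans (⟪⟫-derW-∷ (∂A x) (suc k) w f) (cong (_+ D) (⟪⟫-br-mon (suc k ∷ []) (T x) (λ z → f (z ++ w))))) ⟩
    f (T x ++ suc k ∷ w) + ((f (suc k ∷ T x ++ w) - f ((T x ++ suc k ∷ []) ++ w)) + D)
      ≡⟨ cong (λ z → f (T x ++ suc k ∷ w) + ((f (suc k ∷ T x ++ w) - f z) + D)) (++-assoc (T x) (suc k ∷ []) w) ⟩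
    f (T x ++ suc k ∷ w) + ((f (suc k ∷ T x ++ w) - f (T x ++ suc k ∷ w)) + D)
      ≡⟨ solve 3 (λ a b d → a :+ ((b :- a) :+ d) := b :+ d) refl (f (T x ++ suc k ∷ w)) (f (suc k ∷ T x ++ w)) D ⟩
    f (suc k ∷ T x ++ w) + D ≡⟨ ⟪⟫-act (∂A x) (T x) w (λ z → f (suc k ∷ z)) ⟨
    ⟪ actA x w ∣ (λ z → f (suc k ∷ z)) ⟫ ≡⟨ ⟪⟫-actA-suc x v (λ z → f (suc k ∷ z)) ⟩
    f (suc k ∷ w ++ T x) ∎
  where
  w = map suc v
  D = ⟪ derW (∂A x) w ∣ (λ z → f (suc k ∷ z)) ⟫

⟪⟫-actA-revB : ∀ x u f → ⟪ actA x (revB u) ∣ f ⟫ ≡ f (revB u ++ T x)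
⟪⟫-actA-revB x u f with revB u | revB-map u
... | _ | v , refl = ⟪⟫-actA-suc x v f

-- The derivation kills b₁ as well as b₀, because the commutator with x₀^m is zero at m = 0.
⟪⟫-derC-T : ∀ y x f → ⟪ derW (∂C y) (T x) ∣ f ⟫ ≡ 0ℚ
⟪⟫-derC-T y [] f = refl
⟪⟫-derC-T y (x₀ ∷ x) f = trans (⟪⟫-derW-∷ (∂C y) 0 (T x) f) (trans (+-identityˡ _) (⟪⟫-derC-T y x (λ z → f (0 ∷ z))))
⟪⟫-derC-T y (x₁ ∷ x) f = trans (⟪⟫-derW-∷ (∂C y) 1 (T x) f) (cong₂ _+_
    (trans (⟪⟫-∂C y 0 (λ z → f (z ++ T x))) (P₀ (proj₁ (sp y)) (proj₂ (sp y)))) (⟪⟫-derC-T y x (λ z → f (1 ∷ z))))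
  where
  raiseW-0 : ∀ u → raiseW 0 u ≡ u
  raiseW-0 [] = refl
  raiseW-0 (_ ∷ _) = refl
  P₀ : ∀ u r → Pm 0 (λ v → f (revB v ++ T x)) (u , r) ≡ 0ℚ
  P₀ u r = trans (cong₂ (λ a b → f (revB (u ++ a ∷ []) ++ T x) - f (revB b ++ T x)) (ℕₚ.+-identityʳ r) (raiseW-0 (u ++ r ∷ [])))
    (+-inverseʳ (f (revB (u ++ r ∷ []) ++ T x)))

-- Both sides equal the product θ_Y(π_Y φ₂) θ_X(φ₁).
σ-cross : ∀ φ₁ φ₂ → ∂-formula φ₂ → ∀ f → ⟪ σ (θX φ₁) (θY (πY φ₂)) ∣ f ⟫ ≡ ⟪ σ (θY (πY φ₂)) (θX φ₁) ∣ f ⟫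
σ-cross φ₁ φ₂ K f = begin
  ⟪ σ (θX φ₁) (θY (πY φ₂)) ∣ f ⟫ ≡⟨ ⟪⟫-σA φ₁ (θY (πY φ₂)) f ⟩
  ⟪ φ₁ ∣ (λ x → ⟪ θY (πY φ₂) ∣ (λ w → ⟪ actA x w ∣ f ⟫) ⟫) ⟫
    ≡⟨ ⟪⟫-cong φ₁ (λ x → trans (⟪⟫-θYπY φ₂ (λ w → ⟪ actA x w ∣ f ⟫)) (⟪⟫-cong φ₂ (λ y → onY-cong (λ u → ⟪⟫-actA-revB x u f) (sp y)))) ⟩
  ⟪ φ₁ ∣ (λ x → ⟪ φ₂ ∣ (λ y → onY (λ u → f (revB u ++ T x)) (sp y)) ⟫) ⟫
    ≡⟨ ⟪⟫-swap φ₁ φ₂ (λ x y → onY (λ u → f (revB u ++ T x)) (sp y)) ⟩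
  ⟪ φ₂ ∣ (λ y → ⟪ φ₁ ∣ (λ x → onY (λ u → f (revB u ++ T x)) (sp y)) ⟫) ⟫
    ≡⟨ ⟪⟫-cong φ₂ (λ y → trans (⟪⟫-θX φ₁ (λ w → ⟪ actC y w ∣ f ⟫)) (⟪⟫-cong φ₁ (λ x →
         trans (⟪⟫-actC y (T x) f) (trans (cong (onY (λ u → f (revB u ++ T x)) (sp y) +_) (⟪⟫-derC-T y x f)) (+-identityʳ _))))) ⟨
  ⟪ φ₂ ∣ (λ y → ⟪ θX φ₁ ∣ (λ w → ⟪ actC y w ∣ f ⟫) ⟫) ⟫ ≡⟨ ⟪⟫-σC φ₂ K (θX φ₁) f ⟨
  ⟪ σ (θY (πY φ₂)) (θX φ₁) ∣ f ⟫ ∎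

σ-x₁-θX : ∀ φ f → ⟪ σ (θX φ) (letter 1) ∣ f ⟫ ≡ ⟪ σ (letter 1) (θX φ) ∣ f ⟫
σ-x₁-θX φ f = trans (σ-congʳ (θX φ) (letter 1) (θY (πY (letter x₁))) x₁-θY f) (trans (σ-cross φ (letter x₁) x₁-∂-formula f)
  (sym (σ-congˡ (letter 1) (θY (πY (letter x₁))) x₁-θY (θX φ) f)))

σ-x₁-θY : ∀ φ → ∂-formula φ → ∀ f → ⟪ σ (letter 1) (θY (πY φ)) ∣ f ⟫ ≡ ⟪ σ (θY (πY φ)) (letter 1) ∣ f ⟫
σ-x₁-θY φ K f = trans (σ-congˡ (letter 1) (θX (letter x₁)) x₁-θX (θY (πY φ)) f) (trans (σ-cross (letter x₁) φ K f)
  (sym (σ-congʳ (θY (πY φ)) (letter 1) (θX (letter x₁)) x₁-θX f)))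

-- Either one of `x`, `y` is empty and the words agree, or both words have at least two letters. The
-- context `u`, `v` makes the property stable under the induction in `⟪⟫-derW-perm`.
δx₁-perm : ∀ u x y v → δx₁ (u ++ x ++ y ++ v) ≡ δx₁ (u ++ y ++ x ++ v)
δx₁-perm u [] y v = refl
δx₁-perm u (a ∷ x) [] v = refl
δx₁-perm u (a ∷ x) (b ∷ y) v = trans (long a x b (y ++ v)) (sym (long b y a (x ++ v)))
  where
  long : ∀ a x b z → δx₁ (u ++ (a ∷ x) ++ b ∷ z) ≡ 0ℚ
  long a x b z = WX.δW-≢ (x₁ ∷ []) (u ++ (a ∷ x) ++ b ∷ z) (λ e → two (length u) (length x) (length z)
    (trans (sym (trans (length-++ u {(a ∷ x) ++ b ∷ z}) (cong (λ n → length u ℕ.+ suc n) (length-++ x {b ∷ z})))) (cong length e)))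
    where
    two : ∀ l m n → l ℕ.+ suc (m ℕ.+ suc n) ≢ 1
    two l m n e with trans (sym (trans (ℕₚ.+-suc l (m ℕ.+ suc n)) (cong suc (trans (cong (l ℕ.+_) (ℕₚ.+-suc m n)) (ℕₚ.+-suc l (m ℕ.+ n)))))) e
    ... | ()

⟪⟫-derW-perm : ∀ x y (f : Word X → ℚ) → (∀ u x y v → f (u ++ x ++ y ++ v) ≡ f (u ++ y ++ x ++ v)) → ⟪ derW (dXW x) y ∣ f ⟫ ≡ 0ℚ
⟪⟫-derW-perm x [] f e = refl
⟪⟫-derW-perm x (a ∷ y) f e = trans (⟪⟫-derW-∷ (dXW x) a y f)
    (cong₂ _+_ (onLetter a) (⟪⟫-derW-perm x y (λ z → f (a ∷ z)) (λ u x y v → e (a ∷ u) x y v)))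
  where
  onLetter : ∀ a → ⟪ dXW x a ∣ (λ z → f (z ++ y)) ⟫ ≡ 0ℚ
  onLetter x₀ = refl
  onLetter x₁ = trans (⟪⟫-br-mon (x₁ ∷ []) x (λ z → f (z ++ y))) (trans
    (cong (λ a → f (x₁ ∷ x ++ y) - a) (trans (cong f (++-assoc x (x₁ ∷ []) y)) (e [] x (x₁ ∷ []) y))) (+-inverseʳ (f (x₁ ∷ x ++ y))))

-- The bracket is a combination of terms u [x, y] v, which have no coefficient at x₁; so the b₁
-- correction in θ^(10) of a bracket vanishes.
ihara-δx₁ : ∀ φ₁ φ₂ → ⟪ ihara φ₁ φ₂ ∣ δx₁ ⟫ ≡ 0ℚ
ihara-δx₁ φ₁ φ₂ = begin
    ⟪ ihara φ₁ φ₂ ∣ δx₁ ⟫ ≡⟨ ⟪⟫-ihara φ₁ φ₂ δx₁ ⟩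
    ⟪ sX φ₁ φ₂ ∣ δx₁ ⟫ - ⟪ sX φ₂ φ₁ ∣ δx₁ ⟫ ≡⟨ cong₂ _-_ (product φ₁ φ₂) (trans (product φ₂ φ₁) (⟪⟫-swap φ₂ φ₁ (λ y x → δx₁ (y ++ x)))) ⟩
    ⟪ φ₁ ∣ (λ x → ⟪ φ₂ ∣ (λ y → δx₁ (x ++ y)) ⟫) ⟫ - ⟪ φ₁ ∣ (λ x → ⟪ φ₂ ∣ (λ y → δx₁ (y ++ x)) ⟫) ⟫
      ≡⟨ cong (λ a → a - ⟪ φ₁ ∣ (λ x → ⟪ φ₂ ∣ (λ y → δx₁ (y ++ x)) ⟫) ⟫) (⟪⟫-cong φ₁ (λ x → ⟪⟫-cong φ₂ (λ y → commute x y))) ⟩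
    ⟪ φ₁ ∣ (λ x → ⟪ φ₂ ∣ (λ y → δx₁ (y ++ x)) ⟫) ⟫ - ⟪ φ₁ ∣ (λ x → ⟪ φ₂ ∣ (λ y → δx₁ (y ++ x)) ⟫) ⟫
      ≡⟨ +-inverseʳ ⟪ φ₁ ∣ (λ x → ⟪ φ₂ ∣ (λ y → δx₁ (y ++ x)) ⟫) ⟫ ⟩
    0ℚ ∎
  where
  product : ∀ φ₁ φ₂ → ⟪ sX φ₁ φ₂ ∣ δx₁ ⟫ ≡ ⟪ φ₁ ∣ (λ x → ⟪ φ₂ ∣ (λ y → δx₁ (x ++ y)) ⟫) ⟫
  product φ₁ φ₂ = trans (⟪⟫-sX φ₁ φ₂ δx₁) (⟪⟫-cong φ₁ (λ x → ⟪⟫-cong φ₂ (λ y →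
    trans (⟪⟫-act (dXW x) x y δx₁) (trans (cong (δx₁ (x ++ y) +_) (⟪⟫-derW-perm x y δx₁ δx₁-perm)) (+-identityʳ (δx₁ (x ++ y)))))))
  commute : ∀ x y → δx₁ (x ++ y) ≡ δx₁ (y ++ x)
  commute x y = trans (cong (λ z → δx₁ (x ++ z)) (sym (++-identityʳ y))) (trans (δx₁-perm [] x y [])
    (cong (λ z → δx₁ (y ++ z)) (++-identityʳ x)))

σ-θ10-θ10 : ∀ φ₁ φ₂ f → let l = ⟪ φ₁ ∣ δx₁ ⟫ ; m = ⟪ φ₂ ∣ δx₁ ⟫ ; b = letter 1 ; S = λ ψ p → ⟪ σ ψ p ∣ f ⟫ in
  S (θ10 φ₁) (θ10 φ₂)
  ≡ (((S (θX φ₁) (θX φ₂) + S (θX φ₁) (θY (πY φ₂))) - m * S (θX φ₁) b)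
   + ((S (θY (πY φ₁)) (θX φ₂) + S (θY (πY φ₁)) (θY (πY φ₂))) - m * S (θY (πY φ₁)) b))
   - l * ((S b (θX φ₂) + S b (θY (πY φ₂))) - m * S b b)
σ-θ10-θ10 φ₁ φ₂ f = trans (σ-θ10ˡ φ₁ (θ10 φ₂) f) (cong₂ (λ a b → a - ⟪ φ₁ ∣ δx₁ ⟫ * b)
  (cong₂ _+_ (σ-θ10ʳ (θX φ₁) φ₂ f) (σ-θ10ʳ (θY (πY φ₁)) φ₂ f)) (σ-θ10ʳ (letter 1) φ₂ f))

θ10-bracket : ∀ φ₁ φ₂ → ∂-formula φ₁ → ∂-formula φ₂ → θ10 (ihara φ₁ φ₂) ≈N bracketA (θ10 φ₁) (θ10 φ₂)
θ10-bracket φ₁ φ₂ K₁ K₂ = WN.⟪⟫⇒≈ (θ10 (ihara φ₁ φ₂)) (bracketA (θ10 φ₁) (θ10 φ₂)) (λ f → begin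
    ⟪ θ10 (ihara φ₁ φ₂) ∣ f ⟫ ≡⟨ ⟪⟫-θ10-split (ihara φ₁ φ₂) f ⟩
    (⟪ θX (ihara φ₁ φ₂) ∣ f ⟫ + ⟪ θY (πY (ihara φ₁ φ₂)) ∣ f ⟫) - ⟪ ihara φ₁ φ₂ ∣ δx₁ ⟫ * ⟪ b ∣ f ⟫
      ≡⟨ cong₂ (λ x y → x - y * ⟪ b ∣ f ⟫) (cong₂ _+_
           (trans (⟪⟫-θX (ihara φ₁ φ₂) f) (trans (⟪⟫-ihara φ₁ φ₂ (λ x → f (T x))) (sym (cong₂ _-_ (σ-θX-θX φ₁ φ₂ f) (σ-θX-θX φ₂ φ₁ f)))))
           (trans (⟪⟫-θYπY-τ (ihara φ₁ φ₂) f) (trans (⟪⟫-ihara φ₁ φ₂ (λ x → τ* f (T x))) (sym (cong₂ _-_ (σ-θY-θY φ₁ φ₂ K₁ f) (σ-θY-θY φ₂ φ₁ K₂ f))))))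
           (ihara-δx₁ φ₁ φ₂) ⟩
    ((S a₁ a₂ f - S a₂ a₁ f) + (S c₁ c₂ f - S c₂ c₁ f)) - 0ℚ * ⟪ b ∣ f ⟫
      ≡⟨ cancel (S a₁ a₂ f) (S a₂ a₁ f) (S c₁ c₂ f) (S c₂ c₁ f) ⟪ b ∣ f ⟫ l m (S b b f)
           (σ-cross φ₁ φ₂ K₂ f) (sym (σ-cross φ₂ φ₁ K₁ f))
           (σ-x₁-θX φ₁ f) (sym (σ-x₁-θY φ₁ K₁ f)) (sym (σ-x₁-θX φ₂ f)) (σ-x₁-θY φ₂ K₂ f) ⟩
    (((S a₁ a₂ f + S a₁ c₂ f) - m * S a₁ b f) + ((S c₁ a₂ f + S c₁ c₂ f) - m * S c₁ b f) - l * ((S b a₂ f + S b c₂ f) - m * S b b f))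
    - (((S a₂ a₁ f + S a₂ c₁ f) - l * S a₂ b f) + ((S c₂ a₁ f + S c₂ c₁ f) - l * S c₂ b f) - m * ((S b a₁ f + S b c₁ f) - l * S b b f))
      ≡⟨ cong₂ _-_ (σ-θ10-θ10 φ₁ φ₂ f) (σ-θ10-θ10 φ₂ φ₁ f) ⟨
    S (θ10 φ₁) (θ10 φ₂) f - S (θ10 φ₂) (θ10 φ₁) f ≡⟨ ⟪⟫-bracketA (θ10 φ₁) (θ10 φ₂) f ⟨
    ⟪ bracketA (θ10 φ₁) (θ10 φ₂) ∣ f ⟫ ∎)
  where
  S : Poly B → Poly B → (Word B → ℚ) → ℚ
  S ψ p f = ⟪ σ ψ p ∣ f ⟫
  a₁ = θX φ₁
  a₂ = θX φ₂
  c₁ = θY (πY φ₁)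
  c₂ = θY (πY φ₂)
  b : Poly B
  b = letter 1
  l = ⟪ φ₁ ∣ δx₁ ⟫
  m = ⟪ φ₂ ∣ δx₁ ⟫
  cancel : ∀ aa aa′ cc cc′ z l m bb {ac ca′ ca ac′ ab ba cb bc ba₂ ab₂ bc₂ cb₂ : ℚ} →
    ac ≡ ca′ → ca ≡ ac′ → ab ≡ ba → cb ≡ bc → ba₂ ≡ ab₂ → bc₂ ≡ cb₂ →
    ((aa - aa′) + (cc - cc′)) - 0ℚ * z
    ≡ (((aa + ac) - m * ab) + ((ca + cc) - m * cb) - l * ((ba₂ + bc₂) - m * bb))
      - (((aa′ + ac′) - l * ab₂) + ((ca′ + cc′) - l * cb₂) - m * ((ba + bc) - l * bb))
  -- With the cross terms identified, those between a and c, those with b₁, and the two multiples of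
  -- σ_{b₁}(b₁) cancel in pairs.
  cancel aa aa′ cc cc′ z l m bb {ac} {_} {ca} {_} {ab} {_} {cb} {_} {ba₂} {_} {bc₂} refl refl refl refl refl refl =
    solve 14 (λ aa aa′ cc cc′ z l m bb ac ca ab cb ba₂ bc₂ →
      ((aa :- aa′) :+ (cc :- cc′)) :- con 0ℚ :* z
      := (((aa :+ ac) :- m :* ab) :+ ((ca :+ cc) :- m :* cb) :- l :* ((ba₂ :+ bc₂) :- m :* bb))
         :- (((aa′ :+ ca) :- l :* ba₂) :+ ((ac :+ cc′) :- l :* bc₂) :- m :* ((ab :+ cb) :- l :* bb)))
      refl aa aa′ cc cc′ z l m bb ac ca ab cb ba₂ bc₂

-- Injectivity

letterX-injective : ∀ a b → letterX a ≡ letterX b → a ≡ b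
letterX-injective x₀ x₀ _ = refl
letterX-injective x₁ x₁ _ = refl

δ-T : ∀ w x → WN.δW (T w) (T x) ≡ WX.δW w x
δ-T w x = [ (λ { refl → trans (WN.δW-refl (T w)) (sym (WX.δW-refl w)) }) , unequal ]′ (Delta.δ-dec WX.δW-delta w x)
  where
  0≢1 : 0ℚ ≢ 1ℚ
  0≢1 ()
  T-injective : ∀ {x w} → T x ≡ T w → x ≡ w
  T-injective = map-injective (λ {a} {b} → letterX-injective a b)
  unequal : WX.δW w x ≡ 0ℚ → WN.δW (T w) (T x) ≡ WX.δW w x
  unequal e = trans (WN.δW-≢ (T w) (T x) (λ eq → 0≢1 (trans (sym e) (trans (cong (WX.δW w) (T-injective eq)) (WX.δW-refl w))))) (sym e)

-- The two summands θ_X and θ_Y ∘ π_Y overlap only on the powers of b₁.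
data Shape : Word X → Set where
  withZero : ∀ {w} → 0 ∈ T w → Shape w
  power : ∀ n → Shape (replicate n x₁)

shape : ∀ w → Shape w
shape [] = power 0
shape (x₀ ∷ w) = withZero (here refl)
shape (x₁ ∷ w) with shape w
... | withZero z = withZero (there z)
... | power n = power (suc n)

0∉map-suc : ∀ v → 0 ∈ map suc v → ⊥
0∉map-suc (_ ∷ v) (there z) = 0∉map-suc v z

-- No word in the image of θ_Y contains b₀.
τ*-δ-zero : ∀ {v} → 0 ∈ v → ∀ x → τ* (WN.δW v) (T x) ≡ 0ℚ
τ*-δ-zero {v} z x = trans (sym (onY-revB (WN.δW v) x)) (cases (sp x))
  where
  cases : ∀ s → onY (λ u → WN.δW v (revB u)) s ≡ 0ℚ
  cases (u , suc _) = refl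
  cases (u , zero) = WN.δW-≢ v (revB u) (λ e → let u′ , e′ = revB-map u in 0∉map-suc u′ (subst (0 ∈_) (trans (sym e) e′) z))

τW-power : ∀ n → τW 0 (replicate n 1) ≡ just (replicate n 1)
τW-power zero = refl
τW-power (suc n) = trans (τW-suc 0 0 (replicate n 1) (τW-power n)) (cong just (sym (replicate-snoc n 1)))

-- τ fixes b₁^n and, being an involution on products of blocks, sends no other word to it.
τ*-δ-power : ∀ n w → τ* (WN.δW (replicate n 1)) w ≡ WN.δW (replicate n 1) w
τ*-δ-power n w with ending w
... | zeroEnd w′ = trans (τ*-snoc-0 (WN.δW p) w′) (sym (WN.δW-≢ p (w′ ++ 0 ∷ [])
        (λ e → just≢nothing (trans (sym (τW-power n)) (trans (cong (τW 0) (sym e)) (τW-snoc-0 0 w′))))))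
  where
  p = replicate n 1
  just≢nothing : just p ≢ nothing
  just≢nothing ()
... | blocks bs = trans (τ*-word (WN.δW p) bs) (cases (≡-dec ℕ._≟_ (word bs) p))
  where
  p = replicate n 1
  flip : ∀ cs → word cs ≡ p → word (rs cs) ≡ p
  flip cs e = just-injective (trans (sym (τW-word cs)) (trans (cong (τW 0) e) (τW-power n)))
  cases : Dec (word bs ≡ p) → WN.δW p (word (rs bs)) ≡ WN.δW p (word bs)
  cases (yes e) = cong (WN.δW p) (trans (flip bs e) (sym e))
  cases (no ne) = trans (WN.δW-≢ p (word (rs bs)) (λ e → ne (trans (cong word (sym (rs-involutive bs))) (flip (rs bs) e))))
    (sym (WN.δW-≢ p (word bs) ne))

-- A left inverse of θ^(10), one coefficient at a time. A word with x₀ is read off at its image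
-- under θ_X, which θ_Y does not reach; for a power of x₁ both summands contribute.
θ10-separates : ∀ w → ∃ λ f → ∀ x → θ10* f x ≡ WX.δW w x
θ10-separates w with shape w
... | withZero z = WN.δW (T w) , λ x → trans
      (cong₂ _-_ (cong₂ _+_ (δ-T w x) (τ*-δ-zero z x)) (cong (δx₁ x *_) (WN.δW-≢ (T w) (1 ∷ []) (λ e → 0∉map-suc (0 ∷ []) (subst (0 ∈_) (sym e) z)))))
      (solve 2 (λ a b → (a :+ con 0ℚ) :- b :* con 0ℚ := a) refl (WX.δW w x) (δx₁ x))
... | power n = separating n
  where
  T-power : ∀ n → T (replicate n x₁) ≡ replicate n 1
  T-power n = map-replicate letterX n x₁
  δ-power : ∀ n x → WN.δW (replicate n 1) (T x) ≡ WX.δW (replicate n x₁) x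
  δ-power n x = trans (cong (λ v → WN.δW v (T x)) (sym (T-power n))) (δ-T (replicate n x₁) x)
  -- θ_X and θ_Y π_Y each contribute the coefficient of x₁^n once, so it is doubled and the test
  -- function carries `½`.
  halves : ∀ n → WN.δW (replicate n 1) (1 ∷ []) ≡ 0ℚ → ∃ λ f → ∀ x → θ10* f x ≡ WX.δW (replicate n x₁) x
  halves n e = f , λ x → trans
      (cong₂ _-_ (cong₂ _+_ (cong (½ *_) (δ-power n x)) (trans (scaled (T x)) (cong (½ *_) (trans (τ*-δ-power n (T x)) (δ-power n x)))))
        (cong (λ c → δx₁ x * (½ * c)) e))
      (solve 2 (λ a b → (con ½ :* a :+ con ½ :* a) :- b :* (con ½ :* con 0ℚ) := a) refl (WX.δW (replicate n x₁) x) (δx₁ x))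
    where
    f : Word B → ℚ
    f v = ½ * WN.δW (replicate n 1) v
    scaled : ∀ v → τ* f v ≡ ½ * τ* (WN.δW (replicate n 1)) v
    scaled v with τW 0 v
    ... | just _ = refl
    ... | nothing = refl
  separating : ∀ n → ∃ λ f → ∀ x → θ10* f x ≡ WX.δW (replicate n x₁) x
  separating zero = halves 0 (WN.δW-≢ [] (1 ∷ []) (λ ()))
  separating (suc (suc n)) = halves (suc (suc n)) (WN.δW-≢ (replicate (suc (suc n)) 1) (1 ∷ []) (λ ()))
  -- For n = 1 the term -λ₁ b₁ already removes the doubling, so the factor `½` is absent.
  separating (suc zero) = WN.δW (1 ∷ []) , λ x → trans
    (cong₂ _-_ (cong₂ _+_ (δ-power 1 x) (trans (τ*-δ-power 1 (T x)) (δ-power 1 x))) (cong (δx₁ x *_) (WN.δW-refl (1 ∷ []))))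
    (solve 1 (λ a → (a :+ a) :- a :* con 1ℚ := a) refl (δx₁ x))

θ10-injective : ∀ φ₁ φ₂ → θ10 φ₁ ≈N θ10 φ₂ → φ₁ ≈X φ₂
θ10-injective φ₁ φ₂ e w = begin
    coeffX φ₁ w ≡⟨ recover φ₁ ⟩
    ⟪ θ10 φ₁ ∣ f ⟫ ≡⟨ WN.≈⇒⟪⟫ (θ10 φ₁) (θ10 φ₂) e f ⟩
    ⟪ θ10 φ₂ ∣ f ⟫ ≡⟨ recover φ₂ ⟨
    coeffX φ₂ w ∎
  where
  f = proj₁ (θ10-separates w)
  recover : ∀ φ → coeffX φ w ≡ ⟪ θ10 φ ∣ f ⟫
  recover φ = trans (WX.coeff-⟪⟫ φ w) (trans (⟪⟫-cong φ (λ x → sym (proj₂ (θ10-separates w) x))) (sym (⟪⟫-θ10 φ f)))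

theorem3p2 : (∀ φ → StabX φ → StabB (θ10 φ))
    × (∀ (a b : ℚ) φ₁ φ₂ → StabX φ₁ → StabX φ₂ →
    θ10 (a · φ₁ ⊕ b · φ₂) ≈N (a · θ10 φ₁ ⊕ b · θ10 φ₂))
    × (∀ φ₁ φ₂ → StabX φ₁ → StabX φ₂ →
    θ10 (ihara φ₁ φ₂) ≈N bracketA (θ10 φ₁) (θ10 φ₂))
    × (∀ φ₁ φ₂ → StabX φ₁ → StabX φ₂ → θ10 φ₁ ≈N θ10 φ₂ → φ₁ ≈X φ₂)
theorem3p2 =
    (λ φ st → θ10-Lie φ st , λ p _ → θ10-τ φ st p)
  , (λ a b φ₁ φ₂ _ _ → θ10-linear a b φ₁ φ₂)
  , (λ φ₁ φ₂ st₁ st₂ → θ10-bracket φ₁ φ₂ (stab-∂-formula φ₁ st₁) (stab-∂-formula φ₂ st₂))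
  , (λ φ₁ φ₂ _ _ → θ10-injective φ₁ φ₂)
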